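{- For any integers $s\ge 1$, $t\ge 2$ and $n\ge k+1$ (with $k\ge 1$), $$ex(n,K^*_{s,t},\mathcal{L}_{n,k})=\max\Bigg\{\binom{k}{s+t}\binom{s+t}{t},\ \binom{\left\lfloor\frac{k-1}{2}\right\rfloor}{s}\binom{n-s}{t}+\left(n-\left\lceil\frac{k+1}{2}\right\rceil\right)\binom{\left\lfloor\frac{k-1}{2}\right\rfloor}{s-1}\binom{\left\lfloor\frac{k-1}{2}\right\rfloor-s+1}{t}+\left(\binom{\left\lceil\frac{k+1}{2}\right\rceil}{s}-\binom{\left\lfloor\frac{k-1}{2}\right\rfloor}{s}\right)\binom{\left\lceil\frac{k+1}{2}\right\rceil-s}{t}\Bigg\}.$$
   Context: All graphs are simple. For a family of graphs $\mathcal{F}$, a graph $G$ is $\mathcal{F}$-free if no subgraph of $G$ is isomorphic to a member of $\mathcal{F}$. For a graph $T$, $ex(n,T,\mathcal{F})$ denotes the maximum number of (not necessarily induced) copies of $T$ in an $\mathcal{F}$-free graph on $n$ vertices. A linear forest is a graph whose connected components are all paths or isolated vertices. $\mathcal{L}_{n,k}$ denotes the family of all linear forests on $n$ vertices with exactly $k$ edges. $K^*_{s,t}$ is the graph obtained from the complete bipartite graph $K_{s,t}$ by replacing the part of size $s$ with a clique on those $s$ vertices (i.e. adding all edges inside the part of size $s$). -}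

module Defs where

open import Data.Nat using (ℕ; zero; suc; _+_; _*_; _∸_; _≤_; _<ᵇ_; _≡ᵇ_; _/_)
open import Data.Nat.Combinatorics using (_C_)
open import Data.Bool using (Bool; true; false; _∧_; _∨_; not; if_then_else_)
open import Data.Fin using (Fin; zero; suc; toℕ)
open import Data.Fin.Properties using () renaming (_≟_ to _≟F_)
open import Data.List using (List; []; _∷_; [_]; map; concatMap; filter; length; foldr)
open import Data.Nat.ListAction using (sum)
open import Data.Product using (Σ; _×_; _,_; ∃)
open import Relation.Nullary using (¬_; does)
open import Relation.Nullary.Decidable using (⌊_⌋)
open import Relation.Binary.PropositionalEquality using (_≡_)
open import Data.List using (allFin)

record Graph (n : ℕ) : Set where
  field
    adj    : Fin n → Fin n → Bool
    sym    : ∀ i j → adj i j ≡ adj j i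
    irrefl : ∀ i → adj i i ≡ false
open Graph public

-- A "pattern" graph on Fin m, given by its adjacency relation (the
-- patterns below are symmetric and irreflexive by construction).
Pattern : ℕ → Set
Pattern m = Fin m → Fin m → Bool

Contains : ∀ {n m} → Graph n → Pattern m → Set
Contains {n} {m} G H =
  Σ (Fin m → Fin n) λ f →
    (∀ i j → f i ≡ f j → i ≡ j) ×
    (∀ i j → H i j ≡ true → adj G (f i) (f j) ≡ true)

anyB : ∀ {A : Set} → (A → Bool) → List A → Bool
anyB p = foldr (λ x b → p x ∨ b) false

allB : ∀ {A : Set} → (A → Bool) → List A → Bool
allB p = foldr (λ x b → p x ∧ b) true

eqF : ∀ {n} → Fin n → Fin n → Bool
eqF i j = does (i ≟F j)

_⇒B_ : Bool → Bool → Bool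
a ⇒B b = not a ∨ b

_==B_ : Bool → Bool → Bool
true  ==B b = b
false ==B b = not b

funs : ∀ {A : Set} (m : ℕ) → List A → List (Fin m → A)
funs zero    xs = [ (λ ()) ]
funs (suc m) xs =
  concatMap (λ x → map (λ f → λ { zero → x ; (suc j) → f j }) (funs m xs)) xs

bools : List Bool
bools = true ∷ false ∷ []

-- Number of (not necessarily induced) copies of H in G:
-- the number of subgraphs (U , F) of G (U ⊆ V(G), F ⊆ E(G) with both
-- ends of every edge of F in U) such that (U , F) is isomorphic to H.
-- Subgraphs are represented canonically by their characteristic
-- functions (F symmetric), so distinct functions = distinct subgraphs.

isoB : ∀ {n m} → Pattern m → (Fin n → Bool) → (Fin n → Fin n → Bool) → Bool
isoB {n} {m} H U F = anyB ok (funs m (allFin n))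
  where
  ok : (Fin m → Fin n) → Bool
  ok φ =
    allB (λ i → allB (λ j → eqF (φ i) (φ j) ⇒B eqF i j) (allFin m)) (allFin m) ∧
    allB (λ i → U (φ i)) (allFin m) ∧
    allB (λ v → U v ⇒B anyB (λ i → eqF (φ i) v) (allFin m)) (allFin n) ∧
    allB (λ i → allB (λ j → H i j ==B F (φ i) (φ j)) (allFin m)) (allFin m)

isSubgraphB : ∀ {n} → Graph n → (Fin n → Bool) → (Fin n → Fin n → Bool) → Bool
isSubgraphB {n} G U F =
  allB (λ i → allB (λ j →
     (F i j ==B F j i) ∧ (F i j ⇒B (adj G i j ∧ U i ∧ U j))) (allFin n)) (allFin n)

copies : ∀ {n m} → Pattern m → Graph n → ℕ
copies {n} {m} H G =
  length (filter (λ UF → isSubgraphB G (Data.Product.proj₁ UF) (Data.Product.proj₂ UF)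
                           ∧ isoB H (Data.Product.proj₁ UF) (Data.Product.proj₂ UF) ≡? true)
    (concatMap (λ U → map (λ F → (U , F)) (funs n (funs n bools))) (funs n bools)))
  where
  open import Data.Bool.Properties using () renaming (_≟_ to _≡?_)

edgeCount : ∀ {m} → Pattern m → ℕ
edgeCount {m} H =
  sum (map (λ i → length (filter (λ j → (toℕ i <ᵇ toℕ j) ∧ H i j ≡? true) (allFin m)))
           (allFin m))
  where
  open import Data.Bool.Properties using () renaming (_≟_ to _≡?_)

-- Linear forests: disjoint unions of paths (isolated vertex = path on
-- one vertex).  For a list ls = [a₁ , … , a_r] of positive path orders
-- with a₁ + ⋯ + a_r = n, LF n ls is the graph on Fin n whose vertices are
-- laid out in consecutive blocks of sizes a₁, …, a_r, each block
-- carrying the path along consecutive vertices.  Every linear forest on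
-- n vertices is isomorphic to some LF n ls and conversely.

starts : ℕ → List ℕ → List ℕ
starts off []       = []
starts off (l ∷ ls) = off ∷ starts (off + l) ls

memℕ : ℕ → List ℕ → Bool
memℕ x = anyB (λ y → x ≡ᵇ y)

LF : (n : ℕ) → List ℕ → Pattern n
LF n ls i j = step i j ∨ step j i
  where
  step : Fin n → Fin n → Bool
  step a b = (toℕ b ≡ᵇ suc (toℕ a)) ∧ not (memℕ (toℕ b) (starts 0 ls))

data AllPos : List ℕ → Set where
  []  : AllPos []
  _∷_ : ∀ {l ls} → 1 ≤ l → AllPos ls → AllPos (l ∷ ls)

InL : ℕ → ℕ → List ℕ → Set
InL n k ls = AllPos ls × sum ls ≡ n × edgeCount (LF n ls) ≡ k

LFree : ∀ {n} → ℕ → Graph n → Set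
LFree {n} k G = ∀ ls → InL n k ls → ¬ Contains G (LF n ls)

Kstar : (s t : ℕ) → Pattern (s + t)
Kstar s t i j = not (eqF i j) ∧ ((toℕ i <ᵇ s) ∨ (toℕ j <ᵇ s))

IsExL : (n k : ℕ) → ∀ {m} → Pattern m → ℕ → Set
IsExL n k T M =
  (∀ (G : Graph n) → LFree k G → copies T G ≤ M) ×
  (Σ (Graph n) λ G → LFree k G × copies T G ≡ M)

-- The right-hand side of Theorem 1.6.
-- a = ⌊(k-1)/2⌋ , b = ⌈(k+1)/2⌉ = ⌊(k+2)/2⌋

bound : (n k s t : ℕ) → ℕ
bound n k s t =
  (k C (s + t)) * ((s + t) C t) ⊔
  ((a C s) * ((n ∸ s) C t)
    + (n ∸ b) * (a C (s ∸ 1)) * ((a + 1 ∸ s) C t)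
    + ((b C s) ∸ (a C s)) * ((b ∸ s) C t))
  where
  open import Data.Nat using (_⊔_)
  a = (k ∸ 1) / 2
  b = (k + 2) / 2

{-# OPTIONS --safe #-}

-- A graph has no linear forest with k edges iff every ordering of its vertices has
-- fewer than k consecutive adjacent pairs.  Replacing edges jv by iv (i < j) keeps
-- this property, since an ordering good for the shifted graph becomes good for the
-- original one after exchanging i with j and/or reversing the stretch between them;
-- and it does not lower the number of copies of K*_{s,t}.  In a fully shifted graph
-- the path k, 0, k − 1, 1, … misses an edge ij with i < j and i + j ≤ k, so with
-- c = i the graph lies in the threshold graph formed by a clique on k − c vertices,
-- c of which are joined to everything.  Its number of copies is convex in c on
-- 0 ≤ c ≤ ⌊(k − 1)/2⌋, and the two ends of this range give the two terms of the bound.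

module Submission where

open import Defs renaming (sym to adj-sym)
open import Data.Bool using (Bool; true; false; _∧_; _∨_; not; if_then_else_; T)
open import Data.Bool.Properties using (∨-comm; ∧-comm; ∨-zeroʳ; ∧-idem; ∨-idem) renaming (_≟_ to _≟B_)
open import Data.Empty using (⊥; ⊥-elim)
open import Data.Fin using (Fin; zero; suc; toℕ; fromℕ<; splitAt; _↑ˡ_; _↑ʳ_)
open import Data.Fin.Properties using (toℕ-injective; toℕ<n; toℕ-fromℕ<; all?; any?; toℕ-↑ˡ; toℕ-↑ʳ; splitAt⁻¹-↑ˡ; splitAt⁻¹-↑ʳ; splitAt-↑ˡ; splitAt-↑ʳ; ↑ˡ-injective; ↑ʳ-injective) renaming (_≟_ to _≟F_; suc-injective to Fin-suc-injective)
open import Data.List using (List; []; _∷_; [_]; map; concatMap; filter; length; tabulate; allFin; upTo; lookup; reverse; _++_; head; last)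
open import Data.List.Properties
open import Data.List.Membership.Propositional using (_∈_)
open import Data.List.Membership.Propositional.Properties using (∈-filter⁺; ∈-filter⁻; ∈-allFin; ∈-map⁺; ∈-map⁻; ∈-lookup; ∈-++⁺ˡ; ∈-++⁺ʳ; ∈-++⁻; ∈-∃++; ∈-tabulate⁺; ∈-tabulate⁻; ∈-upTo⁺; ∈-length)
open import Data.List.Relation.Unary.All as All using (All; []; _∷_)
import Data.List.Relation.Unary.All.Properties as AllP
open import Data.List.Relation.Unary.Any as Any using (Any; here; there; _─_; index)
import Data.List.Relation.Unary.Any.Properties as AnyP
open import Data.List.Relation.Unary.AllPairs as AllPairs using (AllPairs; []; _∷_)
import Data.List.Relation.Unary.AllPairs.Properties as AllPairsP
open import Data.List.Relation.Unary.Unique.Propositional using (Unique)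
import Data.List.Relation.Unary.Unique.Propositional.Properties as UniqueP
open import Data.List.Relation.Binary.Permutation.Propositional using (_↭_; ↭-refl; ↭-sym; ↭-trans; prep; swap)
import Data.List.Relation.Binary.Permutation.Propositional.Properties as Perm
open import Data.List.Relation.Binary.Permutation.Propositional using (↭⇒↭ₛ)
import Data.List.Relation.Binary.Permutation.Setoid.Properties as PermSetoid
open import Data.Maybe using (Maybe; just; nothing)
open import Data.Maybe.Relation.Unary.All as MAll using (just; nothing)
open import Data.Nat hiding (_≟_)
open import Data.Nat.Divisibility using (∣-refl)
open import Data.Nat.DivMod using (+-distrib-/-∣ˡ)
open import Data.Nat.Combinatorics using (_C_; nCk+nC[k+1]≡[n+1]C[k+1]; k>n⇒nCk≡0; nC1≡n; nCn≡1)
open import Data.Nat.Induction using (<-wellFounded; Acc; acc)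
open import Data.Nat.ListAction using (sum)
open import Data.Nat.Properties hiding (_≟_)
open import Data.Nat.Tactic.RingSolver using (solve-∀)
open import Data.Product using (Σ; ∃; _×_; _,_; proj₁; proj₂)
open import Data.Sum using (_⊎_; inj₁; inj₂; [_,_]′)
open import Data.Unit using (tt)
open import Function using (_∘_; id; case_of_)
open import Relation.Binary.Definitions using (tri<; tri≈; tri>)
open import Relation.Binary.PropositionalEquality hiding ([_])
open import Relation.Nullary using (¬_; Dec; yes; no; does; contradiction)
open import Relation.Nullary.Decidable using (_×-dec_; _→-dec_; ¬?; dec-true; dec-false)
open import Relation.Unary using (Decidable)

-- Orderings can stand for forests with exactly k edges because surplus links of an ordering may be
-- cut. A copy becomes a labelling of the vertices by `core`, `leaf` and `none`, which removes
-- isomorphisms from the count; the labelling can be read off the copy only because t ≥ 2, as for t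
-- = 1 the pattern is complete and each copy would be labelled s + 1 times.
--
-- Shifting suits this pattern because the sets of labels to which the three labels must be joined
-- form a chain, so a copy destroyed by the shift survives once i and j are swapped in it. The
-- zigzag path has k + 1 vertices, whence n ≥ k + 1; its consecutive labels sum to k or k - 1, so
-- its missing link has i + j ≤ k, and the range of c is just 2i < i + j ≤ k.
--
-- A threshold graph with a hub (a vertex joined to everything) has vertex 0 as one, and deleting it
-- leaves a threshold graph: labellings are therefore counted by a Pascal recurrence. Convexity is
-- checked on the three summands separately, since the clique term decreases in c while the other
-- two increase.

private variable
  A B : Set
  n m k s t : ℕ

-- Counting and enumeration in lists

any-─ : ∀ {P Q : A → Set} {ys} → (∀ y → P y → ¬ Q y) →
        (p : Any P ys) → Any Q ys → Any Q (ys ─ p)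
any-─ dis (here px) (here qx) = contradiction qx (dis _ px)
any-─ dis (here px) (there q) = q
any-─ dis (there p) (here qx) = here qx
any-─ dis (there p) (there q) = there (any-─ dis p q)

length-removed : ∀ {P : A → Set} {ys} (p : Any P ys) → length ys ≡ suc (length (ys ─ p))
length-removed (here px) = refl
length-removed {ys = _ ∷ _} (there p) = cong suc (length-removed p)

-- The injection is a relation because the objects counted are functions, found in a list only up to
-- pointwise equality. Deleting the partner of x from `ys` harms no later element, as none of them
-- is related to it.
injective⇒length≤ : ∀ {R : A → B → Set} {xs ys} →
                    AllPairs (λ x x′ → ∀ y → R x y → ¬ R x′ y) xs →
                    All (λ x → Any (R x) ys) xs → length xs ≤ length ys
injective⇒length≤ [] [] = z≤n
injective⇒length≤ {R = R} {x ∷ xs} {ys} (x# ∷ xs#) (p ∷ ps) =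
  subst (suc (length xs) ≤_) (sym (length-removed p))
    (s≤s (injective⇒length≤ xs#
      (All.zipWith (λ {x′} (dis , q) → any-─ {P = R x} {Q = R x′} dis p q) (x# , ps))))

all-pairs : ∀ {P : A → Set} {R S : A → A → Set} → (∀ {x y} → P x → P y → R x y → S x y) →
            ∀ {xs} → All P xs → AllPairs R xs → AllPairs S xs
all-pairs f [] [] = []
all-pairs f (p ∷ ps) (r ∷ rs) = All.zipWith (λ (q , r) → f p q r) (ps , r) ∷ all-pairs f ps rs

infix 8 #_
#_ : ∀ {P : A → Set} → Decidable P → List A → ℕ
(# P?) xs = length (filter P? xs)

#-cong : ∀ {P Q : A → Set} (P? : Decidable P) (Q? : Decidable Q) →
         (∀ x → P x → Q x) → (∀ x → Q x → P x) → ∀ xs → (# P?) xs ≡ (# Q?) xs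
#-cong P? Q? pq qp [] = refl
#-cong P? Q? pq qp (x ∷ xs) with P? x | Q? x
... | yes _ | yes _ = cong suc (#-cong P? Q? pq qp xs)
... | yes p | no ¬q = contradiction (pq x p) ¬q
... | no ¬p | yes q = contradiction (qp x q) ¬p
... | no _  | no _  = #-cong P? Q? pq qp xs

#-none : ∀ {P : A → Set} (P? : Decidable P) → (∀ x → ¬ P x) → ∀ xs → (# P?) xs ≡ 0
#-none P? ¬p [] = refl
#-none P? ¬p (x ∷ xs) with P? x
... | yes p = contradiction p (¬p x)
... | no _  = #-none P? ¬p xs

#-++ : ∀ {P : A → Set} (P? : Decidable P) xs ys → (# P?) (xs ++ ys) ≡ (# P?) xs + (# P?) ys
#-++ P? xs ys = trans (cong length (filter-++ P? xs ys)) (length-++ (filter P? xs))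

#-map : ∀ {P : B → Set} (P? : Decidable P) (f : A → B) xs → (# P?) (map f xs) ≡ (# (P? ∘ f)) xs
#-map P? f [] = refl
#-map P? f (x ∷ xs) with does (P? (f x))
... | true  = cong suc (#-map P? f xs)
... | false = #-map P? f xs

#-mono : ∀ {P Q : A → Set} (P? : Decidable P) (Q? : Decidable Q) →
         (∀ x → P x → Q x) → ∀ xs → (# P?) xs ≤ (# Q?) xs
#-mono P? Q? pq [] = z≤n
#-mono P? Q? pq (x ∷ xs) with P? x | Q? x
... | yes _ | yes _ = s≤s (#-mono P? Q? pq xs)
... | yes p | no ¬q = contradiction (pq x p) ¬q
... | no _  | yes _ = m≤n⇒m≤1+n (#-mono P? Q? pq xs)
... | no _  | no _  = #-mono P? Q? pq xs

-- Distinctness is relative to an arbitrary `_≈_`, so that the lemma applies to its own output: edge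
-- sets are functions into functions.
funs-unique : ∀ {_≈_ : A → A → Set} {xs} m → AllPairs (λ x y → ¬ (x ≈ y)) xs →
              AllPairs (λ f g → ¬ (∀ i → f i ≈ g i)) (funs m xs)
funs-unique zero    u = [] ∷ []
funs-unique (suc m) u = AllPairsP.concat⁺
  (AllP.map⁺ (All.universal (λ x → AllPairsP.map⁺
    (AllPairs.map (λ f≉g e → f≉g (λ i → e (suc i))) (funs-unique m u))) _))
  (AllPairsP.map⁺ (AllPairs.map (λ x≉y → AllP.map⁺ (All.universal (λ f →
    AllP.map⁺ (All.universal (λ g e → x≉y (e zero)) _)) _)) u))

funs-complete : ∀ {_≈_ : A → A → Set} {xs} m (f : Fin m → A) → (∀ i → Any (f i ≈_) xs) →
                Any (λ g → ∀ i → f i ≈ g i) (funs m xs)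
funs-complete zero    f h = here (λ ())
funs-complete {_≈_ = _≈_} (suc m) f h = AnyP.concat⁺ (AnyP.map⁺ (Any.map (λ f0≈x → AnyP.map⁺
  (Any.map (λ e → λ { zero → f0≈x ; (suc i) → e i }) (funs-complete {_≈_ = _≈_} m (f ∘ suc) (h ∘ suc)))) (h zero)))

-- Boolean tests and what they decide

allB⁻ : ∀ (p : A → Bool) xs → allB p xs ≡ true → All (λ x → p x ≡ true) xs
allB⁻ p [] _ = []
allB⁻ p (x ∷ xs) e with p x in eq
... | true = eq ∷ allB⁻ p xs e

allB⁺ : ∀ {p : A → Bool} {xs} → All (λ x → p x ≡ true) xs → allB p xs ≡ true
allB⁺ [] = refl
allB⁺ (px ∷ ps) rewrite px = allB⁺ ps

anyB⁻ : ∀ (p : A → Bool) xs → anyB p xs ≡ true → Any (λ x → p x ≡ true) xs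
anyB⁻ p (x ∷ xs) e with p x in eq
... | true  = here eq
... | false = there (anyB⁻ p xs e)

anyB⁺ : ∀ {p : A → Bool} {xs} → Any (λ x → p x ≡ true) xs → anyB p xs ≡ true
anyB⁺ (here px) rewrite px = refl
anyB⁺ {p = p} (there {x} a) rewrite anyB⁺ {p = p} a = ∨-zeroʳ (p x)

allFinB⁻ : ∀ (p : Fin n → Bool) → allB p (allFin n) ≡ true → ∀ i → p i ≡ true
allFinB⁻ p e i = All.lookup (allB⁻ p _ e) (∈-allFin i)

allFinB⁺ : ∀ {p : Fin n → Bool} → (∀ i → p i ≡ true) → allB p (allFin n) ≡ true
allFinB⁺ {n} {p} h = allB⁺ (All.universal {P = λ i → p i ≡ true} h (allFin n))

∧-⁻ : ∀ {a b} → a ∧ b ≡ true → a ≡ true × b ≡ true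
∧-⁻ {true} {true} _ = refl , refl

∧-⁺ : ∀ {a b} → a ≡ true → b ≡ true → a ∧ b ≡ true
∧-⁺ refl refl = refl

∨-⁻ : ∀ {a b} → a ∨ b ≡ true → a ≡ true ⊎ b ≡ true
∨-⁻ {true}  _ = inj₁ refl
∨-⁻ {false} e = inj₂ e

∨-⁺ˡ : ∀ {a b} → a ≡ true → a ∨ b ≡ true
∨-⁺ˡ refl = refl

∨-⁺ʳ : ∀ {a b} → b ≡ true → a ∨ b ≡ true
∨-⁺ʳ {a} refl = ∨-zeroʳ a

⇒B-⁻ : ∀ {a b} → a ⇒B b ≡ true → a ≡ true → b ≡ true
⇒B-⁻ e refl = e

⇒B-⁺ : ∀ {a b} → (a ≡ true → b ≡ true) → a ⇒B b ≡ true
⇒B-⁺ {true}  h = h refl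
⇒B-⁺ {false} h = refl

==B-⁻ : ∀ {a b} → a ==B b ≡ true → a ≡ b
==B-⁻ {true} {true} _ = refl
==B-⁻ {false} {false} _ = refl

==B-⁺ : ∀ {a b} → a ≡ b → a ==B b ≡ true
==B-⁺ {true} refl = refl
==B-⁺ {false} refl = refl

eqF-⁻ : ∀ {i j : Fin n} → eqF i j ≡ true → i ≡ j
eqF-⁻ {i = i} {j} e with i ≟F j
... | yes p = p

eqF-refl : ∀ (i : Fin n) → eqF i i ≡ true
eqF-refl i = dec-true (i ≟F i) refl

eqF-≢ : ∀ {i j : Fin n} → i ≢ j → eqF i j ≡ false
eqF-≢ {i = i} {j} = dec-false (i ≟F j)

eqF-sym : ∀ (i j : Fin n) → eqF i j ≡ eqF j i
eqF-sym i j with i ≟F j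
... | yes refl = sym (eqF-refl i)
... | no i≢j   = sym (eqF-≢ (i≢j ∘ sym))

≢true : ∀ {b} → b ≢ true → b ≡ false
≢true {true} h = contradiction refl h
≢true {false} h = refl

Bool-ext : ∀ {a b} → (a ≡ true → b ≡ true) → (b ≡ true → a ≡ true) → a ≡ b
Bool-ext {true}  f g = sym (f refl)
Bool-ext {false} {true} f g = g refl
Bool-ext {false} {false} f g = refl

<ᵇ-⁻ : ∀ {a b} → (a <ᵇ b) ≡ true → a < b
<ᵇ-⁻ {a} {b} e = <ᵇ⇒< a b (subst T (sym e) tt)

<ᵇ-⁺ : ∀ {a b} → a < b → (a <ᵇ b) ≡ true
<ᵇ-⁺ {a} {b} a<b with a <ᵇ b | <⇒<ᵇ a<b
... | true | _ = refl

-- Copies as vertex labellings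

b2n : Bool → ℕ
b2n b = if b then 1 else 0

trues : (Fin n → Bool) → List (Fin n)
trues p = filter (λ v → p v ≟B true) (allFin _)

count : (Fin n → Bool) → ℕ
count p = length (trues p)

count-suc : (p : Fin (suc n) → Bool) → count p ≡ b2n (p zero) + count (p ∘ suc)
count-suc {n} p = trans (head-case p (tabulate suc)) (cong (b2n (p zero) +_)
    (trans (cong (# (λ v → p v ≟B true)) (sym (map-tabulate id suc))) (#-map _ suc (allFin n))))
  where
  head-case : ∀ (p : Fin (suc n) → Bool) vs → length (filter (λ v → p v ≟B true) (zero ∷ vs))
              ≡ b2n (p zero) + length (filter (λ v → p v ≟B true) vs)
  head-case p vs with p zero
  ... | true  = refl
  ... | false = refl

trues-unique : (p : Fin n → Bool) → Unique (trues p)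
trues-unique p = UniqueP.filter⁺ _ (UniqueP.allFin⁺ _)

∈-trues⁺ : ∀ (p : Fin n → Bool) {v} → p v ≡ true → v ∈ trues p
∈-trues⁺ p {v} pv = ∈-filter⁺ (λ v → p v ≟B true) (∈-allFin v) pv

∈-trues⁻ : ∀ (p : Fin n → Bool) {v} → v ∈ trues p → p v ≡ true
∈-trues⁻ p {v} v∈ = proj₂ (∈-filter⁻ (λ v → p v ≟B true) {xs = allFin _} v∈)

⊆⇒length≤ : {xs ys : List A} → Unique xs → (∀ {v} → v ∈ xs → v ∈ ys) → length xs ≤ length ys
⊆⇒length≤ xs! xs⊆ys = injective⇒length≤
  (AllPairs.map (λ x≢x′ y x≡y x′≡y → x≢x′ (trans x≡y (sym x′≡y))) xs!) (All.tabulate xs⊆ys)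

length≡count : ∀ {xs} (p : Fin n → Bool) → Unique xs → (∀ {v} → v ∈ xs → p v ≡ true) →
               (∀ {v} → p v ≡ true → v ∈ xs) → length xs ≡ count p
length≡count p xs! ∈⇒p p⇒∈ = ≤-antisym
  (⊆⇒length≤ xs! (∈-trues⁺ p ∘ ∈⇒p)) (⊆⇒length≤ (trues-unique p) (p⇒∈ ∘ ∈-trues⁻ p))

another : (p : Fin n → Bool) → 2 ≤ count p → ∀ v → ∃ λ w → v ≢ w × p w ≡ true
another p 2≤ v = go (trues p) (trues-unique p) (∈-trues⁻ p) 2≤
  where
  go : ∀ ws → Unique ws → (∀ {w} → w ∈ ws → p w ≡ true) → 2 ≤ length ws → ∃ λ w → v ≢ w × p w ≡ true
  go (_ ∷ []) _ _ (s≤s ())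
  go (x ∷ y ∷ _) ((x≢y ∷ _) ∷ _) h _ with v ≟F x
  ... | no v≢x   = x , v≢x , h (here refl)
  ... | yes refl = y , x≢y , h (there (here refl))

data Role : Set where
  none leaf core : Role

isCore isLeaf isUsed : Role → Bool
isCore core = true
isCore _    = false
isLeaf leaf = true
isLeaf _    = false
isUsed none = false
isUsed _    = true

roles : List Role
roles = none ∷ leaf ∷ core ∷ []

roles-unique : AllPairs _≢_ roles
roles-unique = ((λ ()) ∷ (λ ()) ∷ []) ∷ ((λ ()) ∷ []) ∷ [] ∷ []

roles-complete : ∀ r → Any (r ≡_) roles
roles-complete none = here refl
roles-complete leaf = there (here refl)
roles-complete core = there (there (here refl))

needs : Role → Role → Bool
needs core r    = isUsed r
needs leaf core = true
needs _    _    = false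

needs-sym : ∀ r r′ → needs r r′ ≡ needs r′ r
needs-sym none none = refl
needs-sym none leaf = refl
needs-sym none core = refl
needs-sym leaf none = refl
needs-sym leaf leaf = refl
needs-sym leaf core = refl
needs-sym core none = refl
needs-sym core leaf = refl
needs-sym core core = refl

needs-used : ∀ r r′ → needs r r′ ≡ true → isUsed r ≡ true × isUsed r′ ≡ true
needs-used core core _ = refl , refl
needs-used core leaf _ = refl , refl
needs-used leaf core _ = refl , refl

-- A copy of K*_{s,t} is recorded by labelling its clique part with core, its
-- independent part with leaf, and every other vertex with none.
Valid : (Fin n → Fin n → Bool) → ℕ → ℕ → (Fin n → Role) → Set
Valid E s t ρ = count (isCore ∘ ρ) ≡ s × count (isLeaf ∘ ρ) ≡ t ×
  (∀ u v → u ≢ v → needs (ρ u) (ρ v) ≡ true → E u v ≡ true)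

valid? : ∀ (E : Fin n → Fin n → Bool) s t → Decidable (Valid E s t)
valid? E s t ρ = (_ ≟ s) ×-dec ((_ ≟ t) ×-dec
  all? λ u → all? λ v → ¬? (u ≟F v) →-dec ((_ ≟B true) →-dec (_ ≟B true)))
  where open import Data.Nat using (_≟_)

labellings : (Fin n → Fin n → Bool) → ℕ → ℕ → ℕ
labellings {n} E s t = (# (valid? E s t)) (funs n roles)

count-cong : {p q : Fin n → Bool} → (∀ v → p v ≡ q v) → count p ≡ count q
count-cong {n} {p} {q} e = #-cong _ _ (λ v pv → trans (sym (e v)) pv) (λ v qv → trans (e v) qv) (allFin n)

Valid-resp : ∀ {E : Fin n → Fin n → Bool} {ρ ρ′} → (∀ v → ρ v ≡ ρ′ v) → Valid E s t ρ → Valid E s t ρ′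
Valid-resp e (cs , ls , h) =
  trans (sym (count-cong (cong isCore ∘ e))) cs , trans (sym (count-cong (cong isLeaf ∘ e))) ls ,
  λ u v u≢v nd → h u v u≢v (subst₂ (λ r r′ → needs r r′ ≡ true) (sym (e u)) (sym (e v)) nd)

any-filter : ∀ {P Q : A → Set} (P? : Decidable P) → (∀ {x} → Q x → P x) →
             ∀ {xs} → Any Q xs → Any Q (filter P? xs)
any-filter P? qp (here {x} q) with P? x
... | yes _ = here q
... | no ¬p = contradiction (qp q) ¬p
any-filter P? qp (there {x} a) with P? x
... | yes _ = there (any-filter P? qp a)
... | no _  = any-filter P? qp a

-- As in `Kstar s t`, indices below `s` stand for the clique part, so φ is an isomorphism from the
-- pattern onto the labelled copy.
record Enumerates (s t : ℕ) (ρ : Fin n → Role) (φ : Fin (s + t) → Fin n) : Set where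
  field
    role : ∀ i → ρ (φ i) ≡ (if toℕ i <ᵇ s then core else leaf)
    inj  : ∀ {i j} → φ i ≡ φ j → i ≡ j
    surj : ∀ v → isUsed (ρ v) ≡ true → ∃ λ i → φ i ≡ v

module _ (s t : ℕ) where
  <ᵇ-↑ˡ : ∀ (a : Fin s) → (toℕ (a ↑ˡ t) <ᵇ s) ≡ true
  <ᵇ-↑ˡ a = <ᵇ-⁺ (subst (_< s) (sym (toℕ-↑ˡ a t)) (toℕ<n a))

  <ᵇ-↑ʳ : ∀ (b : Fin t) → (toℕ (s ↑ʳ b) <ᵇ s) ≡ false
  <ᵇ-↑ʳ b = ≢true (λ e → m+n≮m s (toℕ b) (subst (_< s) (toℕ-↑ʳ s b) (<ᵇ-⁻ e)))

  ↑-view : ∀ i → (∃ λ a → a ↑ˡ t ≡ i) ⊎ (∃ λ b → s ↑ʳ b ≡ i)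
  ↑-view i with splitAt s i in eq
  ... | inj₁ a = inj₁ (a , splitAt⁻¹-↑ˡ eq)
  ... | inj₂ b = inj₂ (b , splitAt⁻¹-↑ʳ eq)

isCore-true : ∀ {r} → isCore r ≡ true → r ≡ core
isCore-true {core} _ = refl

isLeaf-true : ∀ {r} → isLeaf r ≡ true → r ≡ leaf
isLeaf-true {leaf} _ = refl

lookup-injective : ∀ {xs : List A} → Unique xs → ∀ {i j} → lookup xs i ≡ lookup xs j → i ≡ j
lookup-injective (x∉ ∷ xs!) {zero} {zero} e = refl
lookup-injective {xs = _ ∷ xs} (x∉ ∷ xs!) {zero} {suc j} e = contradiction e (All.lookup x∉ (∈-lookup j))
lookup-injective {xs = _ ∷ xs} (x∉ ∷ xs!) {suc i} {zero} e = contradiction (sym e) (All.lookup x∉ (∈-lookup i))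
lookup-injective (x∉ ∷ xs!) {suc i} {suc j} e = cong suc (lookup-injective xs! e)

enumerate : (ρ : Fin n → Role) → ∃ (Enumerates (count (isCore ∘ ρ)) (count (isLeaf ∘ ρ)) ρ)
enumerate ρ = φ , record { role = role ; inj = λ {i} {j} → inj i j ; surj = surj }
  where
  cs = trues (isCore ∘ ρ)
  ls = trues (isLeaf ∘ ρ)
  φ : Fin (length cs + length ls) → Fin _
  φ i = [ lookup cs , lookup ls ]′ (splitAt (length cs) i)
  φˡ : ∀ a → φ (a ↑ˡ length ls) ≡ lookup cs a
  φˡ a rewrite splitAt-↑ˡ (length cs) a (length ls) = refl
  φʳ : ∀ b → φ (length cs ↑ʳ b) ≡ lookup ls b
  φʳ b rewrite splitAt-↑ʳ (length cs) (length ls) b = refl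
  lookup-core : ∀ a → ρ (lookup cs a) ≡ core
  lookup-core a = isCore-true (∈-trues⁻ (isCore ∘ ρ) (∈-lookup a))
  lookup-leaf : ∀ b → ρ (lookup ls b) ≡ leaf
  lookup-leaf b = isLeaf-true (∈-trues⁻ (isLeaf ∘ ρ) (∈-lookup b))
  role : ∀ i → ρ (φ i) ≡ (if toℕ i <ᵇ length cs then core else leaf)
  role i with ↑-view (length cs) (length ls) i
  ... | inj₁ (a , refl) rewrite <ᵇ-↑ˡ (length cs) (length ls) a | φˡ a = lookup-core a
  ... | inj₂ (b , refl) rewrite <ᵇ-↑ʳ (length cs) (length ls) b | φʳ b = lookup-leaf b
  clash : ∀ {a b} → lookup cs a ≢ lookup ls b
  clash {a} {b} e with trans (sym (lookup-core a)) (trans (cong ρ e) (lookup-leaf b))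
  ... | ()
  inj : ∀ i j → φ i ≡ φ j → i ≡ j
  inj i j e with ↑-view (length cs) (length ls) i | ↑-view (length cs) (length ls) j
  ... | inj₁ (a , refl) | inj₁ (b , refl) = cong (_↑ˡ length ls)
        (lookup-injective (trues-unique (isCore ∘ ρ)) (trans (sym (φˡ a)) (trans e (φˡ b))))
  ... | inj₁ (a , refl) | inj₂ (b , refl) = contradiction (trans (sym (φˡ a)) (trans e (φʳ b))) clash
  ... | inj₂ (a , refl) | inj₁ (b , refl) = contradiction (trans (sym (φˡ b)) (trans (sym e) (φʳ a))) clash
  ... | inj₂ (a , refl) | inj₂ (b , refl) = cong (length cs ↑ʳ_)
        (lookup-injective (trues-unique (isLeaf ∘ ρ)) (trans (sym (φʳ a)) (trans e (φʳ b))))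
  surj : ∀ v → isUsed (ρ v) ≡ true → ∃ λ i → φ i ≡ v
  surj v used with ρ v in eq
  ... | core = let v∈ = ∈-trues⁺ (isCore ∘ ρ) (cong isCore eq) in
               index v∈ ↑ˡ length ls , trans (φˡ (index v∈)) (sym (AnyP.lookup-index v∈))
  ... | leaf = let v∈ = ∈-trues⁺ (isLeaf ∘ ρ) (cong isLeaf eq) in
               length cs ↑ʳ index v∈ , trans (φʳ (index v∈)) (sym (AnyP.lookup-index v∈))

module _ {ρ : Fin n → Role} {φ : Fin (s + t) → Fin n} (en : Enumerates s t ρ φ) where
  open Enumerates en

  private
    roleˡ : ∀ a → ρ (φ (a ↑ˡ t)) ≡ core
    roleˡ a = trans (role (a ↑ˡ t)) (cong (if_then core else leaf) (<ᵇ-↑ˡ s t a))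
    roleʳ : ∀ b → ρ (φ (s ↑ʳ b)) ≡ leaf
    roleʳ b = trans (role (s ↑ʳ b)) (cong (if_then core else leaf) (<ᵇ-↑ʳ s t b))
    core≢leaf : core ≢ leaf
    core≢leaf ()

  count-core : count (isCore ∘ ρ) ≡ s
  count-core = trans (sym (length≡count _ (UniqueP.tabulate⁺ (↑ˡ-injective t _ _ ∘ inj)) ∈⇒ ⇒∈))
                     (length-tabulate (λ a → φ (a ↑ˡ t)))
    where
    ∈⇒ : ∀ {v} → v ∈ tabulate (λ a → φ (a ↑ˡ t)) → isCore (ρ v) ≡ true
    ∈⇒ v∈ with ∈-tabulate⁻ v∈
    ... | a , refl = cong isCore (roleˡ a)
    ⇒∈ : ∀ {v} → isCore (ρ v) ≡ true → v ∈ tabulate (λ a → φ (a ↑ˡ t))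
    ⇒∈ {v} c with surj v (cong isUsed (isCore-true c))
    ... | i , refl with ↑-view s t i
    ...   | inj₁ (a , refl) = ∈-tabulate⁺ a
    ...   | inj₂ (b , refl) = contradiction (trans (sym (isCore-true c)) (roleʳ b)) core≢leaf

  count-leaf : count (isLeaf ∘ ρ) ≡ t
  count-leaf = trans (sym (length≡count _ (UniqueP.tabulate⁺ (↑ʳ-injective s _ _ ∘ inj)) ∈⇒ ⇒∈))
                     (length-tabulate (λ b → φ (s ↑ʳ b)))
    where
    ∈⇒ : ∀ {v} → v ∈ tabulate (λ b → φ (s ↑ʳ b)) → isLeaf (ρ v) ≡ true
    ∈⇒ v∈ with ∈-tabulate⁻ v∈
    ... | b , refl = cong isLeaf (roleʳ b)
    ⇒∈ : ∀ {v} → isLeaf (ρ v) ≡ true → v ∈ tabulate (λ b → φ (s ↑ʳ b))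
    ⇒∈ {v} c with surj v (cong isUsed (isLeaf-true c))
    ... | i , refl with ↑-view s t i
    ...   | inj₂ (b , refl) = ∈-tabulate⁺ b
    ...   | inj₁ (a , refl) = contradiction (trans (sym (roleˡ a)) (isLeaf-true c)) core≢leaf

  Kstar≡ : ∀ i j → Kstar s t i j ≡ not (eqF (φ i) (φ j)) ∧ needs (ρ (φ i)) (ρ (φ j))
  Kstar≡ i j = cong₂ (λ a b → not a ∧ b) eqF≡ needs≡
    where
    eqF≡ : eqF i j ≡ eqF (φ i) (φ j)
    eqF≡ with i ≟F j
    ... | yes refl = sym (eqF-refl (φ i))
    ... | no i≢j   = sym (eqF-≢ (i≢j ∘ inj))
    needs≡ : (toℕ i <ᵇ s) ∨ (toℕ j <ᵇ s) ≡ needs (ρ (φ i)) (ρ (φ j))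
    needs≡ rewrite role i | role j with toℕ i <ᵇ s | toℕ j <ᵇ s
    ... | true  | true  = refl
    ... | true  | false = refl
    ... | false | true  = refl
    ... | false | false = refl

Subgraph : ℕ → Set
Subgraph n = (Fin n → Bool) × (Fin n → Fin n → Bool)

_≈_ : Subgraph n → Subgraph n → Set
(U , F) ≈ (U′ , F′) = (∀ v → U v ≡ U′ v) × (∀ u v → F u v ≡ F′ u v)

Labels : (Fin n → Role) → Subgraph n → Set
Labels ρ (U , F) = (∀ v → U v ≡ isUsed (ρ v)) ×
                   (∀ u v → F u v ≡ not (eqF u v) ∧ needs (ρ u) (ρ v))

subgraphs : ∀ n → List (Subgraph n)
subgraphs n = concatMap (λ U → map (λ F → (U , F)) (funs n (funs n bools))) (funs n bools)

bools-unique : AllPairs _≢_ bools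
bools-unique = ((λ ()) ∷ []) ∷ [] ∷ []

bools-complete : ∀ b → Any (b ≡_) bools
bools-complete true  = here refl
bools-complete false = there (here refl)

subgraphs-unique : ∀ n → AllPairs (λ x y → ¬ (x ≈ y)) (subgraphs n)
subgraphs-unique n = AllPairsP.concat⁺
  (AllP.map⁺ (All.universal (λ U → AllPairsP.map⁺
    (AllPairs.map (λ F≉ e → F≉ (proj₂ e)) (funs-unique n (funs-unique n bools-unique)))) _))
  (AllPairsP.map⁺ (AllPairs.map (λ U≉ → AllP.map⁺ (All.universal (λ F →
    AllP.map⁺ (All.universal (λ F′ e → U≉ (proj₁ e)) _)) _)) (funs-unique n bools-unique)))

subgraphs-complete : ∀ (x : Subgraph n) → Any (x ≈_) (subgraphs n)
subgraphs-complete {n} (U , F) = AnyP.concat⁺ (AnyP.map⁺ (Any.map (λ eU → AnyP.map⁺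
  (Any.map (λ eF → eU , eF)
    (funs-complete {_≈_ = λ f g → ∀ v → f v ≡ g v} n F
      (λ u → funs-complete {_≈_ = _≡_} n (F u) (λ v → bools-complete _)))))
  (funs-complete {_≈_ = _≡_} n U (λ v → bools-complete _))))

isCopyB : ∀ s t → Graph n → Subgraph n → Bool
isCopyB s t G (U , F) = isSubgraphB G U F ∧ isoB (Kstar s t) U F

isCopy? : ∀ s t (G : Graph n) → Decidable (λ x → isCopyB s t G x ≡ true)
isCopy? s t G x = isCopyB s t G x ≟B true

record IsIso (H : Pattern m) (U : Fin n → Bool) (F : Fin n → Fin n → Bool) : Set where
  field
    φ     : Fin m → Fin n
    inj   : ∀ {i j} → φ i ≡ φ j → i ≡ j
    into  : ∀ i → U (φ i) ≡ true
    onto  : ∀ v → U v ≡ true → ∃ λ i → φ i ≡ v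
    edges : ∀ i j → H i j ≡ F (φ i) (φ j)

module _ (H : Pattern m) (U : Fin n → Bool) (F : Fin n → Fin n → Bool) where

  private
    inj? into? onto? edges? : (Fin m → Fin n) → Bool
    inj? φ   = allB (λ i → allB (λ j → eqF (φ i) (φ j) ⇒B eqF i j) (allFin m)) (allFin m)
    into? φ  = allB (λ i → U (φ i)) (allFin m)
    onto? φ  = allB (λ v → U v ⇒B anyB (λ i → eqF (φ i) v) (allFin m)) (allFin n)
    edges? φ = allB (λ i → allB (λ j → H i j ==B F (φ i) (φ j)) (allFin m)) (allFin m)

    -- A replica of the test local to `isoB`, definitionally equal to it, since that one cannot be
    -- named here.
    iso? : (Fin m → Fin n) → Bool
    iso? φ = inj? φ ∧ into? φ ∧ onto? φ ∧ edges? φ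

    toIso : ∀ φ → iso? φ ≡ true → IsIso H U F
    toIso φ ok with inj? φ in e₁ | into? φ in e₂ | onto? φ in e₃ | edges? φ in e₄
    ... | true | true | true | true = record
      { φ = φ
      ; inj = λ {i} {j} e → eqF-⁻ (⇒B-⁻ {eqF (φ i) (φ j)} (allFinB⁻ _ (allFinB⁻ _ e₁ i) j)
                              (subst (λ w → eqF (φ i) w ≡ true) e (eqF-refl (φ i))))
      ; into = allFinB⁻ _ e₂
      ; onto = λ v Uv → let i , e = Any.satisfied (anyB⁻ (λ i → eqF (φ i) v) (allFin m)
                                      (⇒B-⁻ {U v} (allFinB⁻ _ e₃ v) Uv)) in i , eqF-⁻ e
      ; edges = λ i j → ==B-⁻ (allFinB⁻ _ (allFinB⁻ _ e₄ i) j) }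

    fromIso : (iso : IsIso H U F) → ∀ φ′ → (∀ i → IsIso.φ iso i ≡ φ′ i) → iso? φ′ ≡ true
    fromIso iso φ′ e = ∧-⁺ {inj? φ′} ok₁ (∧-⁺ {into? φ′} ok₂ (∧-⁺ {onto? φ′} {edges? φ′} ok₃ ok₄))
      where
      open IsIso iso
      ok₁ : inj? φ′ ≡ true
      ok₁ = allFinB⁺ λ i → allFinB⁺ λ j → ⇒B-⁺ {eqF (φ′ i) (φ′ j)} λ q →
        subst (λ k → eqF i k ≡ true) (inj (trans (e i) (trans (eqF-⁻ q) (sym (e j))))) (eqF-refl i)
      ok₂ : into? φ′ ≡ true
      ok₂ = allFinB⁺ λ i → subst (λ v → U v ≡ true) (e i) (into i)
      hit : ∀ v → (∃ λ i → φ i ≡ v) → anyB (λ i → eqF (φ′ i) v) (allFin m) ≡ true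
      hit v (i , refl) = anyB⁺ (Any.map (λ where refl → subst (λ w → eqF w v ≡ true) (e i) (eqF-refl v))
                                        (∈-allFin i))
      ok₃ : onto? φ′ ≡ true
      ok₃ = allFinB⁺ λ v → ⇒B-⁺ {U v} λ Uv → hit v (onto v Uv)
      ok₄ : edges? φ′ ≡ true
      ok₄ = allFinB⁺ λ i → allFinB⁺ λ j → ==B-⁺ (trans (edges i j) (cong₂ F (e i) (e j)))

  isoB⁻ : isoB H U F ≡ true → IsIso H U F
  isoB⁻ iso = let φ , ok = Any.satisfied (anyB⁻ iso? (funs m (allFin n)) iso) in toIso φ ok

  isoB⁺ : IsIso H U F → isoB H U F ≡ true
  isoB⁺ iso = anyB⁺ {p = iso?} (Any.map (λ {φ′} → fromIso iso φ′)
    (funs-complete {_≈_ = _≡_} m (IsIso.φ iso) (λ i → ∈-allFin (IsIso.φ iso i))))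

module _ (G : Graph n) (U : Fin n → Bool) (F : Fin n → Fin n → Bool) where

  isSubgraphB⁻ : isSubgraphB G U F ≡ true →
                 ∀ u v → F u v ≡ true → adj G u v ≡ true × U u ≡ true × U v ≡ true
  isSubgraphB⁻ sub u v Fuv =
    let a , b = ∧-⁻ {adj G u v} (⇒B-⁻ {F u v} (proj₂ (∧-⁻ {F u v ==B F v u} (allFinB⁻ _ (allFinB⁻ _ sub u) v))) Fuv)
    in a , ∧-⁻ b

  isSubgraphB⁺ : (∀ u v → F u v ≡ F v u) →
                 (∀ u v → F u v ≡ true → adj G u v ≡ true × U u ≡ true × U v ≡ true) →
                 isSubgraphB G U F ≡ true
  isSubgraphB⁺ F-sym F⇒ = allFinB⁺ λ u → allFinB⁺ λ v → ∧-⁺ {F u v ==B F v u} (==B-⁺ (F-sym u v))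
    (⇒B-⁺ {F u v} λ Fuv → let a , b , c = F⇒ u v Fuv in ∧-⁺ a (∧-⁺ b c))

labels-unique : ∀ {E : Fin n → Fin n → Bool} {ρ ρ′ x} → 2 ≤ t → Valid E s t ρ → Valid E s t ρ′ →
                Labels ρ x → Labels ρ′ x → ∀ v → ρ v ≡ ρ′ v
labels-unique {ρ = ρ} {ρ′} 2≤t (_ , ls , _) (_ , ls′ , _) (U≡ , F≡) (U≡′ , F≡′) v = lemma (ρ v) (ρ′ v) refl refl
  where
  used≡ : ∀ v → isUsed (ρ v) ≡ isUsed (ρ′ v)
  used≡ v = trans (sym (U≡ v)) (U≡′ v)
  needs≡ : ∀ {u v} → u ≢ v → needs (ρ u) (ρ v) ≡ needs (ρ′ u) (ρ′ v)
  needs≡ {u} {v} u≢v with trans (sym (F≡ u v)) (F≡′ u v)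
  ... | e rewrite eqF-≢ u≢v = e
  -- A leaf misses another leaf, whereas a core vertex is joined to every used vertex.
  lemma : ∀ r r′ → ρ v ≡ r → ρ′ v ≡ r′ → r ≡ r′
  lemma none none e e′ = refl
  lemma leaf leaf e e′ = refl
  lemma core core e e′ = refl
  lemma none leaf e e′ with () ← subst₂ (λ a b → isUsed a ≡ isUsed b) e e′ (used≡ v)
  lemma none core e e′ with () ← subst₂ (λ a b → isUsed a ≡ isUsed b) e e′ (used≡ v)
  lemma leaf none e e′ with () ← subst₂ (λ a b → isUsed a ≡ isUsed b) e e′ (used≡ v)
  lemma core none e e′ with () ← subst₂ (λ a b → isUsed a ≡ isUsed b) e e′ (used≡ v)
  lemma core leaf e e′ with another (isLeaf ∘ ρ′) (subst (2 ≤_) (sym ls′) 2≤t) v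
  ... | w , v≢w , leaf-w with needs≡ v≢w | used≡ w
  ...   | n≡ | u≡ rewrite e | e′ | isLeaf-true leaf-w | u≡ with () ← n≡
  lemma leaf core e e′ with another (isLeaf ∘ ρ) (subst (2 ≤_) (sym ls) 2≤t) v
  ... | w , v≢w , leaf-w with needs≡ v≢w | used≡ w
  ...   | n≡ | u≡ rewrite e | e′ | isLeaf-true leaf-w | sym u≡ with () ← n≡

used-if : ∀ b → isUsed (if b then core else leaf) ≡ true
used-if true  = refl
used-if false = refl

enumeration : (ρ : Fin n → Role) → count (isCore ∘ ρ) ≡ s → count (isLeaf ∘ ρ) ≡ t → ∃ (Enumerates s t ρ)
enumeration ρ refl refl = enumerate ρ

module _ (G : Graph n) where

  valid⇒copy : ∀ {ρ x} → Valid (adj G) s t ρ → Labels ρ x → isCopyB s t G x ≡ true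
  valid⇒copy {s} {t} {ρ} {U , F} (cs , ls , edges) (U≡ , F≡) = ∧-⁺ subgraph iso
    where
    subgraph : isSubgraphB G U F ≡ true
    subgraph = isSubgraphB⁺ G U F F-sym edge
      where
      F-sym : ∀ i j → F i j ≡ F j i
      F-sym i j rewrite F≡ i j | F≡ j i = cong₂ (λ a b → not a ∧ b)
        (eqF-sym i j)
        (needs-sym (ρ i) (ρ j))
      edge : ∀ i j → F i j ≡ true → adj G i j ≡ true × U i ≡ true × U j ≡ true
      edge i j Fij with i ≟F j | F≡ i j
      ... | yes refl | e with () ← trans (sym Fij) e
      ... | no i≢j   | e with needs-used (ρ i) (ρ j) (trans (sym e) Fij)
      ...   | ui , uj = edges i j i≢j (trans (sym e) Fij) , trans (U≡ i) ui , trans (U≡ j) uj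
    iso : isoB (Kstar s t) U F ≡ true
    iso = let φ , en = enumeration ρ cs ls
              open Enumerates en in
      isoB⁺ (Kstar s t) U F record
        { φ = φ ; inj = inj
        ; into = λ i → trans (U≡ (φ i)) (trans (cong isUsed (role i)) (used-if (toℕ i <ᵇ s)))
        ; onto = λ v Uv → surj v (trans (sym (U≡ v)) Uv)
        ; edges = λ i j → trans (Kstar≡ en i j) (sym (F≡ (φ i) (φ j))) }

  copy⇒valid : ∀ {x} → isCopyB s t G x ≡ true → ∃ λ ρ → Valid (adj G) s t ρ × Labels ρ x
  copy⇒valid {s} {t} {U , F} copy = ρ , (count-core en , count-leaf en , valid-edge) , U≡ , F≡
    where
    iso : IsIso (Kstar s t) U F
    iso = isoB⁻ (Kstar s t) U F (proj₂ (∧-⁻ {isSubgraphB G U F} copy))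
    open IsIso iso
    ρ : Fin n → Role
    ρ v with any? (λ i → φ i ≟F v)
    ... | yes (i , _) = if toℕ i <ᵇ s then core else leaf
    ... | no _        = none
    ρ-φ : ∀ i → ρ (φ i) ≡ (if toℕ i <ᵇ s then core else leaf)
    ρ-φ i with any? (λ j → φ j ≟F φ i)
    ... | yes (j , e) rewrite inj e = refl
    ... | no ∄ = contradiction (i , refl) ∄
    ρ-onto : ∀ v → isUsed (ρ v) ≡ true → ∃ λ i → φ i ≡ v
    ρ-onto v used with any? (λ i → φ i ≟F v)
    ... | yes p = p
    en : Enumerates s t ρ φ
    en = record { role = ρ-φ ; inj = inj ; surj = ρ-onto }
    used-φ : ∀ i → isUsed (ρ (φ i)) ≡ true
    used-φ i = trans (cong isUsed (ρ-φ i)) (used-if (toℕ i <ᵇ s))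
    U≡ : ∀ v → U v ≡ isUsed (ρ v)
    U≡ v = Bool-ext (λ Uv → case onto v Uv of λ where (i , refl) → used-φ i)
                    (λ u → case ρ-onto v u of λ where (i , refl) → into i)
    F⇒ : ∀ u v → F u v ≡ true → adj G u v ≡ true × U u ≡ true × U v ≡ true
    F⇒ = isSubgraphB⁻ G U F (proj₁ (∧-⁻ copy))
    F-φ : ∀ i j → F (φ i) (φ j) ≡ not (eqF (φ i) (φ j)) ∧ needs (ρ (φ i)) (ρ (φ j))
    F-φ i j = trans (sym (edges i j)) (Kstar≡ en i j)
    F≡ : ∀ u v → F u v ≡ not (eqF u v) ∧ needs (ρ u) (ρ v)
    F≡ u v = Bool-ext to from
      where
      to : F u v ≡ true → not (eqF u v) ∧ needs (ρ u) (ρ v) ≡ true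
      to Fuv = let _ , Uu , Uv = F⇒ u v Fuv in image (onto u Uu) (onto v Uv)
        where
        image : (∃ λ i → φ i ≡ u) → (∃ λ j → φ j ≡ v) → not (eqF u v) ∧ needs (ρ u) (ρ v) ≡ true
        image (i , refl) (j , refl) = trans (sym (F-φ i j)) Fuv
      from : not (eqF u v) ∧ needs (ρ u) (ρ v) ≡ true → F u v ≡ true
      from h = let uu , uv = needs-used (ρ u) (ρ v) (proj₂ (∧-⁻ {not (eqF u v)} h)) in
               image (ρ-onto u uu) (ρ-onto v uv)
        where
        image : (∃ λ i → φ i ≡ u) → (∃ λ j → φ j ≡ v) → F u v ≡ true
        image (i , refl) (j , refl) = trans (F-φ i j) h
    valid-edge : ∀ u v → u ≢ v → needs (ρ u) (ρ v) ≡ true → adj G u v ≡ true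
    valid-edge u v u≢v nd = proj₁ (F⇒ u v (trans (F≡ u v) (∧-⁺ (cong not (eqF-≢ u≢v)) nd)))

  -- The relation `Labels` is injective both ways: a labelling fixes its subgraph outright, and the
  -- subgraph fixes the labelling by `labels-unique`.
  copies≡labellings : 2 ≤ t → copies (Kstar s t) G ≡ labellings (adj G) s t
  copies≡labellings {t} {s} 2≤t = ≤-antisym
    (injective⇒length≤ {R = λ x ρ → Labels ρ x}
      (AllPairs.map (λ x≉y ρ (U≡ , F≡) (U≡′ , F≡′) → x≉y
          ((λ v → trans (U≡ v) (sym (U≡′ v))) , (λ u v → trans (F≡ u v) (sym (F≡′ u v)))))
        (AllPairsP.filter⁺ (isCopy? s t G) (subgraphs-unique n)))
      (All.map hasLabelling (AllP.all-filter (isCopy? s t G) (subgraphs n))))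
    (injective⇒length≤ {R = λ ρ x → Labels ρ x}
      (all-pairs (λ v v′ ρ≉ x l l′ → ρ≉ (labels-unique {x = x} 2≤t v v′ l l′))
        (AllP.all-filter (valid? (adj G) s t) (funs n roles))
        (AllPairsP.filter⁺ (valid? (adj G) s t) (funs-unique n roles-unique)))
      (All.map hasCopy (AllP.all-filter (valid? (adj G) s t) (funs n roles))))
    where
    hasLabelling : ∀ {x} → isCopyB s t G x ≡ true →
                   Any (λ ρ → Labels ρ x) (filter (valid? (adj G) s t) (funs n roles))
    hasLabelling {x} c = let ρ , v , (U≡ , F≡) = copy⇒valid c in Any.map
      (λ e → (λ v → trans (U≡ v) (cong isUsed (e v))) ,
             (λ u v → trans (F≡ u v) (cong₂ (λ a b → not (eqF u v) ∧ needs a b) (e u) (e v))))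
      (any-filter (valid? (adj G) s t) (λ e → Valid-resp e v)
        (funs-complete {_≈_ = _≡_} n ρ (λ i → roles-complete (ρ i))))
    hasCopy : ∀ {ρ} → Valid (adj G) s t ρ → Any (Labels ρ) (filter (isCopy? s t G) (subgraphs n))
    hasCopy {ρ} v = any-filter (isCopy? s t G) (valid⇒copy v)
      (Any.map (λ (U≡ , F≡) → (sym ∘ U≡) , (λ u v → sym (F≡ u v)))
        (subgraphs-complete ((isUsed ∘ ρ) , λ u v → not (eqF u v) ∧ needs (ρ u) (ρ v))))

-- Shifting

Dominates : Role → Role → Set
Dominates r r′ = ∀ x → needs r′ x ≡ true → needs r x ≡ true

-- The sets of labels to be joined to form a chain: nothing for `none`, the core for `leaf`, every
-- used vertex for `core`. Hence of the two placements of a copy on i and j, one always survives the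
-- shift.
dominates-total : ∀ r r′ → Dominates r r′ ⊎ Dominates r′ r
dominates-total core r    = inj₁ λ x nd → proj₂ (needs-used r x nd)
dominates-total none r    = inj₂ λ x ()
dominates-total leaf none = inj₁ λ x ()
dominates-total leaf leaf = inj₁ λ x nd → nd
dominates-total leaf core = inj₂ λ x nd → proj₂ (needs-used leaf x nd)

module Shift (i j : Fin n) (i≢j : i ≢ j) where

  σ : Fin n → Fin n
  σ v = if eqF v i then j else if eqF v j then i else v

  σ-i : σ i ≡ j
  σ-i rewrite eqF-refl i = refl

  σ-j : σ j ≡ i
  σ-j rewrite eqF-≢ (i≢j ∘ sym) | eqF-refl j = refl

  σ-other : ∀ {v} → v ≢ i → v ≢ j → σ v ≡ v
  σ-other v≢i v≢j rewrite eqF-≢ v≢i | eqF-≢ v≢j = refl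

  data View : Fin n → Set where
    is-i  : View i
    is-j  : View j
    other : ∀ {v} → v ≢ i → v ≢ j → View v

  view : ∀ v → View v
  view v with v ≟F i | v ≟F j
  ... | yes refl | _        = is-i
  ... | no _     | yes refl = is-j
  ... | no v≢i   | no v≢j   = other v≢i v≢j

  σσ : ∀ v → σ (σ v) ≡ v
  σσ v with view v
  ... | is-i = trans (cong σ σ-i) σ-j
  ... | is-j = trans (cong σ σ-j) σ-i
  ... | other v≢i v≢j = trans (cong σ (σ-other v≢i v≢j)) (σ-other v≢i v≢j)

  σ-injective : ∀ {u v} → σ u ≡ σ v → u ≡ v
  σ-injective e = trans (sym (σσ _)) (trans (cong σ e) (σσ _))

  count-σ : (p : Fin n → Bool) → count (p ∘ σ) ≡ count p
  count-σ p = trans (sym (length≡count (p ∘ σ) (UniqueP.map⁺ σ-injective (trues-unique p)) to from))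
                    (length-map σ (trues p))
    where
    to : ∀ {v} → v ∈ map σ (trues p) → p (σ v) ≡ true
    to v∈ with ∈-map⁻ σ v∈
    ... | u , u∈ , refl = trans (cong p (σσ u)) (∈-trues⁻ p u∈)
    from : ∀ {v} → p (σ v) ≡ true → v ∈ map σ (trues p)
    from {v} pσv = subst (_∈ map σ (trues p)) (σσ v) (∈-map⁺ σ (∈-trues⁺ p pσv))

  -- Compression towards i: every edge jv with iv absent is replaced by iv.
  shift : (Fin n → Fin n → Bool) → Fin n → Fin n → Bool
  shift E u v = if eqF u i ∨ eqF v i then E u v ∨ E (σ u) (σ v) else E u v ∧ E (σ u) (σ v)

  shift-∨ : ∀ {E u v} → u ≡ i ⊎ v ≡ i → shift E u v ≡ E u v ∨ E (σ u) (σ v)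
  shift-∨ {u = u} {v} u≡i⊎v≡i with eqF u i ∨ eqF v i in eq
  ... | true  = refl
  shift-∨ {u = u} {v} (inj₁ refl) | false with () ← trans (sym eq) (∨-⁺ˡ (eqF-refl i))
  shift-∨ {u = u} {v} (inj₂ refl) | false with () ← trans (sym eq) (∨-⁺ʳ {eqF u i} (eqF-refl i))

  shift-∧ : ∀ {E u v} → u ≢ i → v ≢ i → shift E u v ≡ E u v ∧ E (σ u) (σ v)
  shift-∧ u≢i v≢i rewrite eqF-≢ u≢i | eqF-≢ v≢i = refl

  ∧⇒shift : ∀ E {u v} → E u v ≡ true → E (σ u) (σ v) ≡ true → shift E u v ≡ true
  ∧⇒shift E {u} {v} e e′ with eqF u i ∨ eqF v i
  ... | true  = ∨-⁺ˡ e
  ... | false = ∧-⁺ e e′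

  -- The shift looks only at the unordered pair of `E u v` and `E (σ u) (σ v)`. This reduces the
  -- case where the label of j dominates to the one where the label of i does.
  shift-σ : ∀ E u v → shift (λ u v → E (σ u) (σ v)) u v ≡ shift E u v
  shift-σ E u v rewrite σσ u | σσ v with eqF u i ∨ eqF v i
  ... | true  = ∨-comm (E (σ u) (σ v)) (E u v)
  ... | false = ∧-comm (E (σ u) (σ v)) (E u v)

  shiftG : Graph n → Graph n
  shiftG G = record { adj = shift (adj G) ; sym = shift-sym ; irrefl = shift-irrefl }
    where
    shift-sym : ∀ u v → shift (adj G) u v ≡ shift (adj G) v u
    shift-sym u v rewrite adj-sym G u v | adj-sym G (σ u) (σ v) | ∨-comm (eqF u i) (eqF v i) = refl
    shift-irrefl : ∀ u → shift (adj G) u u ≡ false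
    shift-irrefl u rewrite irrefl G u | irrefl G (σ u) with eqF u i ∨ eqF u i
    ... | true  = refl
    ... | false = refl

  valid-σ : ∀ {E ρ} → Valid E s t ρ → Valid (λ u v → E (σ u) (σ v)) s t (ρ ∘ σ)
  valid-σ {ρ = ρ} (cs , ls , h) = trans (count-σ (isCore ∘ ρ)) cs , trans (count-σ (isLeaf ∘ ρ)) ls ,
    λ u v u≢v → h (σ u) (σ v) (u≢v ∘ σ-injective)

  -- The shift destroys an edge jv only if iv is absent; but if ρ needs jv, domination makes it need
  -- iv as well, so iv is present.
  valid-shift-dom : ∀ {E ρ} → Dominates (ρ i) (ρ j) → Valid E s t ρ → Valid (shift E) s t ρ
  valid-shift-dom {E = E} {ρ} dom (cs , ls , h) = cs , ls , λ u v u≢v nd → edge u v u≢v nd (view u) (view v)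
    where
    edge : ∀ u v → u ≢ v → needs (ρ u) (ρ v) ≡ true → View u → View v → shift E u v ≡ true
    edge u v u≢v nd is-i _ = trans (shift-∨ {E} {u} {v} (inj₁ refl)) (∨-⁺ˡ (h u v u≢v nd))
    edge u v u≢v nd _ is-i = trans (shift-∨ {E} {u} {v} (inj₂ refl)) (∨-⁺ˡ (h u v u≢v nd))
    edge u v u≢v nd is-j is-j = contradiction refl u≢v
    edge u v u≢v nd is-j (other v≢i v≢j) = ∧⇒shift E (h u v u≢v nd)
      (trans (cong₂ E σ-j (σ-other v≢i v≢j)) (h i v (v≢i ∘ sym) (dom _ nd)))
    edge u v u≢v nd (other u≢i u≢j) is-j = ∧⇒shift E (h u v u≢v nd)
      (trans (cong₂ E (σ-other u≢i u≢j) σ-j)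
        (h u i u≢i (trans (needs-sym (ρ u) (ρ i)) (dom _ (trans (needs-sym (ρ j) (ρ u)) nd)))))
    edge u v u≢v nd (other u≢i u≢j) (other v≢i v≢j) = ∧⇒shift E (h u v u≢v nd)
      (trans (cong₂ E (σ-other u≢i u≢j) (σ-other v≢i v≢j)) (h u v u≢v nd))

  valid-shift-either : ∀ {E ρ} → Valid E s t ρ → Valid (shift E) s t ρ ⊎ Valid (shift E) s t (ρ ∘ σ)
  valid-shift-either {s = s} {t} {E} {ρ} val with dominates-total (ρ i) (ρ j)
  ... | inj₁ dom = inj₁ (valid-shift-dom dom val)
  ... | inj₂ dom with valid-shift-dom {ρ = ρ ∘ σ} (subst₂ (λ a b → Dominates (ρ a) (ρ b)) (sym σ-i) (sym σ-j) dom)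
                                      (valid-σ {ρ = ρ} val)
  ...   | cs , ls , h = inj₂ (cs , ls , λ u v u≢v nd → trans (sym (shift-σ E u v)) (h u v u≢v nd))

  -- The source of injectivity in `labellings-shift`: a ρ that is moved to `ρ ∘ σ` could collide
  -- only with a labelling already valid for E, and then ρ itself would have survived and not been
  -- moved.
  valid-shift-both : ∀ {E ρ} → Valid E s t ρ → Valid E s t (ρ ∘ σ) → Valid (shift E) s t ρ
  valid-shift-both {E = E} {ρ} (cs , ls , h) (_ , _ , h′) = cs , ls , λ u v u≢v nd →
    ∧⇒shift E (h u v u≢v nd) (h′ (σ u) (σ v) (u≢v ∘ σ-injective)
      (subst₂ (λ a b → needs (ρ a) (ρ b) ≡ true) (sym (σσ u)) (sym (σσ v)) nd))

  -- The injection fixes ρ when it survives the shift and otherwise applies σ to it.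
  labellings-shift : ∀ E s t → labellings E s t ≤ labellings (shift E) s t
  labellings-shift E s t = injective⇒length≤ {R = R}
    (all-pairs (λ v v′ ρ≉ ρ″ r r′ → ρ≉ (R-injective v v′ r r′))
      (AllP.all-filter (valid? E s t) (funs n roles))
      (AllPairsP.filter⁺ (valid? E s t) (funs-unique n roles-unique)))
    (All.map target (AllP.all-filter (valid? E s t) (funs n roles)))
    where
    R : (Fin n → Role) → (Fin n → Role) → Set
    R ρ ρ′ = (∀ v → ρ v ≡ ρ′ v) ⊎ (¬ Valid (shift E) s t ρ × (∀ v → ρ (σ v) ≡ ρ′ v))
    R-injective : ∀ {ρ₁ ρ₂ ρ′} → Valid E s t ρ₁ → Valid E s t ρ₂ → R ρ₁ ρ′ → R ρ₂ ρ′ → ∀ v → ρ₁ v ≡ ρ₂ v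
    R-injective v₁ v₂ (inj₁ e) (inj₁ e′) v = trans (e v) (sym (e′ v))
    R-injective v₁ v₂ (inj₁ e) (inj₂ (¬v , e′)) v = contradiction
      (valid-shift-both v₂ (Valid-resp (λ v → trans (e v) (sym (e′ v))) v₁)) ¬v
    R-injective v₁ v₂ (inj₂ (¬v , e)) (inj₁ e′) v = contradiction
      (valid-shift-both v₁ (Valid-resp (λ v → trans (e′ v) (sym (e v))) v₂)) ¬v
    R-injective {ρ₁} {ρ₂} v₁ v₂ (inj₂ (_ , e)) (inj₂ (_ , e′)) v =
      subst (λ w → ρ₁ w ≡ ρ₂ w) (σσ v) (trans (e (σ v)) (sym (e′ (σ v))))
    listed : ∀ ρ → Valid (shift E) s t ρ →
             Any (λ ρ′ → ∀ v → ρ v ≡ ρ′ v) (filter (valid? (shift E) s t) (funs n roles))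
    listed ρ val = any-filter (valid? (shift E) s t) (λ e → Valid-resp e val)
                     (funs-complete {_≈_ = _≡_} n ρ (λ v → roles-complete (ρ v)))
    target : ∀ {ρ} → Valid E s t ρ → Any (R ρ) (filter (valid? (shift E) s t) (funs n roles))
    target {ρ} val with valid? (shift E) s t ρ | valid-shift-either val
    ... | yes v | _      = Any.map inj₁ (listed ρ v)
    ... | no ¬v | inj₁ v = contradiction v ¬v
    ... | no ¬v | inj₂ v = Any.map (λ e → inj₂ (¬v , e)) (listed (ρ ∘ σ) v)

-- Scores of orderings under exchange and reversal

at : (A → Bool) → Maybe A → Bool
at p nothing  = false
at p (just x) = p x

head-reverse : ∀ (xs : List A) → head (reverse xs) ≡ last xs
last-reverse : ∀ (xs : List A) → last (reverse xs) ≡ head xs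

last-∷ʳ : ∀ (xs : List A) x → last (xs ++ [ x ]) ≡ just x
last-∷ʳ []           x = refl
last-∷ʳ (_ ∷ [])     x = refl
last-∷ʳ (_ ∷ y ∷ xs) x = last-∷ʳ (y ∷ xs) x

last-reverse []       = refl
last-reverse (x ∷ xs) = trans (cong last (unfold-reverse x xs)) (last-∷ʳ (reverse xs) x)

head-reverse xs = trans (sym (last-reverse (reverse xs))) (cong last (reverse-involutive xs))

head-All : ∀ {P : A → Set} {xs} → All P xs → MAll.All P (head xs)
head-All []      = nothing
head-All (p ∷ _) = just p

last-All : ∀ {P : A → Set} {xs} → All P xs → MAll.All P (last xs)
last-All []           = nothing
last-All (p ∷ [])     = just p
last-All (_ ∷ q ∷ ps) = last-All (q ∷ ps)

score : (A → A → Bool) → List A → ℕ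
score E []           = 0
score E (x ∷ [])     = 0
score E (x ∷ y ∷ xs) = b2n (E x y) + score E (y ∷ xs)

score-∷ : ∀ (E : A → A → Bool) x xs → score E (x ∷ xs) ≡ b2n (at (E x) (head xs)) + score E xs
score-∷ E x []      = refl
score-∷ E x (y ∷ _) = refl

score-cong : ∀ {E E′ : A → A → Bool} {P : A → Set} → (∀ {x y} → P x → P y → E x y ≡ E′ x y) →
             ∀ {xs} → All P xs → score E xs ≡ score E′ xs
score-cong h []           = refl
score-cong h (_ ∷ [])     = refl
score-cong h (p ∷ q ∷ ps) = cong₂ _+_ (cong b2n (h p q)) (score-cong h (q ∷ ps))

module _ {E : A → A → Bool} (E-sym : ∀ x y → E x y ≡ E y x) where

  score-++∷ : ∀ xs z ys → score E (xs ++ z ∷ ys)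
            ≡ score E xs + b2n (at (E z) (last xs)) + b2n (at (E z) (head ys)) + score E ys
  score-++∷ []            z ys = score-∷ E z ys
  score-++∷ (x ∷ [])      z ys = trans (cong₂ _+_ (cong b2n (E-sym x z)) (score-∷ E z ys))
                                       (sym (+-assoc (b2n (E z x)) _ _))
  score-++∷ (x ∷ y ∷ xs)  z ys = trans (cong (b2n (E x y) +_) (score-++∷ (y ∷ xs) z ys))
    (lemma (b2n (E x y)) (score E (y ∷ xs)) (b2n (at (E z) (last (y ∷ xs)))) (b2n (at (E z) (head ys))) (score E ys))
    where
    lemma : ∀ a b c d e → a + (b + c + d + e) ≡ a + b + c + d + e
    lemma = solve-∀

  score-reverse : ∀ xs → score E (reverse xs) ≡ score E xs
  score-reverse []       = refl
  score-reverse (x ∷ xs) = begin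
    score E (reverse (x ∷ xs))      ≡⟨ cong (score E) (unfold-reverse x xs) ⟩
    score E (reverse xs ++ x ∷ [])  ≡⟨ score-++∷ (reverse xs) x [] ⟩
    score E (reverse xs) + b2n (at (E x) (last (reverse xs))) + 0 + 0
      ≡⟨ cong₂ (λ a m → a + b2n (at (E x) m) + 0 + 0) (score-reverse xs) (last-reverse xs) ⟩
    score E xs + b2n (at (E x) (head xs)) + 0 + 0
      ≡⟨ lemma (score E xs) (b2n (at (E x) (head xs))) ⟩
    b2n (at (E x) (head xs)) + score E xs ≡⟨ score-∷ E x xs ⟨
    score E (x ∷ xs) ∎
    where
    open ≡-Reasoning
    lemma : ∀ a b → a + b + 0 + 0 ≡ b + a
    lemma = solve-∀

  -- Separates what no rearrangement affects, the scores of the three stretches, from the four links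
  -- at p and q. The middle stretch is nonempty; otherwise p and q share a link.
  score-two : ∀ xs p y ys q zs → score E (xs ++ p ∷ (y ∷ ys) ++ q ∷ zs)
    ≡ (score E xs + score E (y ∷ ys) + score E zs) +
      (b2n (at (E p) (last xs)) + b2n (at (E p) (just y)) +
        (b2n (at (E q) (last (y ∷ ys))) + b2n (at (E q) (head zs))))
  score-two xs p y ys q zs =
    trans (score-++∷ xs p (y ∷ ys ++ q ∷ zs))
      (trans (cong (score E xs + b2n (at (E p) (last xs)) + b2n (E p y) +_) (score-++∷ (y ∷ ys) q zs))
        (lemma (score E xs) _ _ (score E (y ∷ ys)) _ _ (score E zs)))
    where
    lemma : ∀ sx a b sy c d sz → sx + a + b + (sy + c + d + sz) ≡ (sx + sy + sz) + (a + b + (c + d))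
    lemma = solve-∀

  score-two-reverse : ∀ xs p y ys q zs → score E (xs ++ p ∷ reverse (y ∷ ys) ++ q ∷ zs)
    ≡ (score E xs + score E (y ∷ ys) + score E zs) +
      (b2n (at (E p) (last xs)) + b2n (at (E p) (last (y ∷ ys))) +
        (b2n (at (E q) (just y)) + b2n (at (E q) (head zs))))
  score-two-reverse xs p y ys q zs = go (reverse (y ∷ ys)) refl
    where
    go : ∀ rs → reverse (y ∷ ys) ≡ rs → score E (xs ++ p ∷ rs ++ q ∷ zs)
       ≡ (score E xs + score E (y ∷ ys) + score E zs) +
         (b2n (at (E p) (last xs)) + b2n (at (E p) (last (y ∷ ys))) +
           (b2n (at (E q) (just y)) + b2n (at (E q) (head zs))))
    go [] e with () ← trans (sym (cong last e)) (last-reverse (y ∷ ys))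
    go (r ∷ rs) e = trans (score-two xs p r rs q zs)
      (cong₂ (λ S (l , m) → (score E xs + S + score E zs) +
               (b2n (at (E p) (last xs)) + b2n (at (E p) l) + (b2n (at (E q) m) + b2n (at (E q) (head zs)))))
        (trans (cong (score E) (sym e)) (score-reverse (y ∷ ys)))
        (cong₂ _,_ (trans (cong head (sym e)) (head-reverse (y ∷ ys)))
                   (trans (cong last (sym e)) (last-reverse (y ∷ ys)))))

-- In an ordering … v p w … x q y …, the index 1 (2) of a neighbour records its adjacency
-- to p (q); unite counts the links once all edges possible are moved from q to p.
module Links (v₁ v₂ w₁ w₂ x₁ x₂ y₁ y₂ : Bool) where
  keep exchange turn both unite : ℕ
  keep     = b2n v₁ + b2n w₁ + (b2n x₂ + b2n y₂)
  exchange = b2n v₂ + b2n w₂ + (b2n x₁ + b2n y₁)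
  turn     = b2n v₁ + b2n x₁ + (b2n w₂ + b2n y₂)
  both     = b2n v₂ + b2n x₂ + (b2n w₁ + b2n y₁)
  unite    = b2n (v₁ ∨ v₂) + b2n (w₁ ∨ w₂) + (b2n (x₁ ∧ x₂) + b2n (y₁ ∧ y₂))

  private
    ∨-one : ∀ a b → b2n (a ∨ b) ≤ b2n a ⊎ b2n (a ∨ b) ≤ b2n b
    ∨-one true  b = inj₁ ≤-refl
    ∨-one false b = inj₂ ≤-refl
    ∧ˡ : ∀ a b → b2n (a ∧ b) ≤ b2n a
    ∧ˡ true  true  = ≤-refl
    ∧ˡ true  false = z≤n
    ∧ˡ false b     = z≤n
    ∧ʳ : ∀ a b → b2n (a ∧ b) ≤ b2n b
    ∧ʳ true  b = ≤-refl
    ∧ʳ false b = z≤n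
    cross : ∀ a b c d → a + b + (c + d) ≡ a + c + (b + d)
    cross = solve-∀

  -- Each of the two disjunctions is attained by index 1 or by index 2, and these two choices select
  -- the rearrangement; the conjunctions are below both of their arguments and accept any choice.
  unite≤ : unite ≤ keep ⊎ unite ≤ exchange ⊎ unite ≤ turn ⊎ unite ≤ both
  unite≤ with ∨-one v₁ v₂ | ∨-one w₁ w₂
  ... | inj₁ v | inj₁ w = inj₁ (+-mono-≤ (+-mono-≤ v w) (+-mono-≤ (∧ʳ x₁ x₂) (∧ʳ y₁ y₂)))
  ... | inj₂ v | inj₂ w = inj₂ (inj₁ (+-mono-≤ (+-mono-≤ v w) (+-mono-≤ (∧ˡ x₁ x₂) (∧ˡ y₁ y₂))))
  ... | inj₁ v | inj₂ w = inj₂ (inj₂ (inj₁ (subst (unite ≤_) (cross (b2n v₁) (b2n w₂) (b2n x₁) (b2n y₂))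
                            (+-mono-≤ (+-mono-≤ v w) (+-mono-≤ (∧ˡ x₁ x₂) (∧ʳ y₁ y₂))))))
  ... | inj₂ v | inj₁ w = inj₂ (inj₂ (inj₂ (subst (unite ≤_) (cross (b2n v₂) (b2n w₁) (b2n x₂) (b2n y₁))
                            (+-mono-≤ (+-mono-≤ v w) (+-mono-≤ (∧ʳ x₁ x₂) (∧ˡ y₁ y₂))))))

-- The case in which q gathers the edges of p. It is the previous case for the ordering read
-- backwards, so y, x, w, v take the places of v, w, x, y and the indices are exchanged.
module LinksMirrored (v₁ v₂ w₁ w₂ x₁ x₂ y₁ y₂ : Bool) where
  open Links v₁ v₂ w₁ w₂ x₁ x₂ y₁ y₂ public using (keep; exchange; turn; both)
  unite : ℕ
  unite = b2n (v₁ ∧ v₂) + b2n (w₁ ∧ w₂) + (b2n (x₁ ∨ x₂) + b2n (y₁ ∨ y₂))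

  private module M = Links y₂ y₁ x₂ x₁ w₂ w₁ v₂ v₁

  unite≤ : unite ≤ keep ⊎ unite ≤ exchange ⊎ unite ≤ turn ⊎ unite ≤ both
  unite≤ = [ (λ h → inj₁ (via (mirror (b2n v₁) (b2n w₁) (b2n x₂) (b2n y₂)) h)) ,
           [ (λ h → inj₂ (inj₁ (via (mirror (b2n v₂) (b2n w₂) (b2n x₁) (b2n y₁)) h))) ,
           [ (λ h → inj₂ (inj₂ (inj₁ (via (mirror (b2n v₁) (b2n x₁) (b2n w₂) (b2n y₂)) h)))) ,
             (λ h → inj₂ (inj₂ (inj₂ (via (mirror (b2n v₂) (b2n x₂) (b2n w₁) (b2n y₁)) h)))) ]′ ]′ ]′ M.unite≤
    where
    mirror : ∀ a b c d → d + c + (b + a) ≡ a + b + (c + d)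
    mirror = solve-∀
    unite≡ : unite ≡ M.unite
    unite≡ rewrite ∧-comm v₁ v₂ | ∧-comm w₁ w₂ | ∨-comm x₁ x₂ | ∨-comm y₁ y₂ =
      sym (mirror (b2n (v₂ ∧ v₁)) (b2n (w₂ ∧ w₁)) (b2n (x₂ ∨ x₁)) (b2n (y₂ ∨ y₁)))
    via : ∀ {o o′} → o ≡ o′ → M.unite ≤ o → unite ≤ o′
    via refl h = ≤-trans (≤-reflexive unite≡) h

at-zip : ∀ {P : A → Set} {p q r : A → Bool} (_∙_ : Bool → Bool → Bool) → false ∙ false ≡ false →
         ∀ {m} → MAll.All P m → (∀ {x} → P x → r x ≡ p x ∙ q x) → at r m ≡ at p m ∙ at q m
at-zip _∙_ e nothing  h = sym e
at-zip _∙_ e (just a) h = h a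

module Exchange {G G′ : Graph n} {p q : Fin n} where

  private
    E E′ : Fin n → Fin n → Bool
    E  = adj G
    E′ = adj G′

  Away : Fin n → Set
  Away w = w ≢ p × w ≢ q

  -- Here p is the vertex that comes first in the ordering, so it may be either the one that gathers
  -- the edges or the one that gives them up.
  Near : Set
  Near = (∀ {w} → Away w → E′ p w ≡ E p w ∨ E q w × E′ q w ≡ E p w ∧ E q w) ⊎
         (∀ {w} → Away w → E′ p w ≡ E p w ∧ E q w × E′ q w ≡ E p w ∨ E q w)

  module _ (far : ∀ {u v} → Away u → Away v → E′ u v ≡ E u v) (pq : E′ p q ≡ E p q)
           (near : Near) where

    private
      module L (v w x y : Maybe (Fin n)) =
        Links (at (E p) v) (at (E q) v) (at (E p) w) (at (E q) w) (at (E p) x) (at (E q) x) (at (E p) y) (at (E q) y)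

      links : Near → ∀ {v w x y} → MAll.All Away v → MAll.All Away w → MAll.All Away x → MAll.All Away y →
              let S = b2n (at (E′ p) v) + b2n (at (E′ p) w) + (b2n (at (E′ q) x) + b2n (at (E′ q) y)) in
              S ≤ L.keep v w x y ⊎ S ≤ L.exchange v w x y ⊎ S ≤ L.turn v w x y ⊎ S ≤ L.both v w x y
      links (inj₁ h) {v} {w} {x} {y} av aw ax ay rewrite at-zip _∨_ refl av (proj₁ ∘ h) | at-zip _∨_ refl aw (proj₁ ∘ h)
                       | at-zip _∧_ refl ax (proj₂ ∘ h) | at-zip _∧_ refl ay (proj₂ ∘ h) =
        Links.unite≤ (at (E p) v) (at (E q) v) (at (E p) w) (at (E q) w) (at (E p) x) (at (E q) x) (at (E p) y) (at (E q) y)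
      links (inj₂ h) {v} {w} {x} {y} av aw ax ay rewrite at-zip _∧_ refl av (proj₁ ∘ h) | at-zip _∧_ refl aw (proj₁ ∘ h)
                       | at-zip _∨_ refl ax (proj₂ ∘ h) | at-zip _∨_ refl ay (proj₂ ∘ h) =
        LinksMirrored.unite≤ (at (E p) v) (at (E q) v) (at (E p) w) (at (E q) w) (at (E p) x) (at (E q) x) (at (E p) y) (at (E q) y)

      swap-↭ : ∀ xs ys zs → xs ++ q ∷ ys ++ p ∷ zs ↭ xs ++ p ∷ ys ++ q ∷ zs
      swap-↭ xs ys zs = Perm.++⁺ˡ xs (↭-trans (prep q (Perm.shift p ys zs))
        (↭-trans (swap q p ↭-refl) (prep p (↭-sym (Perm.shift q ys zs)))))

      reverse-↭ : ∀ xs ys zs → xs ++ p ∷ reverse ys ++ q ∷ zs ↭ xs ++ p ∷ ys ++ q ∷ zs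
      reverse-↭ xs ys zs = Perm.++⁺ˡ xs (prep p (Perm.++⁺ʳ (q ∷ zs) (Perm.↭-reverse ys)))

      score-one : ∀ {F : Fin n → Fin n → Bool} → (∀ u v → F u v ≡ F v u) → ∀ xs a b zs →
                  score F (xs ++ a ∷ b ∷ zs) ≡ (score F xs + b2n (F a b) + score F zs) +
                    (b2n (at (F a) (last xs)) + 0 + (0 + b2n (at (F b) (head zs))))
      score-one {F} F-sym xs a b zs = trans (score-++∷ F-sym xs a (b ∷ zs))
        (trans (cong (score F xs + b2n (at (F a) (last xs)) + b2n (F a b) +_) (score-∷ F b zs))
          (lemma (score F xs) (b2n (at (F a) (last xs))) (b2n (F a b)) (b2n (at (F b) (head zs))) (score F zs)))
        where
        lemma : ∀ s v e y z → s + v + e + (y + z) ≡ (s + e + z) + (v + 0 + (0 + y))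
        lemma = solve-∀

      via : ∀ {a b K K′ S S′} → a ≡ K′ + S′ → K′ ≡ K → S′ ≤ S → b ≡ K + S → a ≤ b
      via {K = K} refl refl h refl = +-monoʳ-≤ K h

    exchange : ∀ xs ys zs → All Away xs → All Away ys → All Away zs →
               ∃ λ vs → vs ↭ xs ++ p ∷ ys ++ q ∷ zs × score E′ (xs ++ p ∷ ys ++ q ∷ zs) ≤ score E vs
    -- With nothing between p and q there is no stretch to reverse: w and x are absent, `turn`
    -- amounts to `keep` and `both` to `exchange`, and the link pq belongs to the unaffected part.
    exchange xs [] zs axs [] azs = choose (links near (last-All axs) nothing nothing (head-All azs))
      where
      frame : score E′ xs + b2n (E′ p q) + score E′ zs ≡ score E xs + b2n (E p q) + score E zs
      frame = cong₂ _+_ (cong₂ _+_ (score-cong far axs) (cong b2n pq)) (score-cong far azs)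
      frame-sym : score E xs + b2n (E q p) + score E zs ≡ score E xs + b2n (E p q) + score E zs
      frame-sym rewrite adj-sym G q p = refl
      total = score-one (adj-sym G′) xs p q zs
      stay = score-one (adj-sym G) xs p q zs
      swapped = trans (score-one (adj-sym G) xs q p zs) (cong (_+ (b2n (at (E q) (last xs)) + 0 + (0 + b2n (at (E p) (head zs))))) frame-sym)
      choose : _ → _
      choose (inj₁ h)               = _ , ↭-refl , via total frame h stay
      choose (inj₂ (inj₁ h))        = _ , swap-↭ xs [] zs , via total frame h swapped
      choose (inj₂ (inj₂ (inj₁ h))) = _ , ↭-refl , via total frame h stay
      choose (inj₂ (inj₂ (inj₂ h))) = _ , swap-↭ xs [] zs , via total frame h swapped
    exchange xs ys@(y ∷ ys′) zs axs ays@(ay ∷ _) azs =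
      choose (links near (last-All axs) (just ay) (last-All ays) (head-All azs))
      where
      frame : score E′ xs + score E′ ys + score E′ zs ≡ score E xs + score E ys + score E zs
      frame = cong₂ _+_ (cong₂ _+_ (score-cong far axs) (score-cong far ays)) (score-cong far azs)
      total = score-two (adj-sym G′) xs p y ys′ q zs
      choose : _ → _
      choose (inj₁ h) = _ , ↭-refl , via total frame h (score-two (adj-sym G) xs p y ys′ q zs)
      choose (inj₂ (inj₁ h)) = _ , swap-↭ xs ys zs , via total frame h (score-two (adj-sym G) xs q y ys′ p zs)
      choose (inj₂ (inj₂ (inj₁ h))) = _ , reverse-↭ xs ys zs ,
        via total frame h (score-two-reverse (adj-sym G) xs p y ys′ q zs)
      choose (inj₂ (inj₂ (inj₂ h))) = _ , ↭-trans (swap-↭ xs (reverse ys) zs) (reverse-↭ xs ys zs) ,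
        via total frame h (score-two-reverse (adj-sym G) xs q y ys′ p zs)

-- Orderings of the vertex set are the lists vs ↭ allFin n, and a linear forest
-- with k edges exists iff some ordering has k consecutive adjacent pairs.
Scores< : ℕ → (Fin n → Fin n → Bool) → Set
Scores< {n} k E = ∀ vs → vs ↭ allFin n → score E vs < k

ordering-unique : ∀ {vs} → vs ↭ allFin n → Unique vs
ordering-unique {n} p = PermSetoid.Unique-resp-↭ (setoid (Fin n)) (↭⇒↭ₛ (↭-sym p)) (UniqueP.allFin⁺ n)

unique-++ : ∀ xs {z : A} {ys} → Unique (xs ++ z ∷ ys) → All (_≢ z) xs × All (_≢ z) ys
unique-++ []       (z∉ ∷ u) = [] , All.map (λ z≢ → z≢ ∘ sym) z∉
unique-++ (x ∷ xs) (x∉ ∷ u) with unique-++ xs u | AllP.++⁻ʳ xs x∉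
... | axs , ays | x≢z ∷ _ = x≢z ∷ axs , ays

split-two : ∀ {vs : List A} {i j} → Unique vs → i ≢ j → i ∈ vs → j ∈ vs →
            (∃ λ xs → ∃ λ ys → ∃ λ zs → vs ≡ xs ++ i ∷ ys ++ j ∷ zs) ⊎
            (∃ λ xs → ∃ λ ys → ∃ λ zs → vs ≡ xs ++ j ∷ ys ++ i ∷ zs)
split-two {i = i} {j} u i≢j i∈ j∈ with ∈-∃++ i∈
... | xs , rs , refl with ∈-++⁻ xs j∈
...   | inj₂ (here refl) = contradiction refl i≢j
...   | inj₂ (there j∈rs) with ∈-∃++ j∈rs
...     | ys , zs , refl = inj₁ (xs , ys , zs , refl)
split-two {i = i} {j} u i≢j i∈ j∈ | xs , rs , refl | inj₁ j∈xs with ∈-∃++ j∈xs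
... | ws , ys , refl = inj₂ (ws , ys , rs , ++-assoc ws (j ∷ ys) (i ∷ rs))

away : ∀ xs {p q : A} ys {zs} → Unique (xs ++ p ∷ ys ++ q ∷ zs) →
       let Away = λ w → w ≢ p × w ≢ q in All Away xs × All Away ys × All Away zs
away xs {p} {q} ys {zs} u with unique-++ xs u
                             | unique-++ (xs ++ p ∷ ys) (subst Unique (sym (++-assoc xs (p ∷ ys) (q ∷ zs))) u)
... | xs≢p , rs≢p | ws≢q , zs≢q with AllP.++⁻ʳ xs ws≢q
...   | _ ∷ ys≢q = All.zip (xs≢p , AllP.++⁻ˡ xs ws≢q) , All.zip (AllP.++⁻ˡ ys rs≢p , ys≢q) ,
                   All.zip (All.tail (AllP.++⁻ʳ ys rs≢p) , zs≢q)

module _ (G : Graph n) {i j : Fin n} (i≢j : i ≢ j) where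
  open Shift i j i≢j
  private E = adj G

  shift-far : ∀ {u v} → u ≢ i × u ≢ j → v ≢ i × v ≢ j → shift E u v ≡ E u v
  shift-far {u} {v} (u≢i , u≢j) (v≢i , v≢j) = trans (shift-∧ {E} u≢i v≢i)
    (trans (cong (E u v ∧_) (cong₂ E (σ-other u≢i u≢j) (σ-other v≢i v≢j))) (∧-idem (E u v)))

  shift-i : ∀ {w} → w ≢ i → w ≢ j → shift E i w ≡ E i w ∨ E j w
  shift-i {w} w≢i w≢j = trans (shift-∨ {E} {i} {w} (inj₁ refl)) (cong (E i w ∨_) (cong₂ E σ-i (σ-other w≢i w≢j)))

  shift-j : ∀ {w} → w ≢ i → w ≢ j → shift E j w ≡ E i w ∧ E j w
  shift-j {w} w≢i w≢j = trans (shift-∧ {E} (i≢j ∘ sym) w≢i)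
    (trans (cong (E j w ∧_) (cong₂ E σ-j (σ-other w≢i w≢j))) (∧-comm (E j w) (E i w)))

  shift-ij : shift E i j ≡ E i j
  shift-ij = trans (shift-∨ {E} {i} {j} (inj₁ refl)) (trans (cong (E i j ∨_)
    (trans (cong₂ E σ-i σ-j) (adj-sym G j i))) (∨-idem (E i j)))

  score-shift : ∀ {vs} → vs ↭ allFin n → ∃ λ ws → ws ↭ vs × score (shift E) vs ≤ score E ws
  score-shift {vs} vs↭ with split-two (ordering-unique vs↭) i≢j (Perm.∈-resp-↭ (↭-sym vs↭) (∈-allFin i))
                                                              (Perm.∈-resp-↭ (↭-sym vs↭) (∈-allFin j))
  ... | inj₁ (xs , ys , zs , refl) =
    let axs , ays , azs = away xs ys (ordering-unique vs↭) in
    Exchange.exchange {G = G} {shiftG G} shift-far shift-ij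
      (inj₁ λ (w≢i , w≢j) → shift-i w≢i w≢j , shift-j w≢i w≢j) xs ys zs axs ays azs
  ... | inj₂ (xs , ys , zs , refl) =
    let axs , ays , azs = away xs ys (ordering-unique vs↭) in
    Exchange.exchange {G = G} {shiftG G} (λ (a , b) (c , d) → shift-far (b , a) (d , c))
      (trans (adj-sym (shiftG G) j i) (trans shift-ij (adj-sym G i j)))
      (inj₂ λ {w} (w≢j , w≢i) → trans (shift-j w≢i w≢j) (∧-comm (E i w) (E j w)) ,
                                 trans (shift-i w≢i w≢j) (∨-comm (E i w) (E j w))) xs ys zs axs ays azs

  Scores<-shift : Scores< k E → Scores< k (shift E)
  Scores<-shift h vs vs↭ = let ws , ws↭ , le = score-shift vs↭ in ≤-<-trans le (h ws (↭-trans ws↭ vs↭))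

-- Termination of shifting

Σ[_] : (Fin n → ℕ) → ℕ
Σ[ f ] = sum (tabulate f)

Σ-cong : ∀ {f g : Fin n → ℕ} → (∀ v → f v ≡ g v) → Σ[ f ] ≡ Σ[ g ]
Σ-cong e = cong sum (tabulate-cong e)

Σ-+ : ∀ (f g : Fin n → ℕ) → Σ[ (λ v → f v + g v) ] ≡ Σ[ f ] + Σ[ g ]
Σ-+ {zero}  f g = refl
Σ-+ {suc n} f g = trans (cong (f zero + g zero +_) (Σ-+ (f ∘ suc) (g ∘ suc)))
                        (lemma (f zero) (g zero) Σ[ f ∘ suc ] Σ[ g ∘ suc ])
  where
  lemma : ∀ a b c d → a + b + (c + d) ≡ a + c + (b + d)
  lemma = solve-∀

Σ-mono : ∀ {f g : Fin n → ℕ} → (∀ v → f v ≤ g v) → Σ[ f ] ≤ Σ[ g ]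
Σ-mono {zero}  h = z≤n
Σ-mono {suc n} h = +-mono-≤ (h zero) (Σ-mono (h ∘ suc))

Σ-mono-< : ∀ {f g : Fin n → ℕ} → (∀ v → f v ≤ g v) → ∀ v → f v < g v → Σ[ f ] < Σ[ g ]
Σ-mono-< h zero    lt = +-mono-<-≤ lt (Σ-mono (h ∘ suc))
Σ-mono-< h (suc v) lt = +-mono-≤-< (h zero) (Σ-mono-< (h ∘ suc) v lt)

Σ-change : ∀ {f g : Fin n → ℕ} i → (∀ v → v ≢ i → f v ≡ g v) → Σ[ f ] + g i ≡ Σ[ g ] + f i
Σ-change {f = f} {g} zero h rewrite Σ-cong {f = f ∘ suc} {g ∘ suc} (λ v → h (suc v) (λ ())) =
  lemma (f zero) (g zero) Σ[ g ∘ suc ]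
  where
  lemma : ∀ a b c → a + c + b ≡ b + c + a
  lemma = solve-∀
Σ-change {f = f} {g} (suc i) h rewrite h zero (λ ()) =
  trans (+-assoc (g zero) _ _) (trans (cong (g zero +_) (Σ-change i (λ v v≢i → h (suc v) (v≢i ∘ Fin-suc-injective))))
    (sym (+-assoc (g zero) _ _)))

Σ-change₂ : ∀ {f g : Fin n → ℕ} {i j} → i ≢ j → (∀ v → v ≢ i → v ≢ j → f v ≡ g v) →
            Σ[ f ] + (g i + g j) ≡ Σ[ g ] + (f i + f j)
Σ-change₂ {n} {f} {g} {i} {j} i≢j h = begin
  Σ[ f ] + (g i + g j)  ≡⟨ +-assoc Σ[ f ] (g i) (g j) ⟨
  Σ[ f ] + g i + g j    ≡⟨ cong (λ x → Σ[ f ] + x + g j) h-i ⟨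
  Σ[ f ] + mid i + g j  ≡⟨ cong (_+ g j) (Σ-change i (λ v v≢i → sym (mid-≢ v≢i))) ⟩
  Σ[ mid ] + f i + g j  ≡⟨ comm₂ Σ[ mid ] (f i) (g j) ⟩
  Σ[ mid ] + g j + f i  ≡⟨ cong (_+ f i) (Σ-change j mid-g) ⟩
  Σ[ g ] + mid j + f i  ≡⟨ cong (λ x → Σ[ g ] + x + f i) (mid-≢ (i≢j ∘ sym)) ⟩
  Σ[ g ] + f j + f i    ≡⟨ comm₃ Σ[ g ] (f i) (f j) ⟩
  Σ[ g ] + (f i + f j)  ∎
  where
  open ≡-Reasoning
  mid : Fin n → ℕ
  mid v = if eqF v i then g v else f v
  h-i : mid i ≡ g i
  h-i rewrite eqF-refl i = refl
  mid-≢ : ∀ {v} → v ≢ i → mid v ≡ f v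
  mid-≢ v≢i rewrite eqF-≢ v≢i = refl
  mid-g : ∀ v → v ≢ j → mid v ≡ g v
  mid-g v v≢j with v ≟F i
  ... | yes refl = refl
  ... | no v≢i   = h v v≢i v≢j
  comm₂ : ∀ a b c → a + b + c ≡ a + c + b
  comm₂ = solve-∀
  comm₃ : ∀ a b c → a + c + b ≡ a + (b + c)
  comm₃ = solve-∀

degree : (Fin n → Fin n → Bool) → Fin n → ℕ
degree E u = Σ[ b2n ∘ E u ]

-- The termination measure: replacing an edge jv by iv changes only the degrees of i and j and
-- lowers the weight by j - i.
weight : (Fin n → Fin n → Bool) → ℕ
weight E = Σ[ (λ u → toℕ u * degree E u) ]

∨-∧-sum : ∀ a b → b2n (a ∨ b) + b2n (a ∧ b) ≡ b2n a + b2n b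
∨-∧-sum true  b = refl
∨-∧-sum false b = +-identityʳ (b2n b)

≤-b2n : ∀ {a b} → (a ≡ true → b ≡ true) → b2n a ≤ b2n b
≤-b2n {true}  h rewrite h refl = ≤-refl
≤-b2n {false} h = z≤n

module _ (G : Graph n) {i j : Fin n} (i<j : toℕ i < toℕ j) where
  private
    i≢j : i ≢ j
    i≢j refl = <-irrefl refl i<j
    E = adj G
  open Shift i j i≢j
  private
    S  = shift E
    GS = shiftG G

    -- The entries of u at i and j are replaced by their disjunction and conjunction, which have the
    -- same sum.
    degree-far : ∀ u → u ≢ i → u ≢ j → degree S u ≡ degree E u
    degree-far u u≢i u≢j = +-cancelʳ-≡ (b2n (E u i) + b2n (E u j)) _ _
      (trans (Σ-change₂ i≢j (λ v v≢i v≢j → cong b2n (shift-far G i≢j (u≢i , u≢j) (v≢i , v≢j))))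
        (cong (degree E u +_) (begin
          b2n (S u i) + b2n (S u j) ≡⟨ cong₂ (λ a b → b2n a + b2n b) (adj-sym GS u i) (adj-sym GS u j) ⟩
          b2n (S i u) + b2n (S j u) ≡⟨ cong₂ (λ a b → b2n a + b2n b) (shift-i G i≢j u≢i u≢j) (shift-j G i≢j u≢i u≢j) ⟩
          b2n (E i u ∨ E j u) + b2n (E i u ∧ E j u) ≡⟨ ∨-∧-sum (E i u) (E j u) ⟩
          b2n (E i u) + b2n (E j u) ≡⟨ cong₂ (λ a b → b2n a + b2n b) (adj-sym G i u) (adj-sym G j u) ⟩
          b2n (E u i) + b2n (E u j) ∎)))
      where open ≡-Reasoning

    S-ji : S j i ≡ E j i
    S-ji = trans (adj-sym GS j i) (trans (shift-ij G i≢j) (adj-sym G i j))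

    degree-sum : degree S i + degree S j ≡ degree E i + degree E j
    degree-sum = trans (sym (Σ-+ (b2n ∘ S i) (b2n ∘ S j))) (trans (Σ-cong pointwise) (Σ-+ (b2n ∘ E i) (b2n ∘ E j)))
      where
      pointwise : ∀ v → b2n (S i v) + b2n (S j v) ≡ b2n (E i v) + b2n (E j v)
      pointwise v with view v
      ... | is-i = cong₂ (λ a b → b2n a + b2n b) (trans (irrefl GS i) (sym (irrefl G i))) S-ji
      ... | is-j = cong₂ (λ a b → b2n a + b2n b) (shift-ij G i≢j) (trans (irrefl GS j) (sym (irrefl G j)))
      ... | other v≢i v≢j = trans (cong₂ (λ a b → b2n a + b2n b) (shift-i G i≢j v≢i v≢j) (shift-j G i≢j v≢i v≢j))
                                  (∨-∧-sum (E i v) (E j v))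

    degree-i : ∀ {v} → v ≢ i → E j v ≡ true → E i v ≡ false → degree E i < degree S i
    degree-i {v} v≢i Ejv Eiv = Σ-mono-< (λ u → ≤-b2n (grow u)) v
      (subst₂ (λ a b → b2n a < b2n b) (sym Eiv) (sym (trans (shift-i G i≢j v≢i v≢j) (∨-⁺ʳ {E i v} Ejv))) (s≤s z≤n))
      where
      v≢j : v ≢ j
      v≢j refl with () ← trans (sym Ejv) (irrefl G j)
      grow : ∀ u → E i u ≡ true → S i u ≡ true
      grow u e with view u
      ... | is-i with () ← trans (sym e) (irrefl G i)
      ... | is-j = trans (shift-ij G i≢j) e
      ... | other u≢i u≢j = trans (shift-i G i≢j u≢i u≢j) (∨-⁺ˡ e)

    move-down : ∀ a b x y x′ y′ → a < b → x′ + y′ ≡ x + y → x < x′ → a * x′ + b * y′ < a * x + b * y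
    move-down a b x y x′ y′ a<b eq x<x′ with m≤n⇒∃[o]m+o≡n x<x′
    ... | d , refl = subst₂ _<_ (lemma₁ a b x d y′) (trans (lemma₂ a b x d y′) (cong (λ z → a * x + b * z) y≡))
                            (+-monoʳ-< (a * x + b * y′) (*-monoˡ-< (suc d) a<b))
      where
      y≡ : suc d + y′ ≡ y
      y≡ = +-cancelˡ-≡ x _ _ (trans (lemma₃ x d y′) eq)
        where
        lemma₃ : ∀ x d y′ → x + (suc d + y′) ≡ suc x + d + y′
        lemma₃ = solve-∀
      lemma₁ : ∀ a b x d y′ → a * x + b * y′ + a * suc d ≡ a * (suc x + d) + b * y′
      lemma₁ = solve-∀
      lemma₂ : ∀ a b x d y′ → a * x + b * y′ + b * suc d ≡ a * x + b * (suc d + y′)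
      lemma₂ = solve-∀

  weight-shift : ∀ {v} → v ≢ i → E j v ≡ true → E i v ≡ false → weight (shift E) < weight E
  weight-shift v≢i Ejv Eiv = +-cancelʳ-< _ _ _ (subst (_< weight E + (toℕ i * degree E i + toℕ j * degree E j))
    (Σ-change₂ i≢j (λ u u≢i u≢j → cong (toℕ u *_) (sym (degree-far u u≢i u≢j))))
    (+-monoʳ-< (weight E) (move-down (toℕ i) (toℕ j) (degree E i) (degree E j) (degree S i) (degree S j)
                  i<j degree-sum (degree-i v≢i Ejv Eiv))))

-- Excluding v = i spares the edge ij, whose replacement would be a loop.
Shifted : Graph n → Set
Shifted G = ∀ i j v → toℕ i < toℕ j → v ≢ i → adj G j v ≡ true → adj G i v ≡ true

stabilise : ∀ (G : Graph n) → Scores< k (adj G) →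
            ∃ λ G′ → Shifted G′ × Scores< k (adj G′) ×
              (∀ s t → labellings (adj G) s t ≤ labellings (adj G′) s t)
stabilise {n} {k} G = go G (<-wellFounded (weight (adj G)))
  where
  go : ∀ (G : Graph n) → Acc _<_ (weight (adj G)) → Scores< k (adj G) →
       ∃ λ G′ → Shifted G′ × Scores< k (adj G′) ×
         (∀ s t → labellings (adj G) s t ≤ labellings (adj G′) s t)
  go G (acc rec) sc with any? (λ i → any? (λ j → any? (λ v →
    (toℕ i <? toℕ j) ×-dec (¬? (v ≟F i) ×-dec ((adj G j v ≟B true) ×-dec (adj G i v ≟B false))))))
  ... | no ∄ = G , (λ i j v i<j v≢i e → adj-i i j v i<j v≢i e) , sc , λ s t → ≤-refl
    where
    adj-i : ∀ i j v → toℕ i < toℕ j → v ≢ i → adj G j v ≡ true → adj G i v ≡ true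
    adj-i i j v i<j v≢i e with adj G i v in eq
    ... | true  = refl
    ... | false = contradiction (i , j , v , i<j , v≢i , e , eq) ∄
  ... | yes (i , j , v , i<j , v≢i , ejv , eiv) =
    let i≢j = λ i≡j → <-irrefl (cong toℕ i≡j) i<j
        open Shift i j i≢j
        G′ , sh , sc′ , le = go (shiftG G) (rec (weight-shift G i<j v≢i ejv eiv)) (Scores<-shift G i≢j sc)
    in G′ , sh , sc′ , λ s t → ≤-trans (labellings-shift (adj G) s t) (le s t)

-- Threshold graphs

-- The two extremal graphs are the cases c = 0 and c = ⌊(k − 1)/2⌋ with m = k − c.
threshold : ℕ → ℕ → Fin n → Fin n → Bool
threshold m c u v = (toℕ u <ᵇ c) ∨ (toℕ v <ᵇ c) ∨ ((toℕ u <ᵇ m) ∧ (toℕ v <ᵇ m))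

thresholdG : ∀ n → ℕ → ℕ → Graph n
thresholdG n m c = record
  { adj    = λ u v → not (eqF u v) ∧ threshold m c u v
  ; sym    = λ u v → cong₂ (λ a b → not a ∧ b) (eqF-sym u v) (threshold-sym u v)
  ; irrefl = λ u → cong (λ b → not b ∧ threshold m c u u) (eqF-refl u)
  }
  where
  threshold-sym : ∀ (u v : Fin n) → threshold m c u v ≡ threshold m c v u
  threshold-sym u v rewrite ∧-comm (toℕ u <ᵇ m) (toℕ v <ᵇ m) with toℕ u <ᵇ c | toℕ v <ᵇ c
  ... | true  | true  = refl
  ... | true  | false = refl
  ... | false | true  = refl
  ... | false | false = refl

labellings-mono : ∀ {E E′ : Fin n → Fin n → Bool} → (∀ u v → u ≢ v → E u v ≡ true → E′ u v ≡ true) →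
                  ∀ s t → labellings E s t ≤ labellings E′ s t
labellings-mono {n} {E} {E′} E⇒E′ s t = #-mono (valid? E s t) (valid? E′ s t)
  (λ ρ (cs , ls , h) → cs , ls , λ u v u≢v nd → E⇒E′ u v u≢v (h u v u≢v nd)) (funs n roles)

extend : ∀ (xs ys : List A) → Unique xs → (∀ {v} → v ∈ xs → v ∈ ys) → ∃ λ ws → xs ++ ws ↭ ys
extend []       ys _        _     = ys , ↭-refl
extend (x ∷ xs) ys (x∉ ∷ u) xs⊆ys with ∈-∃++ (xs⊆ys (here refl))
... | as , bs , refl = let ws , p = extend xs (as ++ bs) u rest in
                       ws , ↭-trans (prep x p) (↭-sym (Perm.shift x as bs))
  where
  rest : ∀ {v} → v ∈ xs → v ∈ as ++ bs
  rest v∈ with ∈-++⁻ as (xs⊆ys (there v∈))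
  ... | inj₁ v∈as         = ∈-++⁺ˡ v∈as
  ... | inj₂ (here refl)  = contradiction refl (All.lookup x∉ v∈)
  ... | inj₂ (there v∈bs) = ∈-++⁺ʳ as v∈bs

score-++ : ∀ (E : A → A → Bool) xs ys → score E xs ≤ score E (xs ++ ys)
score-++ E []           ys = z≤n
score-++ E (x ∷ [])     ys = z≤n
score-++ E (x ∷ y ∷ xs) ys = +-monoʳ-≤ (b2n (E x y)) (score-++ E (y ∷ xs) ys)

score-map : ∀ (E : B → B → Bool) (f : A → B) xs → score E (map f xs) ≡ score (λ u v → E (f u) (f v)) xs
score-map E f []           = refl
score-map E f (x ∷ [])     = refl
score-map E f (x ∷ y ∷ xs) = cong (b2n (E (f x) (f y)) +_) (score-map E f (y ∷ xs))

-- Such a list can be completed to an ordering, and appending vertices never lowers the score.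
score-unique : ∀ {E : Fin n → Fin n → Bool} → Scores< k E → ∀ {vs} → Unique vs → score E vs < k
score-unique {n} {E = E} h {vs} u with extend vs (allFin n) u (λ {v} _ → ∈-allFin v)
... | ws , p = ≤-<-trans (score-++ E vs ws) (h (vs ++ ws) p)

-- a + d, a, a + d − 1, a + 1, …: consecutive sums alternate between 2a + d and 2a + d − 1.
zigzag : ℕ → ℕ → List ℕ
zigzag a zero          = a ∷ []
zigzag a (suc zero)    = suc a ∷ a ∷ []
zigzag a (suc (suc d)) = a + suc (suc d) ∷ a ∷ zigzag (suc a) d

zigzag-head : ∀ a d → head (zigzag a d) ≡ just (a + d)
zigzag-head a zero          = cong just (sym (+-identityʳ a))
zigzag-head a (suc zero)    = cong just (sym (+-comm a 1))
zigzag-head a (suc (suc d)) = refl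

zigzag-bounds : ∀ a d → All (λ v → a ≤ v × v ≤ a + d) (zigzag a d)
zigzag-bounds a zero          = (≤-refl , m≤m+n a 0) ∷ []
zigzag-bounds a (suc zero)    = (n≤1+n a , ≤-reflexive (+-comm 1 a)) ∷ (≤-refl , m≤m+n a 1) ∷ []
zigzag-bounds a (suc (suc d)) = (m≤m+n a _ , ≤-refl) ∷ (≤-refl , m≤m+n a _) ∷
  All.map (λ (lo , hi) → <⇒≤ lo , ≤-trans hi (≤-trans (≤-reflexive (sym (+-suc a d))) (+-monoʳ-≤ a (n≤1+n _))))
          (zigzag-bounds (suc a) d)

zigzag-unique : ∀ a d → Unique (zigzag a d)
zigzag-unique a zero          = [] ∷ []
zigzag-unique a (suc zero)    = (1+n≢n ∷ []) ∷ [] ∷ []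
zigzag-unique a (suc (suc d)) =
  ((λ e → m+1+n≢m a e) ∷ All.map (λ (_ , hi) e → <-irrefl (sym e) (≤-<-trans hi top)) (zigzag-bounds (suc a) d)) ∷
  All.map (λ (lo , _) e → <-irrefl e lo) (zigzag-bounds (suc a) d) ∷
  zigzag-unique (suc a) d
  where
  top : suc a + d < a + suc (suc d)
  top = ≤-reflexive (sym (trans (+-suc a (suc d)) (cong suc (+-suc a d))))

zigzag-score : ∀ (E : ℕ → ℕ → Bool) k → (∀ u v → u ≢ v → u + v ≤ k → E u v ≡ true) →
               ∀ a d → a + a + d ≤ k → score E (zigzag a d) ≡ d
zigzag-score E k h a zero          le = refl
zigzag-score E k h a (suc zero)    le = trans (+-identityʳ _) (cong b2n (h (suc a) a 1+n≢n
  (≤-trans (≤-reflexive (+-comm 1 (a + a))) le)))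
zigzag-score E k h a (suc (suc d)) le = cong₂ _+_
  (cong b2n (h _ a (m+1+n≢m a) (≤-trans (≤-reflexive (sum₁ a d)) le)))
  (trans (score-∷ E a (zigzag (suc a) d)) (cong₂ _+_
    (trans (cong (b2n ∘ at (E a)) (zigzag-head (suc a) d))
      (cong b2n (h a (suc a + d) (<⇒≢ (s≤s (m≤m+n a d))) (≤-trans (n≤1+n _) (≤-trans (≤-reflexive (sum₂ a d)) le)))))
    (zigzag-score E k h (suc a) d (≤-trans (≤-reflexive (sum₃ a d)) le))))
  where
  sum₁ : ∀ a d → a + suc (suc d) + a ≡ a + a + suc (suc d)
  sum₁ = solve-∀
  sum₂ : ∀ a d → suc (a + (suc a + d)) ≡ a + a + suc (suc d)
  sum₂ = solve-∀
  sum₃ : ∀ a d → suc a + suc a + d ≡ a + a + suc (suc d)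
  sum₃ = solve-∀

module _ (G : Graph n) (k<n : k < n) (shifted : Shifted G) (sc : Scores< k (adj G)) where

  private
    E = adj G

    vertex : ℕ → Fin n
    vertex u with u <? n
    ... | yes u<n = fromℕ< u<n
    -- A default never met: only arguments up to k occur below.
    ... | no _    = fromℕ< k<n

    toℕ-vertex : ∀ {u} → u < n → toℕ (vertex u) ≡ u
    toℕ-vertex {u} u<n with u <? n
    ... | yes p = toℕ-fromℕ< p
    ... | no ≮  = contradiction u<n ≮

    -- If all pairs with sum at most k were adjacent, `zigzag 0 k` would be a path with k edges; its
    -- vertices 0, ..., k exist because k < n.
    missing : ∃ λ i → ∃ λ j → toℕ i < toℕ j × toℕ i + toℕ j ≤ k × E i j ≡ false
    missing with any? (λ i → any? (λ j → (toℕ i <? toℕ j) ×-dec ((toℕ i + toℕ j ≤? k) ×-dec (E i j ≟B false))))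
    ... | yes p = p
    ... | no ∄ = contradiction (score-unique sc path-unique) (≤⇒≯ (≤-reflexive (sym path-score)))
      where
      adj-< : ∀ {i j} → toℕ i < toℕ j → toℕ i + toℕ j ≤ k → E i j ≡ true
      adj-< {i} {j} i<j i+j≤k with E i j in eq
      ... | true  = refl
      ... | false = contradiction (i , j , i<j , i+j≤k , eq) ∄
      E′ : ℕ → ℕ → Bool
      E′ u v = E (vertex u) (vertex v)
      E′-< : ∀ {u v} → u < v → u + v ≤ k → E′ u v ≡ true
      E′-< {u} {v} u<v u+v≤k = adj-< (subst₂ _<_ (sym eu) (sym ev) u<v)
                                     (subst₂ (λ a b → a + b ≤ k) (sym eu) (sym ev) u+v≤k)
        where
        eu = toℕ-vertex (≤-<-trans (≤-trans (m≤m+n u v) u+v≤k) k<n)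
        ev = toℕ-vertex (≤-<-trans (≤-trans (m≤n+m v u) u+v≤k) k<n)
      E′-≢ : ∀ u v → u ≢ v → u + v ≤ k → E′ u v ≡ true
      E′-≢ u v u≢v u+v≤k with <-cmp u v
      ... | tri< u<v _ _ = E′-< u<v u+v≤k
      ... | tri≈ _ u≡v _ = contradiction u≡v u≢v
      ... | tri> _ _ v<u = trans (adj-sym G (vertex u) (vertex v)) (E′-< v<u (subst (_≤ k) (+-comm u v) u+v≤k))
      path = map vertex (zigzag 0 k)
      path-score : score E path ≡ k
      path-score = trans (score-map E vertex (zigzag 0 k)) (zigzag-score E′ k E′-≢ 0 k ≤-refl)
      path-unique : Unique path
      path-unique = AllPairsP.map⁺ (all-pairs
        (λ (_ , u≤k) (_ , v≤k) u≢v e → u≢v (trans (sym (toℕ-vertex (≤-<-trans u≤k k<n)))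
                                        (trans (cong toℕ e) (toℕ-vertex (≤-<-trans v≤k k<n)))))
        (zigzag-bounds 0 k) (zigzag-unique 0 k))

  -- Take c = i for a missing edge ij, so that 2c < i + j ≤ k. An edge not covered has both ends at
  -- least i and one end at least k - i, hence at least j; lowering its ends would produce the edge
  -- ij.
  shifted⇒threshold : ∃ λ c → c + c < k × (∀ u v → u ≢ v → E u v ≡ true → threshold (k ∸ c) c u v ≡ true)
  shifted⇒threshold with missing
  ... | i , j , i<j , i+j≤k , eij = toℕ i , <-≤-trans (+-monoʳ-< (toℕ i) i<j) i+j≤k , covered
    where
    c = toℕ i
    j≤m : toℕ j ≤ k ∸ c
    j≤m = m+n≤o⇒m≤o∸n (toℕ j) (subst (_≤ k) (+-comm c (toℕ j)) i+j≤k)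
    down : ∀ {u v w} → toℕ w ≤ toℕ u → v ≢ w → E u v ≡ true → E w v ≡ true
    down {u} {v} {w} w≤u v≢w e with m≤n⇒m<n∨m≡n w≤u
    ... | inj₁ w<u = shifted w u v w<u v≢w e
    ... | inj₂ w≡u = subst (λ z → E z v ≡ true) (sym (toℕ-injective w≡u)) e
    i≢j : i ≢ j
    i≢j refl = <-irrefl refl i<j
    -- Lower v to j and then u to i. If u = j, the first move would create a loop, and v is lowered
    -- to i instead.
    no-edge : ∀ u v → c ≤ toℕ u → toℕ j ≤ toℕ v → E u v ≡ true → E i j ≡ true
    no-edge u v c≤u j≤v e with u ≟F j
    ... | yes refl = down (≤-trans (<⇒≤ i<j) j≤v) (i≢j ∘ sym) (trans (adj-sym G v u) e)
    ... | no u≢j   = down c≤u (i≢j ∘ sym) (trans (adj-sym G u j) (down j≤v u≢j (trans (adj-sym G v u) e)))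
    absurd : ∀ u v → c ≤ toℕ u → k ∸ c ≤ toℕ v → E u v ≡ true → ⊥
    absurd u v c≤u m≤v e with () ← trans (sym (no-edge u v c≤u (≤-trans j≤m m≤v) e)) eij
    covered : ∀ u v → u ≢ v → E u v ≡ true → threshold (k ∸ c) c u v ≡ true
    covered u v _ e with toℕ u <? c | toℕ v <? c
    ... | yes u<c | _       = ∨-⁺ˡ (<ᵇ-⁺ u<c)
    ... | no _    | yes v<c = ∨-⁺ʳ {toℕ u <ᵇ c} (∨-⁺ˡ (<ᵇ-⁺ v<c))
    ... | no u≮c  | no v≮c with toℕ u <? k ∸ c | toℕ v <? k ∸ c
    ...   | yes u<m | yes v<m = ∨-⁺ʳ {toℕ u <ᵇ c} (∨-⁺ʳ {toℕ v <ᵇ c} (∧-⁺ (<ᵇ-⁺ u<m) (<ᵇ-⁺ v<m)))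
    ...   | _       | no v≮m  = ⊥-elim (absurd u v (≮⇒≥ u≮c) (≮⇒≥ v≮m) e)
    ...   | no u≮m  | yes _   = ⊥-elim (absurd v u (≮⇒≥ v≮c) (≮⇒≥ u≮m) (trans (adj-sym G v u) e))

-- Linear forests and orderings

≡ᵇ-refl : ∀ a → (a ≡ᵇ a) ≡ true
≡ᵇ-refl zero    = refl
≡ᵇ-refl (suc a) = ≡ᵇ-refl a

≡ᵇ-⁻ : ∀ {a b} → (a ≡ᵇ b) ≡ true → a ≡ b
≡ᵇ-⁻ {a} {b} e = ≡ᵇ⇒≡ a b (subst T (sym e) tt)

≡ᵇ-≢ : ∀ {a b} → a ≢ b → (a ≡ᵇ b) ≡ false
≡ᵇ-≢ a≢b = ≢true (a≢b ∘ ≡ᵇ-⁻)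

-- The score of the natural order of the indices, by a recursion that drops vertex 0 as the one for
-- `edgeCount` does.
pathCount : (Fin n → Fin n → Bool) → ℕ
pathCount {zero}        H = 0
pathCount {suc zero}    H = 0
pathCount {suc (suc n)} H = b2n (H zero (suc zero)) + pathCount (λ i j → H (suc i) (suc j))

Consecutive : (Fin n → Fin n → Bool) → Set
Consecutive H = ∀ i j → toℕ i < toℕ j → H i j ≡ true → toℕ j ≡ suc (toℕ i)

count-none : {p : Fin n → Bool} → (∀ v → p v ≡ false) → count p ≡ 0
count-none {n} {p} h = #-none (λ v → p v ≟B true) (λ v e → case trans (sym e) (h v) of λ ()) (allFin n)

edgeCount≡pathCount : ∀ (H : Fin n → Fin n → Bool) → Consecutive H → edgeCount H ≡ pathCount H
edgeCount≡pathCount {zero}  H con = refl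
edgeCount≡pathCount {suc n} H con = begin
  row zero + sum (map row (tabulate suc)) ≡⟨ cong₂ _+_ (count-suc (λ j → (0 <ᵇ toℕ j) ∧ H zero j)) (cong sum (trans (map-tabulate suc row)
                                               (trans (tabulate-cong (λ i → count-suc (λ j → (suc (toℕ i) <ᵇ toℕ j) ∧ H (suc i) j))) (sym (map-tabulate id row′))))) ⟩
  count (H zero ∘ suc) + edgeCount (λ i j → H (suc i) (suc j))
    ≡⟨ cong₂ _+_ refl (edgeCount≡pathCount _ (λ i j i<j e → suc-injective (con (suc i) (suc j) (s≤s i<j) e))) ⟩
  count (H zero ∘ suc) + pathCount (λ i j → H (suc i) (suc j)) ≡⟨ first n H con ⟩
  pathCount H ∎
  where
  open ≡-Reasoning
  row : Fin (suc n) → ℕ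
  row i = count (λ j → (toℕ i <ᵇ toℕ j) ∧ H i j)
  row′ : Fin n → ℕ
  row′ i = count (λ j → (toℕ i <ᵇ toℕ j) ∧ H (suc i) (suc j))
  first : ∀ n (H : Fin (suc n) → Fin (suc n) → Bool) → Consecutive H →
          count (H zero ∘ suc) + pathCount (λ i j → H (suc i) (suc j)) ≡ pathCount H
  first zero    H con = refl
  first (suc n) H con = cong (_+ pathCount (λ i j → H (suc i) (suc j)))
    (trans (count-suc (H zero ∘ suc)) (trans (cong (b2n (H zero (suc zero)) +_) (count-none λ v → ≢true (far v))) (+-identityʳ _)))
    where
    far : ∀ v → H zero (suc (suc v)) ≢ true
    far v e with () ← con zero (suc (suc v)) (s≤s z≤n) e

pathCount-mono : ∀ {H H′ : Fin n → Fin n → Bool} → (∀ i j → H i j ≡ true → H′ i j ≡ true) →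
                 pathCount H ≤ pathCount H′
pathCount-mono {zero}        h = z≤n
pathCount-mono {suc zero}    h = z≤n
pathCount-mono {suc (suc n)} h = +-mono-≤ (≤-b2n (h zero (suc zero))) (pathCount-mono (λ i j → h (suc i) (suc j)))

score-tabulate : ∀ (E : A → A → Bool) (f : Fin n → A) → score E (tabulate f) ≡ pathCount (λ i j → E (f i) (f j))
score-tabulate {n = zero}        E f = refl
score-tabulate {n = suc zero}    E f = refl
score-tabulate {n = suc (suc n)} E f = cong (b2n (E (f zero) (f (suc zero))) +_) (score-tabulate E (f ∘ suc))

LF-consecutive : ∀ ls → Consecutive (LF n ls)
LF-consecutive ls i j i<j e with ∨-⁻ e
... | inj₁ e′ = ≡ᵇ-⁻ (proj₁ (∧-⁻ e′))
... | inj₂ e′ = contradiction (≡ᵇ-⁻ {toℕ i} {suc (toℕ j)} (proj₁ (∧-⁻ e′))) (<⇒≢ (m≤n⇒m≤1+n i<j))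

LF-sym : ∀ ls i j → LF n ls i j ≡ true → LF n ls j i ≡ true
LF-sym ls i j e = trans (∨-comm (step j i) (step i j)) e
  where
  step : Fin _ → Fin _ → Bool
  step a b = (toℕ b ≡ᵇ suc (toℕ a)) ∧ not (memℕ (toℕ b) (starts 0 ls))

-- The images of the vertices of an embedded forest, in their natural order, form a duplicate-free
-- list in which every edge of the forest is a link.
unique-score⇒LFree : ∀ (G : Graph n) → (∀ {vs} → Unique vs → score (adj G) vs < k) → LFree k G
unique-score⇒LFree {n} G h ls (_ , _ , refl) (f , inj , pres) = <-irrefl refl (begin-strict
  edgeCount (LF n ls)                  ≡⟨ edgeCount≡pathCount (LF n ls) (LF-consecutive ls) ⟩
  pathCount (LF n ls)                  ≤⟨ pathCount-mono pres ⟩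
  pathCount (λ i j → adj G (f i) (f j)) ≡⟨ score-tabulate (adj G) f ⟨
  score (adj G) (tabulate f)           <⟨ h (UniqueP.tabulate⁺ (λ {i} {j} → inj i j)) ⟩
  edgeCount (LF n ls)                  ∎)
  where open ≤-Reasoning

bit : List Bool → ℕ → Bool
bit []       r       = false
bit (b ∷ bs) zero    = b
bit (b ∷ bs) (suc r) = bit bs r

-- bs tells which consecutive positions are joined; blocks 1 bs are the resulting path orders.
blocks : ℕ → List Bool → List ℕ
blocks a []           = a ∷ []
blocks a (true ∷ bs)  = blocks (suc a) bs
blocks a (false ∷ bs) = a ∷ blocks 1 bs

sum-blocks : ∀ a bs → sum (blocks a bs) ≡ a + length bs
sum-blocks a []           = refl
sum-blocks a (true ∷ bs)  = trans (sum-blocks (suc a) bs) (sym (+-suc a _))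
sum-blocks a (false ∷ bs) = cong (a +_) (sum-blocks 1 bs)

blocks-pos : ∀ a bs → AllPos (blocks (suc a) bs)
blocks-pos a []           = s≤s z≤n ∷ []
blocks-pos a (true ∷ bs)  = blocks-pos (suc a) bs
blocks-pos a (false ∷ bs) = s≤s z≤n ∷ blocks-pos 0 bs

mem-below : ∀ {x off} ls → x < off → memℕ x (starts off ls) ≡ false
mem-below []       x<off = refl
mem-below {x} {off} (l ∷ ls) x<off rewrite ≡ᵇ-≢ (<⇒≢ x<off) = mem-below ls (<-≤-trans x<off (m≤m+n off l))

mem-head : ∀ off a bs → memℕ off (starts off (blocks a bs)) ≡ true
mem-head off a []           rewrite ≡ᵇ-refl off = refl
mem-head off a (true ∷ bs)  = mem-head off (suc a) bs
mem-head off a (false ∷ bs) rewrite ≡ᵇ-refl off = refl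

mem-inside : ∀ {x off a} bs → off < x → x < off + a → memℕ x (starts off (blocks a bs)) ≡ false
mem-inside [] lo hi rewrite ≡ᵇ-≢ (>⇒≢ lo) = refl
mem-inside {off = off} {a} (true ∷ bs) lo hi = mem-inside bs lo (<-≤-trans hi (+-monoʳ-≤ off (n≤1+n a)))
mem-inside (false ∷ bs) lo hi rewrite ≡ᵇ-≢ (>⇒≢ lo) = mem-below (blocks 1 bs) hi

private
  regroup : ∀ o a r → o + suc a + suc r ≡ o + suc a + 1 + r
  regroup = solve-∀

-- The open block began at `off` and already has `suc a` vertices, so `off + suc a + r` is the
-- vertex to which bit r leads; it begins a block when that bit is a cut.
mem-link : ∀ off a bs r → r < length bs →
           memℕ (off + suc a + r) (starts off (blocks (suc a) bs)) ≡ not (bit bs r)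
mem-link off a (true ∷ bs) zero _ rewrite +-identityʳ (off + suc a) =
  mem-inside bs (m<m+n off (s≤s z≤n)) (+-monoʳ-< off ≤-refl)
mem-link off a (true ∷ bs) (suc r) (s≤s r<) =
  trans (cong (λ x → memℕ x (starts off (blocks (suc (suc a)) bs))) (shuffle off a r)) (mem-link off (suc a) bs r r<)
  where
  shuffle : ∀ o a r → o + suc a + suc r ≡ o + suc (suc a) + r
  shuffle = solve-∀
mem-link off a (false ∷ bs) zero _
  rewrite +-identityʳ (off + suc a) | ≡ᵇ-≢ {off + suc a} {off} (m+1+n≢m off) = mem-head (off + suc a) 1 bs
mem-link off a (false ∷ bs) (suc r) (s≤s r<)
  rewrite regroup off a r
        | ≡ᵇ-≢ {off + suc a + 1 + r} {off} (>⇒≢ (<-≤-trans (m<m+n off {suc a} (s≤s z≤n)) (≤-trans (m≤m+n _ 1) (m≤m+n _ r))))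
  = mem-link (off + suc a) 0 bs r r<

#trues : List Bool → ℕ
#trues []       = 0
#trues (b ∷ bs) = b2n b + #trues bs

-- An ordering may have more than k links whereas `InL` asks for exactly k edges; the surplus links
-- are cut.
firstTrues : ℕ → List Bool → List Bool
firstTrues k       []           = []
firstTrues zero    (b ∷ bs)     = false ∷ firstTrues zero bs
firstTrues (suc k) (true ∷ bs)  = true ∷ firstTrues k bs
firstTrues (suc k) (false ∷ bs) = false ∷ firstTrues (suc k) bs

length-firstTrues : ∀ k bs → length (firstTrues k bs) ≡ length bs
length-firstTrues k       []           = refl
length-firstTrues zero    (b ∷ bs)     = cong suc (length-firstTrues zero bs)
length-firstTrues (suc k) (true ∷ bs)  = cong suc (length-firstTrues k bs)
length-firstTrues (suc k) (false ∷ bs) = cong suc (length-firstTrues (suc k) bs)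

#trues-firstTrues : ∀ k bs → k ≤ #trues bs → #trues (firstTrues k bs) ≡ k
#trues-firstTrues zero    []           _       = refl
#trues-firstTrues zero    (b ∷ bs)     _       = #trues-firstTrues zero bs z≤n
#trues-firstTrues (suc k) (true ∷ bs)  (s≤s h) = cong suc (#trues-firstTrues k bs h)
#trues-firstTrues (suc k) (false ∷ bs) h       = #trues-firstTrues (suc k) bs h

bit-firstTrues : ∀ k bs r → bit (firstTrues k bs) r ≡ true → bit bs r ≡ true
bit-firstTrues zero    (b ∷ bs)     (suc r) e = bit-firstTrues zero bs r e
bit-firstTrues (suc k) (true ∷ bs)  zero    e = refl
bit-firstTrues (suc k) (true ∷ bs)  (suc r) e = bit-firstTrues k bs r e
bit-firstTrues (suc k) (false ∷ bs) (suc r) e = bit-firstTrues (suc k) bs r e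

links : (A → A → Bool) → A → List A → List Bool
links E x []       = []
links E x (y ∷ ys) = E x y ∷ links E y ys

length-links : ∀ (E : A → A → Bool) x ys → length (links E x ys) ≡ length ys
length-links E x []       = refl
length-links E x (y ∷ ys) = cong suc (length-links E y ys)

#trues-links : ∀ (E : A → A → Bool) x ys → #trues (links E x ys) ≡ score E (x ∷ ys)
#trues-links E x []       = refl
#trues-links E x (y ∷ ys) = cong (b2n (E x y) +_) (#trues-links E y ys)

bit-links : ∀ (E : A → A → Bool) x ys i j → toℕ j ≡ suc (toℕ i) →
            bit (links E x ys) (toℕ i) ≡ E (lookup (x ∷ ys) i) (lookup (x ∷ ys) j)
bit-links E x (y ∷ ys) zero    (suc zero) e = refl
bit-links E x (y ∷ ys) (suc i) (suc j)    e = bit-links E y ys i j (suc-injective e)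

pathCount-bits : ∀ (H : Fin (suc n) → Fin (suc n) → Bool) bs → length bs ≡ n →
                 (∀ i j → toℕ j ≡ suc (toℕ i) → H i j ≡ bit bs (toℕ i)) → pathCount H ≡ #trues bs
pathCount-bits H []       refl h = refl
pathCount-bits H (b ∷ bs) refl h = cong₂ _+_ (cong b2n (h zero (suc zero) refl))
  (pathCount-bits (λ i j → H (suc i) (suc j)) bs refl (λ i j e → h (suc i) (suc j) (cong suc e)))

LF-bits : ∀ bs → length bs ≡ n → ∀ (i j : Fin (suc n)) → toℕ j ≡ suc (toℕ i) →
          LF (suc n) (blocks 1 bs) i j ≡ bit bs (toℕ i)
LF-bits bs refl i j e
  rewrite e | ≡ᵇ-refl (toℕ i) | ≡ᵇ-≢ {toℕ i} {suc (suc (toℕ i))} (<⇒≢ (m≤n⇒m≤1+n ≤-refl))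
        | mem-link 0 0 bs (toℕ i) (s≤s⁻¹ (subst (_≤ suc (length bs)) (cong suc e) (toℕ<n j)))
  with bit bs (toℕ i)
... | true  = refl
... | false = refl

LFree⇒Scores< : ∀ (G : Graph n) → 1 ≤ n → LFree k G → Scores< k (adj G)
LFree⇒Scores< {n} {k} G 1≤n free vs vs↭ with score (adj G) vs <? k
... | yes lt = lt
... | no ≮k  = ⊥-elim (embed vs (ordering-unique vs↭) (trans (Perm.↭-length vs↭) (length-tabulate id)) (≮⇒≥ ≮k))
  where
  E = adj G
  embed : ∀ vs → Unique vs → length vs ≡ n → k ≤ score E vs → ⊥
  embed []       _ len _   = contradiction (subst (1 ≤_) (sym len) 1≤n) λ ()
  embed (x ∷ ys) u len  k≤ = free ls (subst (λ m → InL m k ls) len inL) (subst (λ m → Contains G (LF m ls)) len contains)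
    where
    all = links E x ys
    bs = firstTrues k all
    ls = blocks 1 bs
    len-bs : length bs ≡ length ys
    len-bs = trans (length-firstTrues k all) (length-links E x ys)
    inL : InL (suc (length ys)) k ls
    inL = blocks-pos 0 bs , trans (sum-blocks 1 bs) (cong suc len-bs) ,
      trans (edgeCount≡pathCount (LF (suc (length ys)) ls) (LF-consecutive ls))
        (trans (pathCount-bits (LF (suc (length ys)) ls) bs len-bs (LF-bits bs len-bs))
          (#trues-firstTrues k all (subst (k ≤_) (sym (#trues-links E x ys)) k≤)))
    next : ∀ i j → toℕ j ≡ suc (toℕ i) → LF (suc (length ys)) ls i j ≡ true →
           E (lookup (x ∷ ys) i) (lookup (x ∷ ys) j) ≡ true
    next i j e lf = trans (sym (bit-links E x ys i j e))
      (bit-firstTrues k all (toℕ i) (trans (sym (LF-bits bs len-bs i j e)) lf))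
    contains : Contains G (LF (suc (length ys)) ls)
    contains = lookup (x ∷ ys) , (λ i j → lookup-injective u) , pres
      where
      pres : ∀ i j → LF (suc (length ys)) ls i j ≡ true → E (lookup (x ∷ ys) i) (lookup (x ∷ ys) j) ≡ true
      pres i j lf with ∨-⁻ lf
      ... | inj₁ s = next i j (≡ᵇ-⁻ (proj₁ (∧-⁻ s))) lf
      ... | inj₂ s = trans (adj-sym G _ _) (next j i (≡ᵇ-⁻ (proj₁ (∧-⁻ s)))
                       (LF-sym ls i j lf))

-- Scores in threshold graphs

tally : (A → Bool) → List A → ℕ
tally p []       = 0
tally p (x ∷ xs) = b2n (p x) + tally p xs

tally-filter : ∀ (p : A → Bool) xs → tally p xs ≡ length (filter (λ x → p x ≟B true) xs)
tally-filter p [] = refl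
tally-filter p (x ∷ xs) with p x
... | true  = cong suc (tally-filter p xs)
... | false = tally-filter p xs

tally-unique : ∀ (p : Fin n → Bool) b → (∀ v → p v ≡ true → toℕ v < b) →
               ∀ {vs} → Unique vs → tally p vs ≤ b
tally-unique p b p⇒< {vs} u = begin
  tally p vs                    ≡⟨ tally-filter p vs ⟩
  length ws                     ≡⟨ length-map toℕ ws ⟨
  length (map toℕ ws)           ≤⟨ ⊆⇒length≤ (UniqueP.map⁺ toℕ-injective (UniqueP.filter⁺ _ u)) below ⟩
  length (upTo b)               ≡⟨ length-upTo b ⟩
  b                             ∎
  where
  open ≤-Reasoning
  ws = filter (λ x → p x ≟B true) vs
  below : ∀ {x} → x ∈ map toℕ ws → x ∈ upTo b
  below x∈ with ∈-map⁻ toℕ x∈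
  ... | v , v∈ , refl = ∈-upTo⁺ (p⇒< v (proj₂ (∈-filter⁻ (λ x → p x ≟B true) {xs = vs} v∈)))

tally-disjoint : ∀ (p q : A → Bool) xs →
                 tally p xs + tally (λ x → not (p x) ∧ q x) xs ≡ tally (λ x → p x ∨ q x) xs
tally-disjoint p q [] = refl
tally-disjoint p q (x ∷ xs) with p x | q x
... | true  | _     = cong suc (tally-disjoint p q xs)
... | false | true  = trans (+-suc (tally p xs) _) (cong suc (tally-disjoint p q xs))
... | false | false = tally-disjoint p q xs

positive : ℕ → ℕ
positive zero    = 0
positive (suc _) = 1

module _ (c m : ℕ) where
  private
    hub mid : Fin n → Bool
    hub v = toℕ v <ᵇ c
    mid v = not (toℕ v <ᵇ c) ∧ (toℕ v <ᵇ m)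

    hubAtHead : List (Fin n) → ℕ
    hubAtHead vs = b2n (at hub (head vs))

    -- The induction step of `score-bound` for x ∷ y ∷ ys: e is the link xy, and sc, h, d are the
    -- score, the hubs and the mid vertices from y on. A hub x brings two units, for xy and for the
    -- link before it; a mid x brings one, for a link to a mid y or for `positive`; a link to a hub
    -- y is paid by the spare unit of y.
    cons-bound : ∀ cx mx cy my e sc h d → e ≤ b2n (cx ∨ cy ∨ (mx ∧ my)) → b2n (not cy ∧ my) ≤ d →
      sc + positive d + b2n cy ≤ h + h + d →
      e + sc + positive (b2n (not cx ∧ mx) + d) + b2n cx ≤ (b2n cx + h) + (b2n cx + h) + (b2n (not cx ∧ mx) + d)
    cons-bound true mx cy my e sc h d e≤ _ ih = begin
      e + sc + positive d + 1     ≤⟨ +-monoˡ-≤ 1 (+-monoˡ-≤ (positive d) (+-monoˡ-≤ sc e≤)) ⟩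
      1 + sc + positive d + 1     ≡⟨ l₁ sc (positive d) ⟩
      2 + (sc + positive d)       ≤⟨ +-monoʳ-≤ 2 (≤-trans (m≤m+n _ (b2n cy)) ih) ⟩
      2 + (h + h + d)             ≡⟨ l₂ h d ⟩
      suc h + suc h + d           ∎
      where
      open ≤-Reasoning
      l₁ : ∀ a b → 1 + a + b + 1 ≡ 2 + (a + b)
      l₁ = solve-∀
      l₂ : ∀ h d → 2 + (h + h + d) ≡ suc h + suc h + d
      l₂ = solve-∀
    cons-bound false true true my e sc h d e≤ _ ih = begin
      e + sc + 1 + 0       ≤⟨ +-monoˡ-≤ 0 (+-monoˡ-≤ 1 (+-monoˡ-≤ sc e≤)) ⟩
      1 + sc + 1 + 0       ≡⟨ l₁ sc ⟩
      1 + (sc + 0 + 1)     ≤⟨ +-monoʳ-≤ 1 (≤-trans (+-monoˡ-≤ 1 (+-monoʳ-≤ sc z≤n)) ih) ⟩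
      1 + (h + h + d)      ≡⟨ +-suc (h + h) d ⟨
      h + h + suc d        ∎
      where
      open ≤-Reasoning
      l₁ : ∀ a → 1 + a + 1 + 0 ≡ 1 + (a + 0 + 1)
      l₁ = solve-∀
    cons-bound false true false true e sc h (suc d) e≤ _ ih = begin
      e + sc + 1 + 0       ≤⟨ +-monoˡ-≤ 0 (+-monoˡ-≤ 1 (+-monoˡ-≤ sc e≤)) ⟩
      1 + sc + 1 + 0       ≡⟨ l₁ sc ⟩
      1 + (sc + 1 + 0)     ≤⟨ +-monoʳ-≤ 1 ih ⟩
      1 + (h + h + suc d)  ≡⟨ +-suc (h + h) (suc d) ⟨
      h + h + suc (suc d)  ∎
      where
      open ≤-Reasoning
      l₁ : ∀ a → 1 + a + 1 + 0 ≡ 1 + (a + 1 + 0)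
      l₁ = solve-∀
    cons-bound false true false false e sc h d e≤ _ ih = begin
      e + sc + 1 + 0       ≤⟨ +-monoˡ-≤ 0 (+-monoˡ-≤ 1 (+-monoˡ-≤ sc e≤)) ⟩
      sc + 1 + 0           ≡⟨ l₁ sc ⟩
      1 + (sc + 0 + 0)     ≤⟨ +-monoʳ-≤ 1 (≤-trans (+-monoˡ-≤ 0 (+-monoʳ-≤ sc z≤n)) ih) ⟩
      1 + (h + h + d)      ≡⟨ +-suc (h + h) d ⟨
      h + h + suc d        ∎
      where
      open ≤-Reasoning
      l₁ : ∀ a → a + 1 + 0 ≡ 1 + (a + 0 + 0)
      l₁ = solve-∀
    cons-bound false false true my e sc h d e≤ _ ih = begin
      e + sc + positive d + 0  ≤⟨ +-monoˡ-≤ 0 (+-monoˡ-≤ (positive d) (+-monoˡ-≤ sc e≤)) ⟩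
      1 + sc + positive d + 0  ≡⟨ l₁ sc (positive d) ⟩
      sc + positive d + 1      ≤⟨ ih ⟩
      h + h + d                ∎
      where
      open ≤-Reasoning
      l₁ : ∀ a b → 1 + a + b + 0 ≡ a + b + 1
      l₁ = solve-∀
    cons-bound false false false my e sc h d e≤ _ ih = begin
      e + sc + positive d + 0  ≤⟨ +-monoˡ-≤ 0 (+-monoˡ-≤ (positive d) (+-monoˡ-≤ sc e≤)) ⟩
      sc + positive d + 0      ≤⟨ ih ⟩
      h + h + d                ∎
      where open ≤-Reasoning

    -- Each hub lies on at most two links, and d > 0 mid vertices have at most d - 1 links among
    -- themselves; `positive` records this saving. `hubAtHead` strengthens the induction: a hub at
    -- the head has so far used only one of its two links.
    score-bound : ∀ (vs : List (Fin n)) → score (adj (thresholdG n m c)) vs + positive (tally mid vs) + hubAtHead vs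
                  ≤ tally hub vs + tally hub vs + tally mid vs
    score-bound [] = z≤n
    score-bound (x ∷ []) with toℕ x <ᵇ c | toℕ x <ᵇ m
    ... | true  | _     = s≤s z≤n
    ... | false | true  = s≤s z≤n
    ... | false | false = z≤n
    score-bound {n} (x ∷ y ∷ ys) = cons-bound (hub x) (toℕ x <ᵇ m) (hub y) (toℕ y <ᵇ m)
      (b2n (adj (thresholdG n m c) x y)) (score (adj (thresholdG n m c)) (y ∷ ys)) (tally hub (y ∷ ys)) (tally mid (y ∷ ys))
      (≤-b2n (λ e → proj₂ (∧-⁻ {not (eqF x y)} e))) (m≤m+n _ _) (score-bound (y ∷ ys))

  -- Here c + m is k. There are at most c hubs, and at most m hubs and mid vertices together. If a
  -- mid vertex occurs, the saving in `score-bound` makes the inequality strict; if none does, the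
  -- score is at most 2c.
  threshold-score : c + c < c + m → c ≤ m → ∀ {vs : List (Fin n)} → Unique vs →
                    score (adj (thresholdG n m c)) vs < c + m
  threshold-score {n} 2c<k c≤m {vs} u with tally mid vs in eq | score-bound vs
  ... | zero | h = ≤-<-trans (≤-trans (m≤m+n _ 0) (≤-trans (m≤m+n _ (hubAtHead vs)) h))
    (≤-<-trans (≤-trans (≤-reflexive (+-identityʳ _)) (+-mono-≤ hub≤ hub≤)) 2c<k)
    where
    hub≤ : tally hub vs ≤ c
    hub≤ = tally-unique hub c (λ v → <ᵇ-⁻) u
  ... | suc d | h = ≤-trans (≤-trans (≤-reflexive (+-comm 1 _)) (≤-trans (m≤m+n _ (hubAtHead vs)) h))
    (≤-trans (≤-reflexive (+-assoc (tally hub vs) _ _)) (+-mono-≤ (tally-unique hub c (λ v → <ᵇ-⁻) u)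
      (subst (_≤ m) (trans (sym (tally-disjoint hub (λ v → toℕ v <ᵇ m) vs)) (cong (tally hub vs +_) eq))
        (tally-unique (λ v → hub v ∨ (toℕ v <ᵇ m)) m below u))))
    where
    below : ∀ v → hub v ∨ (toℕ v <ᵇ m) ≡ true → toℕ v < m
    below v e with ∨-⁻ {hub v} e
    ... | inj₁ e′ = <-≤-trans (<ᵇ-⁻ e′) c≤m
    ... | inj₂ e′ = <ᵇ-⁻ e′

-- Counting labellings of threshold graphs

pred-arg : (ℕ → ℕ) → ℕ → ℕ
pred-arg f zero    = 0
pred-arg f (suc t) = f t

-- The number of choices once an unrestricted vertex is added: it is unused, a leaf, or a core vertex.
addVertex : (ℕ → ℕ → ℕ) → ℕ → ℕ → ℕ
addVertex f s t = f s t + pred-arg (f s) t + pred-arg (λ s → f s t) s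

-- Pairs (S , T) of disjoint sets of sizes s, t with S ⊆ [c] and T ⊆ [c + r].
choices : ℕ → ℕ → ℕ → ℕ → ℕ
choices c r s t = (c C s) * ((c + r ∸ s) C t)

pascal : ∀ n k → suc n C suc k ≡ n C k + n C suc k
pascal n k = sym (nCk+nC[k+1]≡[n+1]C[k+1] n k)

pascal-pred : ∀ n t → suc n C t ≡ n C t + pred-arg (n C_) t
pascal-pred n zero    = refl
pascal-pred n (suc t) = trans (pascal n t) (+-comm (n C t) _)

-- The new element lies in both ground sets and may belong to neither set, to T or to S.
-- Algebraically this is Pascal's rule in each of the two factors.
choices-suc : ∀ c r s t → choices (suc c) r s t ≡ addVertex (choices c r) s t
choices-suc c r zero t = begin
  1 * (suc (c + r) C t)                                 ≡⟨ *-identityˡ _ ⟩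
  suc (c + r) C t                                       ≡⟨ pascal-pred (c + r) t ⟩
  (c + r) C t + pred-arg ((c + r) C_) t                 ≡⟨ cong₂ _+_ (sym (*-identityˡ _)) (unit t) ⟩
  1 * ((c + r) C t) + pred-arg (choices c r 0) t        ≡⟨ +-identityʳ _ ⟨
  1 * ((c + r) C t) + pred-arg (choices c r 0) t + 0    ∎
  where
  open ≡-Reasoning
  unit : ∀ t → pred-arg ((c + r) C_) t ≡ pred-arg (choices c r 0) t
  unit zero    = refl
  unit (suc t) = sym (*-identityˡ _)
choices-suc c r (suc s) t = begin
  (suc c C suc s) * ((c + r ∸ s) C t)                   ≡⟨ cong (_* ((c + r ∸ s) C t)) (pascal c s) ⟩
  (c C s + c C suc s) * ((c + r ∸ s) C t)               ≡⟨ *-distribʳ-+ ((c + r ∸ s) C t) (c C s) _ ⟩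
  choices c r s t + (c C suc s) * ((c + r ∸ s) C t)     ≡⟨ +-comm (choices c r s t) _ ⟩
  (c C suc s) * ((c + r ∸ s) C t) + choices c r s t     ≡⟨ cong (_+ choices c r s t) (split (suc s ≤? c)) ⟩
  choices c r (suc s) t + pred-arg (choices c r (suc s)) t + choices c r s t ∎
  where
  open ≡-Reasoning
  scale : ∀ t → (c C suc s) * pred-arg ((c + r ∸ suc s) C_) t ≡ pred-arg (choices c r (suc s)) t
  scale zero    = *-zeroʳ (c C suc s)
  scale (suc t) = refl
  vanish : c C suc s ≡ 0 → ∀ t → pred-arg (choices c r (suc s)) t ≡ 0
  vanish z zero    = refl
  vanish z (suc t) = cong (_* ((c + r ∸ suc s) C t)) z
  -- Pascal's rule in the second factor needs s < c + r, which truncated subtraction hides;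
  -- distinguishing s < c is enough, since otherwise `c C suc s` is 0.
  split : Dec (suc s ≤ c) →
          (c C suc s) * ((c + r ∸ s) C t) ≡ choices c r (suc s) t + pred-arg (choices c r (suc s)) t
  split (yes s<c) = begin
    (c C suc s) * ((c + r ∸ s) C t)        ≡⟨ cong (λ x → (c C suc s) * (x C t)) c+r∸s ⟩
    (c C suc s) * (suc (c + r ∸ suc s) C t)
      ≡⟨ cong ((c C suc s) *_) (pascal-pred (c + r ∸ suc s) t) ⟩
    (c C suc s) * ((c + r ∸ suc s) C t + pred-arg ((c + r ∸ suc s) C_) t)
      ≡⟨ *-distribˡ-+ (c C suc s) _ _ ⟩
    choices c r (suc s) t + (c C suc s) * pred-arg ((c + r ∸ suc s) C_) t
      ≡⟨ cong (choices c r (suc s) t +_) (scale t) ⟩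
    choices c r (suc s) t + pred-arg (choices c r (suc s)) t ∎
    where
    c+r∸s : c + r ∸ s ≡ suc (c + r ∸ suc s)
    c+r∸s = sym (trans (sym (+-∸-assoc 1 (≤-trans s<c (m≤m+n c r)))) refl)
  split (no s≮c) = let z = k>n⇒nCk≡0 (≰⇒> s≮c) in
    trans (cong (_* ((c + r ∸ s) C t)) z)
      (sym (cong₂ _+_ (cong (_* ((c + r ∸ suc s) C t)) z) (vanish z t)))

-- Stated for every g that has the values of r prepended to f: the functions listed by `funs` come
-- from a pattern lambda and are recognised only through their values.
Peels : ((Fin (suc n) → Role) → Set) → Role → ((Fin n → Role) → Set) → Set
Peels {n} P r Q = ∀ (g : Fin (suc n) → Role) f → g zero ≡ r → (∀ v → g (suc v) ≡ f v) → (P g → Q f) × (Q f → P g)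

#-peel : ∀ {P : (Fin (suc n) → Role) → Set} {Q₀ Q₁ Q₂ : (Fin n → Role) → Set}
         (P? : Decidable P) (Q₀? : Decidable Q₀) (Q₁? : Decidable Q₁) (Q₂? : Decidable Q₂) →
         Peels P none Q₀ → Peels P leaf Q₁ → Peels P core Q₂ →
         (# P?) (funs (suc n) roles) ≡ (# Q₀?) (funs n roles) + (# Q₁?) (funs n roles) + (# Q₂?) (funs n roles)
#-peel {n} {P} P? Q₀? Q₁? Q₂? p₀ p₁ p₂ = trans (#-++ P? (map _ fs) _)
  (trans (cong₂ _+_ (one none Q₀? p₀ (λ _ → refl) (λ _ _ → refl)) (trans (#-++ P? (map _ fs) _)
    (cong₂ _+_ (one leaf Q₁? p₁ (λ _ → refl) (λ _ _ → refl)) (trans (#-++ P? (map _ fs) []) (trans (+-identityʳ _) (one core Q₂? p₂ (λ _ → refl) (λ _ _ → refl)))))))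
    (sym (+-assoc ((# Q₀?) fs) _ _)))
  where
  fs = funs n roles
  one : ∀ r {Q} (Q? : Decidable Q) → Peels P r Q → ∀ {c : (Fin n → Role) → Fin (suc n) → Role} →
        (∀ f → c f zero ≡ r) → (∀ f v → c f (suc v) ≡ f v) → (# P?) (map c fs) ≡ (# Q?) fs
  one r Q? p {c} e₀ eₛ = trans (#-map P? c fs)
    (#-cong (P? ∘ c) Q? (λ f → proj₁ (p (c f) f (e₀ f) (eₛ f))) (λ f → proj₂ (p (c f) f (e₀ f) (eₛ f))) fs)

Sized : ((Fin n → Role) → Set) → ℕ → ℕ → (Fin n → Role) → Set
Sized P s t ρ = count (isCore ∘ ρ) ≡ s × count (isLeaf ∘ ρ) ≡ t × P ρ

sized? : ∀ {P : (Fin n → Role) → Set} → Decidable P → ∀ s t → Decidable (Sized P s t)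
sized? P? s t ρ = (_ ≟ s) ×-dec ((_ ≟ t) ×-dec P? ρ)
  where open import Data.Nat using (_≟_)

#sized : ∀ {P : (Fin n → Role) → Set} → Decidable P → ℕ → ℕ → ℕ
#sized {n} P? s t = (# (sized? P? s t)) (funs n roles)

#sized-cong : ∀ {P Q : (Fin n → Role) → Set} (P? : Decidable P) (Q? : Decidable Q) {s t} →
              (∀ ρ → Sized P s t ρ → Q ρ) → (∀ ρ → Sized Q s t ρ → P ρ) → #sized P? s t ≡ #sized Q? s t
#sized-cong {n} P? Q? {s} {t} to from = #-cong (sized? P? s t) (sized? Q? s t)
  (λ ρ p → proj₁ p , proj₁ (proj₂ p) , to ρ p) (λ ρ q → proj₁ q , proj₁ (proj₂ q) , from ρ q) (funs n roles)

module _ {P : (Fin (suc n) → Role) → Set} {P′ : (Fin n → Role) → Set} (P? : Decidable P) (P′? : Decidable P′)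
         (allowed : Role → Bool) (none-allowed : allowed none ≡ true)
         (restrict : ∀ {g f} → (∀ v → g (suc v) ≡ f v) → P g → allowed (g zero) ≡ true × P′ f)
         (prolong : ∀ {g f} → (∀ v → g (suc v) ≡ f v) → allowed (g zero) ≡ true → P′ f → P g) where

  private
    count-cons : ∀ (q : Role → Bool) (g : Fin (suc n) → Role) {f r} → g zero ≡ r → (∀ v → g (suc v) ≡ f v) →
                 count (q ∘ g) ≡ b2n (q r) + count (q ∘ f)
    count-cons q g e₀ eₛ = trans (count-suc (q ∘ g)) (cong₂ _+_ (cong (b2n ∘ q) e₀) (count-cong (cong q ∘ eₛ)))

    Rest : Role → ℕ → ℕ → (Fin n → Role) → Set
    Rest r s t f = allowed r ≡ true ×
      (b2n (isCore r) + count (isCore ∘ f) ≡ s × b2n (isLeaf r) + count (isLeaf ∘ f) ≡ t × P′ f)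

    rest? : ∀ r s t → Decidable (Rest r s t)
    rest? r s t f = (_ ≟B _) ×-dec ((_ ≟ s) ×-dec ((_ ≟ t) ×-dec P′? f))
      where open import Data.Nat using (_≟_)

    peels : ∀ r s t → Peels (Sized P s t) r (Rest r s t)
    peels r s t g f e₀ eₛ =
      (λ (cs , ls , p) → let a , p′ = restrict eₛ p in
         trans (cong allowed (sym e₀)) a , trans (sym (count-cons isCore g e₀ eₛ)) cs , trans (sym (count-cons isLeaf g e₀ eₛ)) ls , p′) ,
      (λ (a , cs , ls , p′) → trans (count-cons isCore g e₀ eₛ) cs , trans (count-cons isLeaf g e₀ eₛ) ls ,
         prolong eₛ (trans (cong allowed e₀) a) p′)

    N : ℕ → ℕ → ℕ
    N = #sized P′?

    rest-none : ∀ s t → (# (rest? none s t)) (funs n roles) ≡ N s t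
    rest-none s t = #-cong (rest? none s t) (sized? P′? s t) (λ _ → proj₂) (λ _ → none-allowed ,_) (funs n roles)

    rest-leaf : ∀ b → allowed leaf ≡ b → ∀ s t →
                (# (rest? leaf s t)) (funs n roles) ≡ (if b then pred-arg (N s) t else 0)
    rest-leaf false eq s t       = #-none (rest? leaf s t) (λ f (a , _) → case trans (sym eq) a of λ ()) (funs n roles)
    rest-leaf true  eq s zero    = #-none (rest? leaf s zero) (λ f (_ , _ , e , _) → 1+n≢0 e) (funs n roles)
    rest-leaf true  eq s (suc t) = #-cong (rest? leaf s (suc t)) (sized? P′? s t)
      (λ f (_ , cs , ls , p) → cs , suc-injective ls , p) (λ f (cs , ls , p) → eq , cs , cong suc ls , p) (funs n roles)

    rest-core : ∀ b → allowed core ≡ b → ∀ s t →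
                (# (rest? core s t)) (funs n roles) ≡ (if b then pred-arg (λ s → N s t) s else 0)
    rest-core false eq s t       = #-none (rest? core s t) (λ f (a , _) → case trans (sym eq) a of λ ()) (funs n roles)
    rest-core true  eq zero t    = #-none (rest? core zero t) (λ f (_ , e , _) → 1+n≢0 e) (funs n roles)
    rest-core true  eq (suc s) t = #-cong (rest? core (suc s) t) (sized? P′? s t)
      (λ f (_ , cs , ls , p) → suc-injective cs , ls , p) (λ f (cs , ls , p) → eq , cong suc cs , ls , p) (funs n roles)

  -- One recurrence for both kinds of count, by ranges (`Within`) and by adjacency (`Edges`): the
  -- label of vertex 0 is constrained only by `allowed`, the other labels only by P′.
  #sized-suc : ∀ s t → #sized P? s t ≡ #sized P′? s t + (if allowed leaf then pred-arg (#sized P′? s) t else 0)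
                                      + (if allowed core then pred-arg (λ s → #sized P′? s t) s else 0)
  #sized-suc s t = trans
    (#-peel (sized? P? s t) (rest? none s t) (rest? leaf s t) (rest? core s t) (peels none s t) (peels leaf s t) (peels core s t))
    (cong₂ _+_ (cong₂ _+_ (rest-none s t) (rest-leaf (allowed leaf) refl s t)) (rest-core (allowed core) refl s t))

pred-arg-cong : ∀ {f g} → (∀ x → f x ≡ g x) → ∀ t → pred-arg f t ≡ pred-arg g t
pred-arg-cong e zero    = refl
pred-arg-cong e (suc t) = e t

addVertex-cong : ∀ {f g : ℕ → ℕ → ℕ} → (∀ s t → f s t ≡ g s t) → ∀ s t → addVertex f s t ≡ addVertex g s t
addVertex-cong e s t = cong₂ _+_ (cong₂ _+_ (e s t) (pred-arg-cong (e s) t)) (pred-arg-cong (λ s → e s t) s)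

Within : ℕ → ℕ → (Fin n → Role) → Set
Within a b ρ = ∀ v → (isCore (ρ v) ≡ true → toℕ v < a) × (isLeaf (ρ v) ≡ true → toℕ v < b)

within? : ∀ a b → Decidable (Within {n} a b)
within? a b ρ = all? λ v → ((_ ≟B true) →-dec (toℕ v <? a)) ×-dec ((_ ≟B true) →-dec (toℕ v <? b))

allowedAt : ℕ → ℕ → Role → Bool
allowedAt a b none = true
allowedAt a b leaf = 0 <ᵇ b
allowedAt a b core = 0 <ᵇ a

module _ (a b : ℕ) where
  within-restrict : ∀ {g : Fin (suc n) → Role} {f} → (∀ v → g (suc v) ≡ f v) → Within a b g →
                    allowedAt a b (g zero) ≡ true × Within (pred a) (pred b) f
  within-restrict {g = g} {f} eₛ w = at-zero (g zero) (w zero) , λ v →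
    (λ c → below-pred (proj₁ (w (suc v)) (trans (cong isCore (eₛ v)) c))) ,
    (λ l → below-pred (proj₂ (w (suc v)) (trans (cong isLeaf (eₛ v)) l)))
    where
    at-zero : ∀ r → (isCore r ≡ true → 0 < a) × (isLeaf r ≡ true → 0 < b) → allowedAt a b r ≡ true
    at-zero none _       = refl
    at-zero leaf (_ , h) = <ᵇ-⁺ (h refl)
    at-zero core (h , _) = <ᵇ-⁺ (h refl)
    below-pred : ∀ {x y} → suc x < y → x < pred y
    below-pred (s≤s h) = h

  within-prolong : ∀ {g : Fin (suc n) → Role} {f} → (∀ v → g (suc v) ≡ f v) → allowedAt a b (g zero) ≡ true →
                   Within (pred a) (pred b) f → Within a b g
  within-prolong eₛ al w zero = at-zero _ al
    where
    at-zero : ∀ r → allowedAt a b r ≡ true → (isCore r ≡ true → 0 < a) × (isLeaf r ≡ true → 0 < b)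
    at-zero none _ = (λ ()) , (λ ())
    at-zero leaf e = (λ ()) , (λ _ → <ᵇ-⁻ e)
    at-zero core e = (λ _ → <ᵇ-⁻ e) , (λ ())
  within-prolong eₛ al w (suc v) =
    (λ c → lift (proj₁ (w v) (trans (cong isCore (sym (eₛ v))) c))) ,
    (λ l → lift (proj₂ (w v) (trans (cong isLeaf (sym (eₛ v))) l)))
    where
    lift : ∀ {x y} → x < pred y → suc x < y
    lift {y = suc y} h = s≤s h

#within-suc : ∀ n a b s t → #sized (within? {suc n} a b) s t ≡
  #sized (within? {n} (pred a) (pred b)) s t
  + (if 0 <ᵇ b then pred-arg (#sized (within? {n} (pred a) (pred b)) s) t else 0)
  + (if 0 <ᵇ a then pred-arg (λ s → #sized (within? {n} (pred a) (pred b)) s t) s else 0)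
#within-suc n a b s t = #sized-suc {n} (within? a b) (within? (pred a) (pred b)) (allowedAt a b) refl
  (within-restrict a b) (within-prolong a b) s t

-- Vertex 0 is open to every label while c is positive, then only to `leaf` and `none`, then only to
-- `none`; the clauses are the matching recurrences of `choices`.
#within : ∀ n c r → c + r ≤ n → ∀ s t → #sized (within? {n} c (c + r)) s t ≡ choices c r s t
#within zero zero zero _ zero    zero    = refl
#within zero zero zero _ zero    (suc t) = refl
#within zero zero zero _ (suc s) t       = refl
#within (suc n) zero zero le s t = trans (#within-suc n 0 0 s t)
  (trans (+-identityʳ _) (trans (+-identityʳ _) (#within n 0 0 z≤n s t)))
#within (suc n) zero (suc r) (s≤s le) s t = trans (#within-suc n 0 (suc r) s t)
  (trans (+-identityʳ _) (trans (cong₂ _+_ (#within n 0 r le s t) (pred-arg-cong (#within n 0 r le s) t)) (pascal₀ s t)))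
  where
  pascal₀ : ∀ s t → choices 0 r s t + pred-arg (choices 0 r s) t ≡ choices 0 (suc r) s t
  pascal₀ (suc s) zero    = refl
  pascal₀ (suc s) (suc t) = refl
  pascal₀ zero    zero    = refl
  pascal₀ zero    (suc t) = trans (sym (*-distribˡ-+ 1 (r C suc t) (r C t)))
                                  (cong (1 *_) (sym (pascal-pred r (suc t))))
#within (suc n) (suc c) r (s≤s le) s t = trans (#within-suc n (suc c) (suc c + r) s t)
  (trans (addVertex-cong (#within n c r le) s t) (sym (choices-suc c r s t)))

Edges : (Fin n → Fin n → Bool) → (Fin n → Role) → Set
Edges E ρ = ∀ u v → u ≢ v → needs (ρ u) (ρ v) ≡ true → E u v ≡ true

edges? : (E : Fin n → Fin n → Bool) → Decidable (Edges E)
edges? E ρ = all? λ u → all? λ v → ¬? (u ≟F v) →-dec ((_ ≟B true) →-dec (_ ≟B true))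

-- Vertex 0 is a hub, so every label is open to it and its label does not restrict the others.
labellings-suc : ∀ n m c s t → labellings (threshold {suc n} (suc m) (suc c)) s t ≡
                 addVertex (labellings (threshold {n} m c)) s t
labellings-suc n m c s t = #sized-suc {n} (edges? (threshold (suc m) (suc c))) (edges? (threshold m c)) (λ _ → true) refl
  (λ {g} → restrict {g}) (λ {g} → prolong {g}) s t
  where
  restrict : ∀ {g : Fin (suc n) → Role} {f} → (∀ v → g (suc v) ≡ f v) → Edges (threshold (suc m) (suc c)) g →
             true ≡ true × Edges (threshold m c) f
  restrict eₛ h = refl , λ u v u≢v nd → h (suc u) (suc v) (u≢v ∘ Fin-suc-injective)
    (trans (cong₂ needs (eₛ u) (eₛ v)) nd)
  prolong : ∀ {g : Fin (suc n) → Role} {f} → (∀ v → g (suc v) ≡ f v) → true ≡ true →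
            Edges (threshold m c) f → Edges (threshold (suc m) (suc c)) g
  prolong eₛ _ h zero    zero    u≢v nd = contradiction refl u≢v
  prolong eₛ _ h zero    (suc v) u≢v nd = refl
  prolong eₛ _ h (suc u) zero    u≢v nd = ∨-zeroʳ (toℕ u <ᵇ c)
  prolong eₛ _ h (suc u) (suc v) u≢v nd = h u v (u≢v ∘ cong suc) (trans (sym (cong₂ needs (eₛ u) (eₛ v))) nd)

isCore⇒isUsed : ∀ {r} → isCore r ≡ true → isUsed r ≡ true
isCore⇒isUsed {core} _ = refl

isLeaf⇒isUsed : ∀ {r} → isLeaf r ≡ true → isUsed r ≡ true
isLeaf⇒isUsed {leaf} _ = refl

some : (p : Fin n → Bool) → 1 ≤ count p → ∃ λ v → p v ≡ true
some p 1≤ = go (trues p) (∈-trues⁻ p) 1≤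
  where
  go : ∀ ws → (∀ {w} → w ∈ ws → p w ≡ true) → 1 ≤ length ws → ∃ λ v → p v ≡ true
  go (w ∷ _) h _ = w , h (here refl)

core-partner : ∀ (ρ : Fin n → Role) s t → count (isCore ∘ ρ) ≡ suc s → count (isLeaf ∘ ρ) ≡ t → 2 ≤ suc s + t →
               ∀ v → isCore (ρ v) ≡ true → ∃ λ w → v ≢ w × isUsed (ρ w) ≡ true
core-partner ρ zero zero cs ls (s≤s ()) v c
core-partner ρ (suc s) t cs ls _ v c =
  let w , v≢w , cw = another (isCore ∘ ρ) (subst (2 ≤_) (sym cs) (s≤s (s≤s z≤n))) v in w , v≢w , isCore⇒isUsed cw
core-partner ρ zero (suc t) cs ls _ v c =
  let w , lw = some (isLeaf ∘ ρ) (subst (1 ≤_) (sym ls) (s≤s z≤n)) in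
  w , (λ { refl → case trans (sym (cong isLeaf (isCore-true c))) lw of λ () }) , isLeaf⇒isUsed lw

-- Every used vertex has a neighbour because s + t ≥ 2, hence lies in the clique.
#clique : ∀ n m s t → m ≤ n → 2 ≤ suc s + t → labellings (threshold {n} m 0) (suc s) t ≡ choices m 0 (suc s) t
#clique n m s t m≤n 2≤ = trans (#sized-cong {n} (edges? (threshold m 0)) (within? m (m + 0)) to from)
                               (#within n m 0 (subst (_≤ n) (sym (+-identityʳ m)) m≤n) (suc s) t)
  where
  to : ∀ ρ → Sized (Edges (threshold m 0)) (suc s) t ρ → Within m (m + 0) ρ
  to ρ (cs , ls , h) v =
    (λ c → let w , v≢w , uw = core-partner ρ s t cs ls 2≤ v c in
       <ᵇ-⁻ (proj₁ (∧-⁻ (h v w v≢w (trans (cong (λ r → needs r (ρ w)) (isCore-true c)) uw))))) ,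
    (λ l → let w , cw = some (isCore ∘ ρ) (subst (1 ≤_) (sym cs) (s≤s z≤n)) in
       subst (toℕ v <_) (sym (+-identityʳ m)) (<ᵇ-⁻ (proj₁ (∧-⁻ (h v w
         (λ { refl → case trans (sym (cong isCore (isLeaf-true l))) cw of λ () })
         (cong₂ needs (isLeaf-true l) (isCore-true cw)))))))
  from : ∀ ρ → Sized (Within m (m + 0)) (suc s) t ρ → Edges (threshold m 0) ρ
  from ρ (_ , _ , w) u v u≢v nd = let uu , uv = needs-used (ρ u) (ρ v) nd in
    ∧-⁺ (<ᵇ-⁺ (low u (ρ u) refl uu)) (<ᵇ-⁺ (low v (ρ v) refl uv))
    where
    low : ∀ v r → ρ v ≡ r → isUsed r ≡ true → toℕ v < m
    low v core e _ = proj₁ (w v) (cong isCore e)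
    low v leaf e _ = subst (toℕ v <_) (+-identityʳ m) (proj₂ (w v) (cong isLeaf e))

count≡0 : ∀ (p : Fin n → Bool) → count p ≡ 0 → ∀ {v} → p v ≢ true
count≡0 p e pv = n≮0 (subst (0 <_) e (∈-length (∈-trues⁺ p pv)))

-- Without a core vertex no edge is demanded, whatever E is. These sizes, like s = 1, t = 0 below,
-- lie outside the theorem but are reached by the recursion of `labellings-threshold`.
#no-core : ∀ n (E : Fin n → Fin n → Bool) t → labellings E 0 t ≡ choices 0 n 0 t
#no-core n E t = trans (#sized-cong {n} (edges? E) (within? 0 n) to from) (#within n 0 n ≤-refl 0 t)
  where
  to : ∀ ρ → Sized (Edges E) 0 t ρ → Within 0 n ρ
  to ρ (cs , _ , _) v = (λ c → contradiction c (count≡0 (isCore ∘ ρ) cs)) , (λ _ → toℕ<n v)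
  from : ∀ ρ → Sized (Within 0 n) 0 t ρ → Edges E ρ
  from ρ (cs , _ , _) u v _ nd with ρ u in eu | ρ v in ev
  ... | core | _    = contradiction (cong isCore eu) (count≡0 (isCore ∘ ρ) cs)
  ... | leaf | core = contradiction (cong isCore ev) (count≡0 (isCore ∘ ρ) cs)

#single : ∀ n (E : Fin n → Fin n → Bool) → labellings E 1 0 ≡ n
#single n E = trans (#sized-cong {n} (edges? E) (within? n (n + 0)) (λ ρ _ v → (λ _ → toℕ<n v) ,
    (λ _ → subst (toℕ v <_) (sym (+-identityʳ n)) (toℕ<n v))) from)
  (trans (#within n n 0 (≤-reflexive (+-identityʳ n)) 1 0) (trans (*-identityʳ (n C 1)) (nC1≡n n)))
  where
  from : ∀ ρ → Sized (Within n (n + 0)) 1 0 ρ → Edges E ρ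
  from ρ (cs , ls , _) u v u≢v nd = contradiction nd (lonely (ρ u) (ρ v) refl refl)
    where
    two-cores : ρ u ≡ core → ρ v ≡ core → 2 ≤ count (isCore ∘ ρ)
    two-cores eu ev = ⊆⇒length≤ {xs = u ∷ v ∷ []} ((u≢v ∷ []) ∷ [] ∷ [])
      λ { (here refl) → ∈-trues⁺ (isCore ∘ ρ) (cong isCore eu) ; (there (here refl)) → ∈-trues⁺ (isCore ∘ ρ) (cong isCore ev) }
    lonely : ∀ r r′ → ρ u ≡ r → ρ v ≡ r′ → needs r r′ ≢ true
    lonely core core eu ev _ = contradiction (subst (2 ≤_) cs (two-cores eu ev)) λ { (s≤s ()) }
    lonely core leaf eu ev _ = count≡0 (isLeaf ∘ ρ) ls (cong isLeaf ev)
    lonely leaf core eu ev _ = count≡0 (isLeaf ∘ ρ) ls (cong isLeaf eu)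

-- Classifying by whether the core lies in the hubs, uses one outer vertex, or lies in the
-- clique; choices c r on the left is counted by the first and the last term of the right.
labellings-threshold : ∀ c r q s t →
  labellings (threshold {c + (r + q)} (c + r) c) s t + choices c r s t ≡
  choices c (r + q) s t + q * pred-arg (λ s → choices c 0 s t) s + choices (c + r) 0 s t
labellings-threshold zero r q zero t = trans (cong (_+ choices 0 r 0 t) (#no-core (r + q) _ t))
  (cong₂ _+_ (sym (trans (cong (choices 0 (r + q) 0 t +_) (*-zeroʳ q)) (+-identityʳ _)))
             (cong (λ x → 1 * (x C t)) (sym (+-identityʳ r))))
-- A lone core vertex may be any vertex: q choices outside the clique and r inside.
labellings-threshold zero r q (suc zero) zero = trans (+-identityʳ _) (trans (#single (r + q) _)
  (trans (+-comm r q) (cong₂ _+_ (sym (*-identityʳ q)) (sym (trans (*-identityʳ (r C 1)) (nC1≡n r))))))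
labellings-threshold zero r q (suc zero) (suc t) = trans (+-identityʳ _)
  (trans (#clique (r + q) r 0 (suc t) (m≤m+n r q) (s≤s (s≤s z≤n))) (cong (_+ choices r 0 1 (suc t)) (sym (*-zeroʳ q))))
labellings-threshold zero r q (suc (suc s)) t = trans (+-identityʳ _)
  (trans (#clique (r + q) r (suc s) t (m≤m+n r q) (s≤s (s≤s z≤n)))
    (cong (_+ choices r 0 (suc (suc s)) t) (sym (*-zeroʳ q))))
-- Every term obeys the recurrence `addVertex`, which is linear, so the identity passes from c to c
-- + 1. Only the outer term needs care, because its index s is lowered by one (`commute`).
labellings-threshold (suc c) r q s t = begin
  L′ s t + choices (suc c) r s t ≡⟨ cong₂ _+_ (labellings-suc (c + (r + q)) (c + r) c s t) (choices-suc c r s t) ⟩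
  addVertex L s t + addVertex (choices c r) s t ≡⟨ linear s t ⟩
  addVertex H s t + q * pred-arg (λ s → addVertex (choices c 0) s t) s + addVertex M s t
    ≡⟨ cong₂ _+_ (cong₂ (λ x y → x + q * y) (sym (choices-suc c (r + q) s t))
         (pred-arg-cong (λ s → sym (choices-suc c 0 s t)) s)) (sym (choices-suc (c + r) 0 s t)) ⟩
  choices (suc c) (r + q) s t + q * pred-arg (λ s → choices (suc c) 0 s t) s + choices (suc c + r) 0 s t ∎
  where
  open ≡-Reasoning
  L′ = labellings (threshold {suc c + (r + q)} (suc c + r) (suc c))
  L  = labellings (threshold {c + (r + q)} (c + r) c)
  H  = choices c (r + q)
  K  = λ s t → pred-arg (λ s → choices c 0 s t) s
  M  = choices (c + r) 0
  ih : ∀ s t → L s t + choices c r s t ≡ H s t + q * K s t + M s t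
  ih = labellings-threshold c r q
  pred-arg-linear : ∀ {f g h k m} → (∀ x → f x + g x ≡ h x + q * k x + m x) → ∀ x →
    pred-arg f x + pred-arg g x ≡ pred-arg h x + q * pred-arg k x + pred-arg m x
  pred-arg-linear e zero    = trans (sym (*-zeroʳ q)) (sym (+-identityʳ (q * 0)))
  pred-arg-linear e (suc x) = e x
  swap₃ : ∀ a b c a′ b′ c′ → (a + b + c) + (a′ + b′ + c′) ≡ (a + a′) + (b + b′) + (c + c′)
  swap₃ = solve-∀
  collect : ∀ h₀ k₀ m₀ h₁ k₁ m₁ h₂ k₂ m₂ →
    (h₀ + q * k₀ + m₀) + (h₁ + q * k₁ + m₁) + (h₂ + q * k₂ + m₂) ≡
    (h₀ + h₁ + h₂) + q * (k₀ + k₁ + k₂) + (m₀ + m₁ + m₂)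
  collect = collect′ q
    where
    collect′ : ∀ q h₀ k₀ m₀ h₁ k₁ m₁ h₂ k₂ m₂ →
      (h₀ + q * k₀ + m₀) + (h₁ + q * k₁ + m₁) + (h₂ + q * k₂ + m₂) ≡
      (h₀ + h₁ + h₂) + q * (k₀ + k₁ + k₂) + (m₀ + m₁ + m₂)
    collect′ = solve-∀
  commute : ∀ s t → addVertex K s t ≡ pred-arg (λ s → addVertex (choices c 0) s t) s
  commute zero    zero    = refl
  commute zero    (suc t) = refl
  commute (suc s) zero    = refl
  commute (suc s) (suc t) = refl
  linear : ∀ s t → addVertex L s t + addVertex (choices c r) s t ≡
           addVertex H s t + q * pred-arg (λ s → addVertex (choices c 0) s t) s + addVertex M s t
  linear s t = begin
    addVertex L s t + addVertex (choices c r) s t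
      ≡⟨ swap₃ (L s t) _ _ (choices c r s t) _ _ ⟩
    (L s t + choices c r s t) + (pred-arg (L s) t + pred-arg (choices c r s) t)
      + (pred-arg (λ s → L s t) s + pred-arg (λ s → choices c r s t) s)
      ≡⟨ cong₂ _+_ (cong₂ _+_ (ih s t) (pred-arg-linear {f = L s} {choices c r s} {H s} {K s} {M s} (ih s) t))
           (pred-arg-linear {f = λ s → L s t} {λ s → choices c r s t} {λ s → H s t} {λ s → K s t} {λ s → M s t} (λ s → ih s t) s) ⟩
    (H s t + q * K s t + M s t) + (pred-arg (H s) t + q * pred-arg (K s) t + pred-arg (M s) t)
      + (pred-arg (λ s → H s t) s + q * pred-arg (λ s → K s t) s + pred-arg (λ s → M s t) s)
      ≡⟨ collect (H s t) (K s t) (M s t) _ (pred-arg (K s) t) _ _ (pred-arg (λ s → K s t) s) _ ⟩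
    addVertex H s t + q * addVertex K s t + addVertex M s t
      ≡⟨ cong (λ x → addVertex H s t + q * x + addVertex M s t) (commute s t) ⟩
    addVertex H s t + q * pred-arg (λ s → addVertex (choices c 0) s t) s + addVertex M s t ∎

-- Convexity in the number of hubs

C-mono : ∀ s {a b} → a ≤ b → a C s ≤ b C s
C-mono s a≤b = go (≤⇒≤′ a≤b)
  where
  go : ∀ {a b} → a ≤′ b → a C s ≤ b C s
  go ≤′-refl            = ≤-refl
  go (≤′-step {b} a≤′b) = ≤-trans (go a≤′b) (≤-trans (m≤m+n _ _) (≤-reflexive (sym (pascal-pred b s))))

-- By Pascal's rule the gap at a is `a C (s − 1)`, which increases with a.
C-gap-mono : ∀ s {a b} → a ≤ b → b C s + suc a C s ≤ suc b C s + a C s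
C-gap-mono s {a} {b} a≤b = begin
  b C s + suc a C s                         ≡⟨ cong (b C s +_) (pascal-pred a s) ⟩
  b C s + (a C s + pred-arg (a C_) s)       ≤⟨ +-monoʳ-≤ (b C s) (+-monoʳ-≤ (a C s) (step-mono s)) ⟩
  b C s + (a C s + pred-arg (b C_) s)       ≡⟨ shuffle (b C s) _ _ ⟩
  (b C s + pred-arg (b C_) s) + a C s       ≡⟨ cong (_+ a C s) (pascal-pred b s) ⟨
  suc b C s + a C s                         ∎
  where
  open ≤-Reasoning
  step-mono : ∀ s → pred-arg (a C_) s ≤ pred-arg (b C_) s
  step-mono zero    = z≤n
  step-mono (suc s) = C-mono s a≤b
  shuffle : ∀ x y z → x + (y + z) ≡ (x + z) + y
  shuffle = solve-∀

record Convex₃ (x y z : ℕ) : Set where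
  constructor convex
  field midpoint : y + y ≤ x + z

C-convex : ∀ s c → Convex₃ (c C s) (suc c C s) (suc (suc c) C s)
C-convex s c = convex (≤-trans (C-gap-mono s (n≤1+n c)) (≤-reflexive (+-comm _ (c C s))))

convex-sym : ∀ {x y z} → Convex₃ x y z → Convex₃ z y x
convex-sym {x} {z = z} (convex h) = convex (≤-trans h (≤-reflexive (+-comm x z)))

constant : ∀ {x} → Convex₃ x x x
constant = convex ≤-refl

convex-+ : ∀ {x y z x′ y′ z′} → Convex₃ x y z → Convex₃ x′ y′ z′ → Convex₃ (x + x′) (y + y′) (z + z′)
convex-+ {x} {y} {z} {x′} {y′} {z′} (convex h) (convex h′) =
  convex (subst₂ _≤_ (shuffle y y y′ y′) (shuffle x z x′ z′) (+-mono-≤ h h′))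
  where
  shuffle : ∀ a b c d → (a + b) + (c + d) ≡ (a + c) + (b + d)
  shuffle = solve-∀

-- With y = x + p and y′ = x′ + q, convexity gives z ≥ x + 2p and z′ ≥ x′ + 2q, and x x′ + (x +
-- 2p)(x′ + 2q) exceeds 2 y y′ by exactly 2pq. The monotonicity hypotheses provide p, q ≥ 0.
convex-* : ∀ {x y z x′ y′ z′} → x ≤ y → x′ ≤ y′ → Convex₃ x y z → Convex₃ x′ y′ z′ →
           Convex₃ (x * x′) (y * y′) (z * z′)
convex-* {x} {y} {z} {x′} {y′} {z′} x≤y x′≤y′ (convex h) (convex h′) with m≤n⇒∃[o]m+o≡n x≤y | m≤n⇒∃[o]m+o≡n x′≤y′
... | p , refl | q , refl = convex (begin
  (x + p) * (x′ + q) + (x + p) * (x′ + q)                     ≤⟨ m≤m+n _ (2 * (p * q)) ⟩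
  (x + p) * (x′ + q) + (x + p) * (x′ + q) + 2 * (p * q)       ≡⟨ expand x p x′ q ⟩
  x * x′ + (x + p + p) * (x′ + q + q)                         ≤⟨ +-monoʳ-≤ (x * x′) (*-mono-≤ (far x p z h) (far x′ q z′ h′)) ⟩
  x * x′ + z * z′                                             ∎)
  where
  open ≤-Reasoning
  expand : ∀ x p x′ q → (x + p) * (x′ + q) + (x + p) * (x′ + q) + 2 * (p * q) ≡ x * x′ + (x + p + p) * (x′ + q + q)
  expand = solve-∀
  far : ∀ x p z → (x + p) + (x + p) ≤ x + z → x + p + p ≤ z
  far x p z h = +-cancelˡ-≤ x _ _ (subst (_≤ x + z) (shuffle x p) h)
    where
    shuffle : ∀ x p → (x + p) + (x + p) ≡ x + (x + p + p)
    shuffle = solve-∀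

convex-≤-max : ∀ (f : ℕ → ℕ) a → (∀ c → suc (suc c) ≤ a → Convex₃ (f c) (f (suc c)) (f (suc (suc c)))) →
               ∀ c → c ≤ a → f c ≤ f 0 ⊔ f a
convex-≤-max f zero    conv zero z≤n = m≤m⊔n _ _
convex-≤-max f (suc a) conv c c≤ with m≤n⇒m<n∨m≡n c≤
... | inj₂ refl      = m≤n⊔m (f 0) _
... | inj₁ (s≤s c≤a) = ≤-trans (convex-≤-max f a (λ c le → conv c (m≤n⇒m≤1+n le)) c c≤a)
                               (⊔-lub (m≤m⊔n _ _) (last-but-one a conv))
  where
  last-but-one : ∀ a → (∀ c → suc (suc c) ≤ suc a → Convex₃ (f c) (f (suc c)) (f (suc (suc c)))) → f a ≤ f 0 ⊔ f (suc a)
  last-but-one zero    conv = m≤m⊔n _ _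
  -- By induction f a is at most the larger of f 0 and f (a + 1). If that is f 0, it bounds f (a +
  -- 1) directly; otherwise f a ≤ f (a + 1), and convexity gives f (a + 1) ≤ f (a + 2).
  last-but-one (suc a) conv with ⊔-sel (f 0) (f (suc a)) | convex-≤-max f (suc a) (λ c le → conv c (m≤n⇒m≤1+n le)) a (n≤1+n a)
  ... | inj₁ e | _  = ≤-trans (subst (f (suc a) ≤_) e (m≤n⊔m (f 0) (f (suc a)))) (m≤m⊔n _ _)
  ... | inj₂ e | le = ≤-trans (+-cancelˡ-≤ (f (suc a)) _ _
    (≤-trans (Convex₃.midpoint (conv a ≤-refl)) (+-monoˡ-≤ (f (suc (suc a))) (subst (f a ≤_) e le)))) (m≤n⊔m (f 0) _)

-- Both sides satisfy the recurrence `addVertex` in k with the same values at k = 0, so neither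
-- factorials nor division are involved.
trinomial : ∀ k s t → (k C s) * ((k ∸ s) C t) ≡ (k C (s + t)) * ((s + t) C t)
trinomial k s t = trans (cong (λ x → (k C s) * ((x ∸ s) C t)) (sym (+-identityʳ k))) (go k s t)
  where
  rhs : ℕ → ℕ → ℕ → ℕ
  rhs k s t = (k C (s + t)) * ((s + t) C t)
  rhs-suc : ∀ k s t → addVertex (rhs k) s t ≡ rhs (suc k) s t
  rhs-suc k zero zero = refl
  rhs-suc k zero (suc t) = trans (+-identityʳ _) (trans
    (cong₂ (λ x y → (k C suc t) * x + (k C t) * y) (nCn≡1 (suc t)) (nCn≡1 t))
    (trans (cong₂ _+_ (*-identityʳ (k C suc t)) (*-identityʳ (k C t)))
      (trans (+-comm (k C suc t) (k C t)) (trans (sym (pascal k t))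
        (sym (trans (cong ((suc k C suc t) *_) (nCn≡1 (suc t))) (*-identityʳ _)))))))
  rhs-suc k (suc s) zero = begin
    (k C suc (s + 0)) * 1 + 0 + (k C (s + 0)) * 1 ≡⟨ drop (k C suc (s + 0)) (k C (s + 0)) ⟩
    k C (s + 0) + k C suc (s + 0)                 ≡⟨ pascal k (s + 0) ⟨
    suc k C suc (s + 0)                           ≡⟨ *-identityʳ _ ⟨
    (suc k C suc (s + 0)) * 1                     ∎
    where
    open ≡-Reasoning
    drop : ∀ x y → x * 1 + 0 + y * 1 ≡ y + x
    drop = solve-∀
  rhs-suc k (suc s) (suc t) = begin
    (k C suc w) * (suc w C suc t) + (k C (suc s + t)) * ((suc s + t) C t) + (k C w) * (w C suc t)
      ≡⟨ cong (λ x → (k C suc w) * (suc w C suc t) + (k C x) * (x C t) + (k C w) * (w C suc t)) (sym (+-suc s t)) ⟩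
    (k C suc w) * (suc w C suc t) + (k C w) * (w C t) + (k C w) * (w C suc t)
      ≡⟨ factor (k C suc w) _ (k C w) _ _ ⟩
    (k C suc w) * (suc w C suc t) + (k C w) * (w C t + w C suc t)
      ≡⟨ cong (λ x → (k C suc w) * (suc w C suc t) + (k C w) * x) (sym (pascal w t)) ⟩
    (k C suc w) * (suc w C suc t) + (k C w) * (suc w C suc t)
      ≡⟨ *-distribʳ-+ (suc w C suc t) (k C suc w) _ ⟨
    (k C suc w + k C w) * (suc w C suc t)
      ≡⟨ cong (_* (suc w C suc t)) (trans (+-comm (k C suc w) _) (sym (pascal k w))) ⟩
    (suc k C suc w) * (suc w C suc t) ∎
    where
    open ≡-Reasoning
    w = s + suc t
    factor : ∀ a b c d e → a * b + c * d + c * e ≡ a * b + c * (d + e)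
    factor = solve-∀
  go : ∀ k s t → choices k 0 s t ≡ rhs k s t
  go zero zero    zero    = refl
  go zero zero    (suc t) = refl
  go zero (suc s) t       = refl
  go (suc k) s t = trans (choices-suc k 0 s t) (trans (addVertex-cong (go k) s t) (rhs-suc k s t))

-- The number of copies of K*_{s,t} in thresholdG n (k ∸ c) c.
value : (n k s t c : ℕ) → ℕ
value n k s t c = (c C s) * ((n ∸ s) C t)
  + (n ∸ (k ∸ c)) * (c C (s ∸ 1)) * ((c + 1 ∸ s) C t)
  + (((k ∸ c) C s) ∸ (c C s)) * ((k ∸ c ∸ s) C t)

labellings-value : ∀ n k s t c → c + c < k → k ≤ n →
                   labellings (threshold {n} (k ∸ c) c) (suc s) t ≡ value n k (suc s) t c
labellings-value n k s t c 2c<k k≤n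
  -- Here r counts the clique vertices that are not hubs and q the vertices outside the clique; in
  -- these terms k ∸ c is c + r and n is c + r + q.
  with m≤n⇒∃[o]m+o≡n (m+n≤o⇒m≤o∸n c (<⇒≤ 2c<k)) | m≤n⇒∃[o]m+o≡n (≤-trans (m∸n≤m k c) k≤n)
... | r , c+r≡m | q , m+q≡n rewrite sym c+r≡m | sym m+q≡n | +-assoc c r q = +-cancelʳ-≡ _ _ _ (begin
  labellings (threshold {c + (r + q)} (c + r) c) S t + x * z  ≡⟨ labellings-threshold c r q S t ⟩
  h + q * (d * ((c + 0 ∸ s) C t)) + y * ((c + r + 0 ∸ S) C t) ≡⟨ cong₂ _+_ (cong (h +_) mid) (cong (λ v → y * ((v ∸ S) C t)) (+-identityʳ (c + r))) ⟩
  p + y * z ≡⟨ cong (p +_) (y≡ (m∸n+n≡m (C-mono S (m≤m+n c r)))) ⟩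
  p + ((y ∸ x) * z + x * z) ≡⟨ +-assoc p ((y ∸ x) * z) (x * z) ⟨
  p + (y ∸ x) * z + x * z ∎)
  where
  open ≡-Reasoning
  S = suc s
  x = c C S
  y = (c + r) C S
  d = c C s
  z = (c + r ∸ S) C t
  h = (c C S) * ((c + (r + q) ∸ S) C t)
  p = h + ((c + (r + q)) ∸ (c + r)) * d * ((c + 1 ∸ S) C t)
  q≡ : q ≡ (c + (r + q)) ∸ (c + r)
  q≡ = sym (trans (cong (_∸ (c + r)) (sym (+-assoc c r q))) (m+n∸m≡n (c + r) q))
  mid : q * (d * ((c + 0 ∸ s) C t)) ≡ ((c + (r + q)) ∸ (c + r)) * d * ((c + 1 ∸ S) C t)
  mid = trans (sym (*-assoc q d _)) (cong₂ (λ a b → a * d * (b C t)) q≡ drop-one)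
    where
    drop-one : c + 0 ∸ s ≡ c + 1 ∸ S
    drop-one = trans (cong (_∸ s) (+-identityʳ c)) (cong (_∸ S) (+-comm 1 c))
  y≡ : y ∸ x + x ≡ y → y * z ≡ (y ∸ x) * z + x * z
  y≡ e = trans (cong (_* z) (sym e)) (*-distribʳ-+ z (y ∸ x) x)

private
  -- Up to s the truncated argument stays 0, where the binomial vanishes, so truncation only
  -- prepends zeros to a convex nonnegative sequence.
  shifted-C-convex : ∀ s t y → Convex₃ ((y ∸ s) C suc t) ((suc y ∸ s) C suc t) ((suc (suc y) ∸ s) C suc t)
  shifted-C-convex zero    t y       = C-convex (suc t) y
  shifted-C-convex (suc s) t (suc y) = shifted-C-convex s t y
  shifted-C-convex (suc s) t zero    = subst (λ x → Convex₃ 0 (x C suc t) ((1 ∸ s) C suc t)) (sym (0∸n≡0 s)) (convex z≤n)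

  -- For s ≥ 2 the second difference is `y C (s − 2)` minus `c C (s − 2)`, nonnegative because c ≤
  -- y. To avoid subtraction all three gaps are written in terms of the smallest one, o, and the
  -- comparison becomes an instance of `C-gap-mono`.
  gap-convex : ∀ s c y → suc (suc c) ≤ y →
    Convex₃ ((suc (suc y) C s) ∸ (c C s)) ((suc y C s) ∸ (suc c C s)) ((y C s) ∸ (suc (suc c) C s))
  gap-convex zero    c y c+2≤y = convex z≤n
  gap-convex (suc s) c y c+2≤y with m≤n⇒∃[o]m+o≡n (C-mono (suc s) c+2≤y)
  ... | o , e = convex (subst₂ _≤_ (sym (cong₂ _+_ mid mid)) (sym (cong₂ _+_ left right))
                  (≤-trans (≤-reflexive (shuffle₁ (y C s) (suc c C s) o))
                    (≤-trans (+-monoˡ-≤ _ (C-gap-mono s (≤-trans (n≤1+n c) (≤-trans (n≤1+n _) c+2≤y))))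
                      (≤-reflexive (shuffle₂ (suc y C s) (c C s) (y C s) (suc c C s) o)))))
    where
    x = c C suc s
    Y≡ : y C suc s ≡ x + (c C s + (suc c C s) + o)
    Y≡ = trans (sym e) (trans (cong (_+ o) (trans (pascal (suc c) s) (cong (suc c C s +_) (pascal c s))))
                         (shuffle (suc c C s) (c C s) x o))
      where
      shuffle : ∀ p q x o → p + (q + x) + o ≡ x + (q + p + o)
      shuffle = solve-∀
    right : (y C suc s) ∸ (suc (suc c) C suc s) ≡ o
    right = trans (cong (_∸ (suc (suc c) C suc s)) (sym e)) (m+n∸m≡n (suc (suc c) C suc s) o)
    mid : (suc y C suc s) ∸ (suc c C suc s) ≡ (y C s) + (suc c C s) + o
    mid = trans (cong (_∸ (suc c C suc s)) (trans (pascal y s) (trans (cong (y C s +_) Y≡)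
            (trans (shuffle (y C s) x (c C s) (suc c C s) o) (cong (_+ ((y C s) + (suc c C s) + o)) (sym (pascal c s)))))))
          (m+n∸m≡n (suc c C suc s) _)
      where
      shuffle : ∀ b x p q o → b + (x + (p + q + o)) ≡ (p + x) + (b + q + o)
      shuffle = solve-∀
    left : (suc (suc y) C suc s) ∸ x ≡ (suc y C s) + (y C s) + (c C s) + (suc c C s) + o
    left = trans (cong (_∸ x) (trans (pascal (suc y) s) (trans (cong (suc y C s +_) (trans (pascal y s) (cong (y C s +_) Y≡)))
             (shuffle (suc y C s) (y C s) x (c C s) (suc c C s) o)))) (m+n∸m≡n x _)
      where
      shuffle : ∀ a b x p q o → a + (b + (x + (p + q + o))) ≡ x + (a + b + p + q + o)
      shuffle = solve-∀
    shuffle₁ : ∀ b q o → (b + q + o) + (b + q + o) ≡ (b + q) + (b + q + o + o)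
    shuffle₁ = solve-∀
    shuffle₂ : ∀ a p b q o → (a + p) + (b + q + o + o) ≡ (a + b + p + q + o) + o
    shuffle₂ = solve-∀

-- The first two summands are products of increasing convex factors, the third of decreasing ones.
-- The bound on c keeps c + 2 ≤ k - (c + 2), so that the truncated difference in the third is a true
-- difference at all three points.
value-convex : ∀ n k s t c → suc (suc c) + suc (suc c) ≤ k → k ≤ n →
               Convex₃ (value n k (suc s) (suc t) c) (value n k (suc s) (suc t) (suc c)) (value n k (suc s) (suc t) (suc (suc c)))
value-convex n k s t c 2c≤k k≤n with m≤n⇒∃[o]m+o≡n (≤-trans (m≤m+n (suc (suc c)) _) 2c≤k) | m≤n⇒∃[o]m+o≡n k≤n
... | y , refl | o , refl = convex-+ (convex-+ hubs outer) clique
  where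
  c+2≤y : suc (suc c) ≤ y
  c+2≤y = +-cancelˡ-≤ (suc (suc c)) _ _ 2c≤k
  hubs : Convex₃ ((c C suc s) * _) ((suc c C suc s) * _) ((suc (suc c) C suc s) * _)
  hubs = convex-* (C-mono (suc s) (n≤1+n c)) ≤-refl (C-convex (suc s) c) constant

  K = suc (suc c) + y
  K≡₀ : K ≡ c + suc (suc y)
  K≡₀ = sym (trans (+-suc c (suc y)) (cong suc (+-suc c y)))
  K≡₁ : K ≡ suc c + suc y
  K≡₁ = cong suc (sym (+-suc c y))
  k∸c : K ∸ c ≡ suc (suc y)
  k∸c = trans (cong (_∸ c) K≡₀) (m+n∸m≡n c (suc (suc y)))
  k∸c+1 : K ∸ suc c ≡ suc y
  k∸c+1 = trans (cong (_∸ suc c) K≡₁) (m+n∸m≡n (suc c) (suc y))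
  k∸c+2 : K ∸ suc (suc c) ≡ y
  k∸c+2 = m+n∸m≡n (suc (suc c)) y

  -- By trinomial revision the outer term is (n − k + c) (c C (s + t)) times a constant.
  outer-≡ : ∀ c m l → (K + o) ∸ m ≡ l → ((K + o) ∸ m) * (c C s) * ((c + 1 ∸ suc s) C suc t)
            ≡ l * ((c C (s + suc t)) * ((s + suc t) C suc t))
  outer-≡ c m l e = trans (cong₂ (λ a b → a * (c C s) * (b C suc t)) e (cong (_∸ suc s) (+-comm c 1)))
    (trans (*-assoc l (c C s) _) (cong (l *_) (trinomial c s (suc t))))
  n∸ : ∀ c y → (c + y) + o ∸ y ≡ c + o
  n∸ c y = trans (cong (_∸ y) (shuffle c y o)) (m+n∸m≡n y (c + o))
    where
    shuffle : ∀ c y o → (c + y) + o ≡ y + (c + o)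
    shuffle = solve-∀
  linear : ∀ x → suc x + suc x ≡ x + suc (suc x)
  linear = solve-∀
  n∸₀ : (K + o) ∸ (K ∸ c) ≡ c + o
  n∸₀ = trans (cong₂ (λ a b → (a + o) ∸ b) K≡₀ k∸c) (n∸ c (suc (suc y)))
  n∸₁ : (K + o) ∸ (K ∸ suc c) ≡ suc c + o
  n∸₁ = trans (cong₂ (λ a b → (a + o) ∸ b) K≡₁ k∸c+1) (n∸ (suc c) (suc y))
  n∸₂ : (K + o) ∸ (K ∸ suc (suc c)) ≡ suc (suc c) + o
  n∸₂ = trans (cong ((K + o) ∸_) k∸c+2) (n∸ (suc (suc c)) y)

  outer : Convex₃ (((K + o) ∸ (K ∸ c)) * (c C s) * ((c + 1 ∸ suc s) C suc t))
                  (((K + o) ∸ (K ∸ suc c)) * (suc c C s) * ((suc c + 1 ∸ suc s) C suc t))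
                  (((K + o) ∸ (K ∸ suc (suc c))) * (suc (suc c) C s) * ((suc (suc c) + 1 ∸ suc s) C suc t))
  outer rewrite outer-≡ c (K ∸ c) (c + o) n∸₀ | outer-≡ (suc c) (K ∸ suc c) (suc c + o) n∸₁
              | outer-≡ (suc (suc c)) (K ∸ suc (suc c)) (suc (suc c) + o) n∸₂ =
    convex-* (n≤1+n (c + o)) (*-monoˡ-≤ _ (C-mono (s + suc t) (n≤1+n c)))
      (convex (≤-reflexive (linear (c + o))))
      (convex-* (C-mono (s + suc t) (n≤1+n c)) ≤-refl (C-convex (s + suc t) c) constant)

  clique : Convex₃ (((K ∸ c) C suc s ∸ c C suc s) * ((K ∸ c ∸ suc s) C suc t))
                   (((K ∸ suc c) C suc s ∸ suc c C suc s) * ((K ∸ suc c ∸ suc s) C suc t))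
                   (((K ∸ suc (suc c)) C suc s ∸ suc (suc c) C suc s) * ((K ∸ suc (suc c) ∸ suc s) C suc t))
  -- Both factors decrease in c, so the three points are read backwards to meet the monotonicity
  -- hypotheses of `convex-*`.
  clique rewrite k∸c | k∸c+1 | k∸c+2 = convex-sym (convex-*
    (∸-mono (C-mono (suc s) (n≤1+n y)) (C-mono (suc s) (n≤1+n (suc c))))
    (C-mono (suc t) (∸-monoˡ-≤ (suc s) (n≤1+n y)))
    (convex-sym (gap-convex (suc s) c y c+2≤y))
    (shifted-C-convex (suc s) t y))

-- The two ends of the range and the extremal number

value-zero : ∀ n k s t → value n k (suc s) (suc (suc t)) 0 ≡
             (k C (suc s + suc (suc t))) * ((suc s + suc (suc t)) C suc (suc t))
value-zero n k s t = trans (cong (_+ (k C suc s) * ((k ∸ suc s) C suc (suc t))) outer≡0) (trinomial k (suc s) (suc (suc t)))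
  where
  -- The factor `0 C s` is 1 when s is 0; the product vanishes because no vertices remain from which
  -- to take the leaves.
  outer≡0 : (n ∸ k) * (0 C s) * ((0 ∸ s) C suc (suc t)) ≡ 0
  outer≡0 = trans (cong (λ x → (n ∸ k) * (0 C s) * (x C suc (suc t))) (0∸n≡0 s)) (*-zeroʳ ((n ∸ k) * (0 C s)))

/2≡⌊/2⌋ : ∀ n → n / 2 ≡ ⌊ n /2⌋
/2≡⌊/2⌋ zero          = refl
/2≡⌊/2⌋ (suc zero)    = refl
/2≡⌊/2⌋ (suc (suc n)) = trans (+-distrib-/-∣ˡ {2} n ∣-refl) (cong suc (/2≡⌊/2⌋ n))

module _ (k : ℕ) where
  half : ℕ
  half = k / 2

  -- With K = `suc k` this is b = K - a: the second term of the bound is the threshold graph with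
  -- the largest admissible number a of hubs and a clique on b vertices.
  half-complement : suc k ∸ half ≡ (suc k + 2) / 2
  half-complement = trans (cong (_∸ half) (sym total)) (m+n∸m≡n half ((suc k + 2) / 2))
    where
    total : half + (suc k + 2) / 2 ≡ suc k
    total = trans (cong₂ _+_ (/2≡⌊/2⌋ k) (trans (/2≡⌊/2⌋ (suc k + 2)) (cong ⌊_/2⌋ (+-comm (suc k) 2))))
                  (trans (+-suc ⌊ k /2⌋ ⌈ k /2⌉) (cong suc (⌊n/2⌋+⌈n/2⌉≡n k)))

  2half<suc : half + half < suc k
  2half<suc = s≤s (subst₂ (λ a b → a + b ≤ k) (sym (/2≡⌊/2⌋ k)) (sym (/2≡⌊/2⌋ k))
    (≤-trans (+-monoʳ-≤ ⌊ k /2⌋ (⌊n/2⌋≤⌈n/2⌉ k)) (≤-reflexive (⌊n/2⌋+⌈n/2⌉≡n k))))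

  ≤half : ∀ {c} → c + c < suc k → c ≤ half
  ≤half {c} (s≤s 2c≤k) = subst₂ _≤_ (sym (n≡⌊n+n/2⌋ c)) (sym (/2≡⌊/2⌋ k)) (⌊n/2⌋-mono 2c≤k)

bound≡ : ∀ n k s t → bound n (suc k) (suc s) (suc (suc t)) ≡
         value n (suc k) (suc s) (suc (suc t)) 0 ⊔ value n (suc k) (suc s) (suc (suc t)) (half k)
bound≡ n k s t rewrite value-zero n (suc k) s t | half-complement k = refl

labellings-thresholdG : ∀ n m c s t → labellings (adj (thresholdG n m c)) s t ≡ labellings (threshold {n} m c) s t
labellings-thresholdG n m c s t = ≤-antisym
  (labellings-mono {n} {adj (thresholdG n m c)} {threshold m c} (λ u v _ e → proj₂ (∧-⁻ {not (eqF u v)} e)) s t)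
  (labellings-mono {n} {threshold m c} {adj (thresholdG n m c)} (λ u v u≢v e → ∧-⁺ (cong not (eqF-≢ u≢v)) e) s t)

extremal : ∀ n k s t c → c + c < k → k ≤ n → 2 ≤ t →
           LFree k (thresholdG n (k ∸ c) c) × copies (Kstar (suc s) t) (thresholdG n (k ∸ c) c) ≡ value n k (suc s) t c
extremal n k s t c 2c<k k≤n 2≤t =
  unique-score⇒LFree (thresholdG n (k ∸ c) c) (λ {vs} u →
    subst (score (adj (thresholdG n (k ∸ c) c)) vs <_) c+m≡k
      (threshold-score c (k ∸ c) (subst (c + c <_) (sym c+m≡k) 2c<k) (m+n≤o⇒m≤o∸n c (<⇒≤ 2c<k)) u)) ,
  trans (copies≡labellings (thresholdG n (k ∸ c) c) 2≤t)
    (trans (labellings-thresholdG n (k ∸ c) c (suc s) t) (labellings-value n k s t c 2c<k k≤n))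
  where
  c+m≡k : c + (k ∸ c) ≡ k
  c+m≡k = m+[n∸m]≡n (≤-trans (m≤m+n c c) (<⇒≤ 2c<k))

theorem1p6 : (n k s t : ℕ) → 1 ≤ s → 2 ≤ t → 1 ≤ k → k + 1 ≤ n →
    IsExL n k (Kstar s t) (bound n k s t)
theorem1p6 n (suc k) (suc s) (suc (suc t)) _ 2≤t@(s≤s (s≤s _)) _ k+1≤n = upper , lower
  where
  K S T′ a : ℕ
  K = suc k
  S = suc s
  T′ = suc (suc t)
  a = half k
  k<n : K < n
  k<n = subst (_≤ n) (+-comm K 1) k+1≤n
  V : ℕ → ℕ
  V = value n K S T′
  upper : (G : Graph n) → LFree K G → copies (Kstar S T′) G ≤ bound n K S T′
  upper G free =
    let G′ , shifted , sc , le = stabilise G (LFree⇒Scores< G (≤-trans (s≤s z≤n) k<n) free)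
        c , 2c<k , covered = shifted⇒threshold G′ k<n shifted sc in begin
    copies (Kstar S T′) G                        ≡⟨ copies≡labellings G 2≤t ⟩
    labellings (adj G) S T′                      ≤⟨ le S T′ ⟩
    labellings (adj G′) S T′                     ≤⟨ labellings-mono {E = adj G′} {threshold (K ∸ c) c} covered S T′ ⟩
    labellings (threshold {n} (K ∸ c) c) S T′    ≡⟨ labellings-value n K s T′ c 2c<k (<⇒≤ k<n) ⟩
    V c                                          ≤⟨ convex-≤-max V a (λ c le → value-convex n K s (suc t) c
                                                      (≤-trans (+-mono-≤ le le) (<⇒≤ (2half<suc k))) (<⇒≤ k<n)) c (≤half k 2c<k) ⟩
    V 0 ⊔ V a                                    ≡⟨ bound≡ n k s t ⟨
    bound n K S T′                               ∎
    where open ≤-Reasoning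
  lower : Σ (Graph n) λ G → LFree K G × copies (Kstar S T′) G ≡ bound n K S T′
  lower with ⊔-sel (V 0) (V a)
  ... | inj₁ e = let free , eq = extremal n K s T′ 0 (s≤s z≤n) (<⇒≤ k<n) 2≤t in
                 thresholdG n (K ∸ 0) 0 , free , trans eq (sym (trans (bound≡ n k s t) e))
  ... | inj₂ e = let free , eq = extremal n K s T′ a (2half<suc k) (<⇒≤ k<n) 2≤t in
                 thresholdG n (K ∸ a) a , free , trans eq (sym (trans (bound≡ n k s t) e))
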